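{- For $j=7,10$ and every $n\ge 1$ the genus distribution of ${\cal S}_j^n$ is unimodal. Writing $p_j(n)$ for the peak of the genus distribution of ${\cal S}_j^n$, one has $$p_7(n)=\begin{cases}\Big[\dfrac{n}{2}\Big], & 2\le n\le 7,\\[2mm] 3, & n=8,\\[1mm] \Big[\dfrac{n+1}{3}\Big]+1, & n\ge 9,\end{cases}$$ and $$p_{10}(n)=\begin{cases}\Big[\dfrac{n+1}{2}\Big], & 1\le n\le 6,\\[2mm] 3, & n=7,\\[1mm] \Big[\dfrac{n+2}{3}\Big]+1, & n\ge 8.\end{cases}$$
   Context: $[x]$ denotes the largest integer not exceeding $x$. A surface is represented by a cyclic word in which every occurring letter $x$ appears exactly once as $x$ and exactly once as $x^-$; it is the closed orientable surface obtained from a polygon with boundary labelled by the word by identifying each side $x$ with the side $x^-$ (orientation reversed), and its genus is the genus of that surface. Let $a,b,a_1,a_2,\dots$ be distinct letters. For $n\ge 1$ and subsets $K,T\subseteq\{1,\dots,n\}$ put: $R_1^n$ = product of the letters $a_k$, $k\in K$, in decreasing order of index; $R_2^n$ = product of the $a_k$, $k\notin K$, in increasing order of index; $R_3^n$ = product of the $a_t^-$, $t\in T$, in decreasing order of index; $R_4^n$ = product of the $a_t^-$, $t\notin T$, in increasing order of index. The sets of ladder surfaces considered are ${\cal S}_7^n=\{aR_1^na^-R_3^nR_2^nR_4^n\}$ and ${\cal S}_{10}^n=\{R_1^nR_4^naR_2^na^-bR_3^nb^-\}$, where $(K,T)$ runs over all $4^n$ pairs of subsets and surfaces are counted with multiplicity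 (one for each pair). The genus distribution of ${\cal S}_j^n$ is the sequence $(g_{i_j}(n))_i$, where $g_{i_j}(n)$ is the number of surfaces of genus $i$ in ${\cal S}_j^n$ and $i$ runs from the minimum to the maximum genus. A finite sequence of nonnegative numbers $\{a_i\}_{i=q}^n$ is unimodal if $a_q\le\cdots\le a_{l-1}<a_l=\cdots=a_m>a_{m+1}\ge\cdots\ge a_n$ for some $q\le l\le m\le n$; if $l=m$, then $m$ is called the peak (indices are genera). -}

module Defs where

open import Data.Fin using (Fin; toℕ; _≤_; _≤?_)
open import Data.Fin.Properties using (any?; all?; nonZeroIndex) renaming (_≟_ to _≟ᶠ_)
open import Data.Fin.Subset using (Subset; inside; outside; ∁)
open import Data.Fin.Subset.Properties using (_∈?_)
open import Data.Integer as ℤ using (ℤ; +_)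
import Data.Integer.Properties as ℤₚ
open import Data.List using (List; []; _∷_; [_]; _++_; map; filter; length; lookup; reverse; allFin; cartesianProduct; foldr)
open import Data.List.Membership.Propositional using () renaming (_∈_ to _∈ˡ_)
open import Data.List.Membership.Propositional.Properties using (∈-filter⁺; ∈-filter⁻; ∈-cartesianProduct⁺; ∈-allFin)
open import Data.List.Relation.Unary.Any using (here; there)
open import Data.Nat as ℕ using (ℕ; zero; suc)
open import Data.Nat.DivMod using (_mod_)
import Data.Nat.Properties as ℕₚ
open import Data.Product using (_×_; _,_; proj₂; ∃₂; uncurry)
open import Data.Sum using (_⊎_; inj₁; inj₂)
open import Data.Vec as Vec using (Vec) renaming ([] to []ᵛ; _∷_ to _∷ᵛ_)
open import Data.Vec.Properties using (lookup-map; lookup-allFin)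
open import Function using (id)
open import Relation.Binary using (Rel; Decidable; DecidableEquality)
open import Relation.Binary.Construct.Closure.Equivalence as Eq using (EqClosure)
import Relation.Binary.Construct.On as On
open import Relation.Binary.PropositionalEquality using (_≡_; refl; sym; trans; cong; isEquivalence)
open import Relation.Nullary using (yes; no; contradiction)
open import Relation.Nullary.Decidable using (map′; _×-dec_; _⊎-dec_; _→-dec_)
import Relation.Unary as U

module Closure {n : ℕ} where

  -- Naive union–find: every point carries a label, and joining p and q
  -- relabels the class of q by the label of p.
  relabel : (old new l : Fin n) → Fin n
  relabel old new l with l ≟ᶠ old
  ... | yes _ = new
  ... | no  _ = l

  merge : Fin n → Fin n → Vec (Fin n) n → Vec (Fin n) n
  merge p q L = Vec.map (relabel (Vec.lookup L q) (Vec.lookup L p)) L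

  labels : List (Fin n × Fin n) → Vec (Fin n) n
  labels = foldr (uncurry merge) (Vec.allFin n)

  label : List (Fin n × Fin n) → Fin n → Fin n
  label ps = Vec.lookup (labels ps)

  private
    Listed : List (Fin n × Fin n) → Rel (Fin n) _
    Listed ps x y = (x , y) ∈ˡ ps

    label-∷ : ∀ p q ps x → label ((p , q) ∷ ps) x ≡ relabel (label ps q) (label ps p) (label ps x)
    label-∷ p q ps x = lookup-map x _ (labels ps)

    relabel-joins : ∀ o l → relabel o l l ≡ relabel o l o
    relabel-joins o l with l ≟ᶠ o | o ≟ᶠ o
    ... | yes _ | yes _ = refl
    ... | no  _ | yes _ = refl
    ... | _     | no ¬r = contradiction refl ¬r

    complete : ∀ ps {x y} → Listed ps x y → label ps x ≡ label ps y
    complete ((p , q) ∷ ps) (here refl) =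
      trans (label-∷ p q ps p) (trans (relabel-joins (label ps q) (label ps p)) (sym (label-∷ p q ps q)))
    complete ((p , q) ∷ ps) {x} {y} (there i) =
      trans (label-∷ p q ps x) (trans (cong (relabel (label ps q) (label ps p)) (complete ps i)) (sym (label-∷ p q ps y)))

    sound : ∀ ps {x y} → label ps x ≡ label ps y → EqClosure (Listed ps) x y
    sound [] {x} {y} e with refl ← trans (sym (lookup-allFin x)) (trans e (lookup-allFin y)) =
      Eq.reflexive _
    sound ((p , q) ∷ ps) {x} {y} e
      with label ps x ≟ᶠ label ps q | label ps y ≟ᶠ label ps q
         | trans (sym (label-∷ p q ps x)) (trans e (label-∷ p q ps y))
    ... | yes s | yes t | _ = Eq.map there (sound ps (trans s (sym t)))
    ... | no  _ | no  _ | e′ = Eq.map there (sound ps e′)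
    ... | yes s | no  _ | e′ =
      Eq.transitive _ (Eq.map there (sound ps s))
        (Eq.transitive _ (Eq.symmetric _ (Eq.return (here refl))) (Eq.map there (sound ps e′)))
    ... | no  _ | yes t | e′ =
      Eq.transitive _ (Eq.map there (sound ps e′))
        (Eq.transitive _ (Eq.return (here refl)) (Eq.map there (sound ps (sym t))))

  eqClosure? : ∀ {ℓ} {R : Rel (Fin n) ℓ} → Decidable R → Decidable (EqClosure R)
  eqClosure? {R = R} R? x y = map′ to from (label ps x ≟ᶠ label ps y)
    where
    R′? : U.Decidable (uncurry R)
    R′? (u , v) = R? u v

    all-pairs ps : List (Fin n × Fin n)
    all-pairs = cartesianProduct (allFin n) (allFin n)
    ps        = filter R′? all-pairs

    to : label ps x ≡ label ps y → EqClosure R x y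
    to e = Eq.map (λ i → proj₂ (∈-filter⁻ R′? {xs = all-pairs} i)) (sound ps e)

    from : EqClosure R x y → label ps x ≡ label ps y
    from = Eq.fold (On.isEquivalence (label ps) isEquivalence)
      (λ {u} {v} r → complete ps
        (∈-filter⁺ R′? (∈-cartesianProduct⁺ (∈-allFin u) (∈-allFin v)) r))

open Closure using (eqClosure?)

data Letter : Set where
  a b : Letter
  a⟨_⟩ : ℕ → Letter

data Symbol : Set where
  _⁺ _⁻ : Letter → Symbol

infix 9 _⁺ _⁻

-- A list stands for its cyclic class; everything below treats the last
-- position as adjacent to the first.
Word : Set
Word = List Symbol

opposite : Symbol → Symbol
opposite (x ⁺) = x ⁻
opposite (x ⁻) = x ⁺

_≟ˡ_ : DecidableEquality Letter
a      ≟ˡ a      = yes refl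
a      ≟ˡ b      = no λ ()
a      ≟ˡ a⟨ _ ⟩ = no λ ()
b      ≟ˡ a      = no λ ()
b      ≟ˡ b      = yes refl
b      ≟ˡ a⟨ _ ⟩ = no λ ()
a⟨ _ ⟩ ≟ˡ a      = no λ ()
a⟨ _ ⟩ ≟ˡ b      = no λ ()
a⟨ i ⟩ ≟ˡ a⟨ j ⟩ = map′ (cong a⟨_⟩) (λ { refl → refl }) (i ℕₚ.≟ j)

_≟ˢ_ : DecidableEquality Symbol
(x ⁺) ≟ˢ (y ⁺) = map′ (cong _⁺) (λ { refl → refl }) (x ≟ˡ y)
(x ⁺) ≟ˢ (y ⁻) = no λ ()
(x ⁻) ≟ˢ (y ⁺) = no λ ()
(x ⁻) ≟ˢ (y ⁻) = map′ (cong _⁻) (λ { refl → refl }) (x ≟ˡ y)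

data Positive : Symbol → Set where
  positive : ∀ {x} → Positive (x ⁺)

positive? : U.Decidable Positive
positive? (_ ⁺) = yes positive
positive? (_ ⁻) = no λ ()

next : ∀ {n} → Fin n → Fin n
next {n} i = (suc (toℕ i) mod n) {{nonZeroIndex i}}

module Polygon (w : Word) where

  -- Side i of the polygon runs from corner i to corner next i, both
  -- sides and corners being numbered by the positions of w.
  Side Corner : Set
  Side   = Fin (length w)
  Corner = Fin (length w)

  Paired : Rel Side _
  Paired i j = lookup w j ≡ opposite (lookup w i)

  -- Paired sides are identified with orientation reversed: the start of
  -- one is glued to the end of the other.
  Glued : Rel Corner _
  Glued c d = ∃₂ λ i j → Paired i j × ((c ≡ i × d ≡ next j) ⊎ (c ≡ next i × d ≡ j))

  glued? : Decidable Glued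
  glued? c d = any? λ i → any? λ j → (lookup w j ≟ˢ opposite (lookup w i)) ×-dec
    (((c ≟ᶠ i) ×-dec (d ≟ᶠ next j)) ⊎-dec ((c ≟ᶠ next i) ×-dec (d ≟ᶠ j)))

  -- Corners which become the same vertex of the surface.
  _∼_ : Rel Corner _
  _∼_ = EqClosure Glued

  _∼?_ : Decidable _∼_
  _∼?_ = eqClosure? glued?

  -- Each vertex is counted through the least corner in its class.
  Least : Corner → Set
  Least c = ∀ d → d ∼ c → c ≤ d

  least? : U.Decidable Least
  least? c = all? λ d → (d ∼? c) →-dec (c ≤? d)

  #vertices #edges : ℕ
  #vertices = length (filter least? (allFin (length w)))
  #edges    = length (filter positive? w)

  -- The polygon is the only face.
  χ : ℤ
  χ = + #vertices ℤ.- + #edges ℤ.+ + 1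

open Polygon using (χ) public

HasGenus : Word → ℕ → Set
HasGenus w g = χ w ≡ + 2 ℤ.- + (2 ℕ.* g)

hasGenus? : Decidable HasGenus
hasGenus? w g = χ w ℤₚ.≟ + 2 ℤ.- + (2 ℕ.* g)

-- Every subset occurs exactly once.
subsets : ∀ n → List (Subset n)
subsets zero    = [ []ᵛ ]
subsets (suc n) = map (outside ∷ᵛ_) (subsets n) ++ map (inside ∷ᵛ_) (subsets n)

-- Position k : Fin n of a subset represents the index toℕ k + 1 ∈ {1,…,n}.
increasing decreasing : ∀ {n} → Subset n → List Letter
increasing {n} K = map (λ k → a⟨ suc (toℕ k) ⟩) (filter (_∈? K) (allFin n))
decreasing K     = reverse (increasing K)

module _ {n : ℕ} (K T : Subset n) where

  R₁ R₂ R₃ R₄ : Word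
  R₁ = map _⁺ (decreasing K)
  R₂ = map _⁺ (increasing (∁ K))
  R₃ = map _⁻ (decreasing T)
  R₄ = map _⁻ (increasing (∁ T))

  surface₇ surface₁₀ : Word
  surface₇  = [ a ⁺ ] ++ R₁ ++ [ a ⁻ ] ++ R₃ ++ R₂ ++ R₄
  surface₁₀ = R₁ ++ R₄ ++ [ a ⁺ ] ++ R₂ ++ [ a ⁻ ] ++ [ b ⁺ ] ++ R₃ ++ [ b ⁻ ]

-- One entry per pair (K , T), so surfaces are counted with multiplicity.
S₇ S₁₀ : ℕ → List Word
S₇  n = map (uncurry surface₇)  (cartesianProduct (subsets n) (subsets n))
S₁₀ n = map (uncurry surface₁₀) (cartesianProduct (subsets n) (subsets n))

genusCount : List Word → ℕ → ℕ
genusCount S i = length (filter (λ w → hasGenus? w i) S)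

IsMinGenus IsMaxGenus : List Word → ℕ → Set
IsMinGenus S q = 0 ℕ.< genusCount S q × (∀ i → 0 ℕ.< genusCount S i → q ℕ.≤ i)
IsMaxGenus S r = 0 ℕ.< genusCount S r × (∀ i → 0 ℕ.< genusCount S i → i ℕ.≤ r)

-- f q ≤ ⋯ ≤ f (l - 1) < f l = ⋯ = f m > f (m + 1) ≥ ⋯ ≥ f r.
record UnimodalWith (f : ℕ → ℕ) (q r l m : ℕ) : Set where
  field
    q≤l     : q ℕ.≤ l
    l≤m     : l ℕ.≤ m
    m≤r     : m ℕ.≤ r
    ascent  : ∀ i → q ℕ.≤ i → suc i ℕ.< l → f i ℕ.≤ f (suc i)
    jump    : ∀ i → q ℕ.≤ i → suc i ≡ l → f i ℕ.< f l
    plateau : ∀ i → l ℕ.≤ i → i ℕ.< m → f i ≡ f (suc i)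
    drop    : m ℕ.< r → f (suc m) ℕ.< f m
    descent : ∀ i → m ℕ.< i → i ℕ.< r → f (suc i) ℕ.≤ f i

Unimodal : (f : ℕ → ℕ) (q r : ℕ) → Set
Unimodal f q r = ∃₂ λ l m → UnimodalWith f q r l m

Peak : (f : ℕ → ℕ) (q r p : ℕ) → Set
Peak f q r p = UnimodalWith f q r p p

-- The genus distribution of S is genusCount S restricted to the genera
-- from the minimum q to the maximum r.
UnimodalDistribution : List Word → Set
UnimodalDistribution S =
  ∃₂ λ q r → IsMinGenus S q × IsMaxGenus S r × Unimodal (genusCount S) q r

DistributionPeak : List Word → ℕ → Set
DistributionPeak S p =
  ∃₂ λ q r → IsMinGenus S q × IsMaxGenus S r × Peak (genusCount S) q r p

{-# OPTIONS --safe #-}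
-- A labelling of the corners of the polygon by Bool which respects the gluing is
-- the same as a pair of Bools for each letter (the labels of its two ends) that
-- fits together around the word, so the number of such families is 2 to the power
-- of the number of vertices.  In a ladder surface the letters aₖ can be summed out
-- one index at a time: each one either swaps two of the four current corners, or
-- identifies two of them and opens a new pair.  Hence only the matching of these
-- corners with each other and with two outer corners matters, six matchings occur,
-- and the genus distributions satisfy a linear recursion with six states.  Its
-- solution is, with e = n + 1 - 2j and L n j = C(n-j, j) + C(n-j+1, j),
--   F n (j+1) = 8^j ((2^e - 1) L n j + 8 L n (j+1)),
-- where F n is the distribution of S₇ (n+1) and, away from genus 0 and 1, four
-- times that of S₁₀ n.  The ratio L n (j+1) / L n j is a rational function of e
-- and j that crosses 1/2 exactly between e = j + 2 and e = j + 1, and this puts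
-- the peak at j = [(n+2)/3], that is, genus j + 1, as soon as n ≥ 8.
module Submission where

open import Defs
open import Algebra.Properties.AbelianGroup using () renaming (∙-cancelˡ to cancelˡ)
open import Data.Bool using (Bool; true; false)
import Data.Bool.Properties as Bool
open import Data.Fin using (Fin; zero; suc; toℕ; fromℕ<)
import Data.Fin.Properties as Fin
open import Data.Fin.Subset using (Subset; inside; outside; ∁)
open import Data.Fin.Subset.Properties using (_∈?_; x∉p⇒x∈∁p)
import Data.Integer as ℤ
import Data.Integer.Properties as ℤ
import Data.Integer.Tactic.RingSolver as ℤ-Solver
open import Data.List using (List; []; _∷_; [_]; _++_; map; filter; length; lookup; reverse; allFin; tabulate; cartesianProductWith; cartesianProduct)
open import Data.List.Membership.Propositional using (_∈_)
open import Data.List.Membership.Propositional.Properties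
  using (∈-lookup; ∈-filter⁺; ∈-filter⁻; ∈-allFin; ∈-map⁺; ∈-map⁻; ∈-++⁺ˡ; ∈-++⁺ʳ; ∈-cartesianProductWith⁺)
open import Data.List.Properties
  using (map-++; map-∘; map-cong; map-tabulate; unfold-reverse; length-reverse; length-map; length-++; filter-++; filter-all; filter-none)
open import Data.List.Relation.Unary.All as All using (All; []; _∷_)
import Data.List.Relation.Unary.All.Properties as All
open import Data.List.Relation.Unary.AllPairs using ([]; _∷_)
open import Data.List.Relation.Unary.Any using (here; there; index)
open import Data.List.Relation.Unary.Any.Properties using (lookup-index; reverse⁺; reverse⁻)
open import Data.List.Relation.Unary.Unique.Propositional using (Unique)
import Data.List.Relation.Unary.Unique.Propositional.Properties as Unique
open import Data.Nat using (ℕ; zero; suc; pred; _+_; _*_; _∸_; _^_; _/_; _%_; ⌊_/2⌋; _≤_; _<_; z≤n; s≤s; _≤?_; _<?_; NonZero)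
open import Data.Nat.DivMod using (m<n⇒m%n≡m; n%n≡0; m≡m%n+[m/n]*n; m%n<n; m/n*n≤m; m*n/n≡m; /-monoˡ-≤)
open import Data.Nat.Induction using (<-wellFounded)
open import Data.Nat.ListAction using (sum)
open import Data.Nat.ListAction.Properties using (sum-++)
import Data.Nat.Properties as ℕ
open import Data.Nat.Tactic.RingSolver using (solve-∀)
open import Data.Product using (_×_; _,_; proj₁; proj₂; ∃; swap; uncurry)
open import Data.Sum using (_⊎_; inj₁; inj₂)
open import Data.Unit using (tt)
open import Data.Vec as Vec using (Vec; []; _∷_)
import Data.Vec.Properties as Vec
open import Function using (_∘_)
open import Induction.WellFounded using (Acc; acc)
open import Relation.Binary using (IsEquivalence)
import Relation.Binary.Construct.Closure.Equivalence as Eq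
import Relation.Binary.Construct.On as On
open import Relation.Binary.PropositionalEquality using (_≡_; refl; sym; trans; cong; cong₂; subst; isEquivalence)
open import Relation.Nullary using (Dec; yes; no; ¬_; contradiction)
open import Relation.Nullary.Decidable using (_×-dec_; _→-dec_; decidable-stable; toWitness)
open import Relation.Unary using (Decidable)
open ℕ.≤-Reasoning hiding (start)

-- The classes of glued corners are awkward to count directly, since one gluing can merge distant
-- corners. The number of labellings constant on these classes is instead a sum of products of
-- Kronecker deltas, one for each adjacency in the word, and can be evaluated locally. As `2 ^ m`
-- determines `m`, two labels are enough to recover the number of vertices. The threshold 1/2 comes
-- from the leading term `8 ^ j * 2 ^ e * L n j` of `F n (suc j)`: from one genus to the next
-- `8 ^ j` gains a factor 8 and `2 ^ e` loses a factor 4, so the leading term is multiplied by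
-- `2 * L n (suc j) / L n j`. The obstacle is the remainder `8 * L n (suc j) - L n j`, which is
-- comparable with the leading term when `e` is small. It forces separate estimates for rise and
-- drop, a finite check for small `e`, and the exceptional peak at `n = 7`. All identities are kept
-- in additive form, because truncated subtraction would not survive the inductions.

-- Finite counting: injections between lists, tuples of labels.

lookup-injective : ∀ {A : Set} {xs : List A} → Unique xs → ∀ {i j} → lookup xs i ≡ lookup xs j → i ≡ j
lookup-injective (_  ∷ _)  {zero}  {zero}  _ = refl
lookup-injective (px ∷ _)  {zero}  {suc j} e = contradiction e (All.lookup px (∈-lookup j))
lookup-injective (px ∷ _)  {suc i} {zero}  e = contradiction (sym e) (All.lookup px (∈-lookup i))
lookup-injective (_  ∷ uq) {suc i} {suc j} e = cong suc (lookup-injective uq e)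

injection⇒length≤ : ∀ {A B : Set} {xs : List A} {ys : List B} (f : A → B) → Unique xs →
  (∀ {x} → x ∈ xs → f x ∈ ys) → (∀ {x x′} → x ∈ xs → x′ ∈ xs → f x ≡ f x′ → x ≡ x′) →
  length xs ≤ length ys
injection⇒length≤ {xs = xs} {ys} f uq f∈ inj =
  Fin.injective⇒≤ {f = λ i → index (f∈ (∈-lookup {xs = xs} i))} λ {i} {j} e →
    lookup-injective uq (inj (∈-lookup i) (∈-lookup j)
      (trans (lookup-index (f∈ (∈-lookup i)))
        (trans (cong (lookup ys) e) (sym (lookup-index (f∈ (∈-lookup j)))))))

length-cartesianProductWith : ∀ {A B C : Set} (f : A → B → C) xs ys →
  length (cartesianProductWith f xs ys) ≡ length xs * length ys
length-cartesianProductWith f []       ys = refl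
length-cartesianProductWith f (x ∷ xs) ys = trans (length-++ (map (f x) ys))
  (cong₂ _+_ (length-map (f x) ys) (length-cartesianProductWith f xs ys))

tuples : ∀ {A : Set} → List A → ∀ n → List (Vec A n)
tuples xs zero    = [] ∷ []
tuples xs (suc n) = cartesianProductWith _∷_ xs (tuples xs n)

length-tuples : ∀ {A : Set} (xs : List A) n → length (tuples xs n) ≡ length xs ^ n
length-tuples xs zero    = refl
length-tuples xs (suc n) =
  trans (length-cartesianProductWith _∷_ xs (tuples xs n)) (cong (length xs *_) (length-tuples xs n))

tuples-unique : ∀ {A : Set} {xs : List A} → Unique xs → ∀ n → Unique (tuples xs n)
tuples-unique uq zero    = All.[] ∷ []
tuples-unique uq (suc n) = Unique.cartesianProductWith⁺ _∷_ Vec.∷-injective uq (tuples-unique uq n)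

∈-tuples : ∀ {A : Set} {xs : List A} → (∀ x → x ∈ xs) → ∀ {n} (v : Vec A n) → v ∈ tuples xs n
∈-tuples all []      = here refl
∈-tuples all (x ∷ v) = ∈-cartesianProductWith⁺ _∷_ (all x) (∈-tuples all v)

Bool² : Set
Bool² = Bool × Bool

bools : List Bool
bools = false ∷ true ∷ []

pairs : List Bool²
pairs = cartesianProduct bools bools

bools-unique : Unique bools
bools-unique = ((λ ()) All.∷ All.[]) ∷ All.[] ∷ []

∈-bools : ∀ x → x ∈ bools
∈-bools false = here refl
∈-bools true  = there (here refl)

pairs-unique : Unique pairs
pairs-unique = Unique.cartesianProduct⁺ bools-unique bools-unique

∈-pairs : ∀ p → p ∈ pairs
∈-pairs (x , y) = ∈-cartesianProductWith⁺ _,_ (∈-bools x) (∈-bools y)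

-- Reading `x ⁻` exchanges the ends of `x`, so the orientation-reversing identification of the two
-- sides is built into `ρ`. The only condition left is that consecutive sides fit together.
start end : (Letter → Bool²) → Symbol → Bool
start ρ (x ⁺) = proj₁ (ρ x)
start ρ (x ⁻) = proj₂ (ρ x)
end   ρ (x ⁺) = proj₂ (ρ x)
end   ρ (x ⁻) = proj₁ (ρ x)

-- Vertices of the glued polygon and consistent labellings.

module Vertices (w : Word) where
  open Polygon w public

  private
    uq = Unique.filter⁺ least? (Unique.allFin⁺ (length w))

    ∼-equiv : IsEquivalence _∼_
    ∼-equiv = Eq.isEquivalence Glued
    module ∼ = IsEquivalence ∼-equiv

    not-least : ∀ c → ¬ Least c → ∃ λ d → d ∼ c × toℕ d < toℕ c
    not-least c ¬p = below (Fin.¬∀⟶∃¬ _ _ (λ d → (d ∼? c) →-dec (c Fin.≤? d)) ¬p)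
      where
      below : (∃ λ d → ¬ (d ∼ c → toℕ c ≤ toℕ d)) → ∃ λ d → d ∼ c × toℕ d < toℕ c
      below (d , ¬q) = d
        , decidable-stable (d ∼? c) (λ ¬r → ¬q λ r → contradiction r ¬r)
        , ℕ.≰⇒> (λ le → ¬q λ _ → le)

    least-below : ∀ c → Acc _<_ (toℕ c) → ∃ λ d → d ∼ c × Least d
    least-below c (acc rs) = from (least? c)
      where
      further : (∃ λ d → d ∼ c × toℕ d < toℕ c) → ∃ λ d → d ∼ c × Least d
      further (d , r , lt) = let d′ , r′ , l = least-below d (rs lt) in d′ , ∼.trans r′ r , l
      from : Dec (Least c) → ∃ λ d → d ∼ c × Least d
      from (yes p) = c , ∼.refl , p
      from (no ¬p) = further (not-least c ¬p)

    least-unique : ∀ {c d} → c ∼ d → Least c → Least d → c ≡ d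
    least-unique r lc ld = Fin.≤-antisym (lc _ (∼.sym r)) (ld _ r)

  vertexRep : Fin #vertices → Corner
  vertexRep = lookup (filter least? (allFin (length w)))

  private
    vertexRep-least : ∀ v → Least (vertexRep v)
    vertexRep-least v = proj₂ (∈-filter⁻ least? {xs = allFin (length w)} (∈-lookup v))

    vertex : ∀ c → ∃ λ v → vertexRep v ∼ c
    vertex c = index i , subst (_∼ c) (lookup-index i) (proj₁ (proj₂ below))
      where
      below = least-below c (<-wellFounded _)
      i = ∈-filter⁺ least? (∈-allFin (proj₁ below)) (proj₂ (proj₂ below))

  vertexOf : Corner → Fin #vertices
  vertexOf = proj₁ ∘ vertex

  vertexRep∼ : ∀ c → vertexRep (vertexOf c) ∼ c
  vertexRep∼ = proj₂ ∘ vertex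

  vertexOf-cong : ∀ {c d} → c ∼ d → vertexOf c ≡ vertexOf d
  vertexOf-cong {c} {d} r = lookup-injective uq
    (least-unique (∼.trans (vertexRep∼ c) (∼.trans r (∼.sym (vertexRep∼ d))))
      (vertexRep-least _) (vertexRep-least _))

  vertexOf-vertexRep : ∀ v → vertexOf (vertexRep v) ≡ v
  vertexOf-vertexRep v = lookup-injective uq
    (least-unique (vertexRep∼ (vertexRep v)) (vertexRep-least _) (vertexRep-least v))

  Consistent : (Letter → Bool²) → Set
  Consistent ρ = ∀ i → end ρ (lookup w i) ≡ start ρ (lookup w (next i))

  consistent? : ∀ ρ → Dec (Consistent ρ)
  consistent? ρ = Fin.all? λ i → end ρ (lookup w i) Bool.≟ start ρ (lookup w (next i))

  -- Paired sides read the same value of `ρ` with the ends exchanged, so the start of one is the end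
  -- of the other; consistency passes this label on to the next corner.
  start-glued : ∀ {ρ} → Consistent ρ → ∀ {c d} → Glued c d → start ρ (lookup w c) ≡ start ρ (lookup w d)
  start-glued {ρ} cons (i , j , p , q) with lookup w i in wi | lookup w j in wj
  start-glued {ρ} cons (i , j , refl , inj₁ (refl , refl)) | x ⁺ | _ = 
    trans (cong (start ρ) wi) (trans (sym (cong (end ρ) wj)) (cons j))
  start-glued {ρ} cons (i , j , refl , inj₁ (refl , refl)) | x ⁻ | _ =
    trans (cong (start ρ) wi) (trans (sym (cong (end ρ) wj)) (cons j))
  start-glued {ρ} cons (i , j , refl , inj₂ (refl , refl)) | x ⁺ | _ =
    trans (sym (cons i)) (trans (cong (end ρ) wi) (sym (cong (start ρ) wj)))
  start-glued {ρ} cons (i , j , refl , inj₂ (refl , refl)) | x ⁻ | _ =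
    trans (sym (cons i)) (trans (cong (end ρ) wi) (sym (cong (start ρ) wj)))

  start-∼ : ∀ {ρ} → Consistent ρ → ∀ {c d} → c ∼ d → start ρ (lookup w c) ≡ start ρ (lookup w d)
  start-∼ {ρ} cons = Eq.fold (On.isEquivalence (start ρ ∘ lookup w) isEquivalence) (start-glued cons)

  -- There are infinitely many letters, so labellings are enumerated through tuples: `name` lists
  -- the letters of the word and `ρ` extends a tuple of labels for them to all letters.
  module _ {M : ℕ} (name : Fin M → Letter) (ρ : Vec Bool² M → Letter → Bool²)
    (ρ-name : ∀ θ k → ρ θ (name k) ≡ Vec.lookup θ k)
    (pos neg : Fin M → Side)
    (pos-name : ∀ k → lookup w (pos k) ≡ name k ⁺)
    (neg-name : ∀ k → lookup w (neg k) ≡ name k ⁻)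
    (named : ∀ i → ∃ λ k → lookup w i ≡ name k ⁺ ⊎ lookup w i ≡ name k ⁻) where

    private
      fromVertices : Vec Bool #vertices → Vec Bool² M
      fromVertices g = Vec.tabulate λ k →
        Vec.lookup g (vertexOf (pos k)) , Vec.lookup g (vertexOf (next (pos k)))

      toVertices : Vec Bool² M → Vec Bool #vertices
      toVertices θ = Vec.tabulate λ v → start (ρ θ) (lookup w (vertexRep v))

      ρ-from : ∀ g k → ρ (fromVertices g) (name k) ≡
        (Vec.lookup g (vertexOf (pos k)) , Vec.lookup g (vertexOf (next (pos k))))
      ρ-from g k = trans (ρ-name _ k) (Vec.lookup∘tabulate _ k)

      paired⁻ : ∀ k i → lookup w i ≡ name k ⁺ → Paired i (neg k)
      paired⁻ k i e = trans (neg-name k) (cong opposite (sym e))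
      paired⁺ : ∀ k i → lookup w i ≡ name k ⁻ → Paired (pos k) i
      paired⁺ k i e = trans e (cong opposite (sym (pos-name k)))

      glue : ∀ {c d} → Glued c d → c ∼ d
      glue = Eq.return

      start-from : ∀ g i → start (ρ (fromVertices g)) (lookup w i) ≡ Vec.lookup g (vertexOf i)
      start-from g i = at (named i)
        where
        at : (∃ λ k → lookup w i ≡ name k ⁺ ⊎ lookup w i ≡ name k ⁻) →
          start (ρ (fromVertices g)) (lookup w i) ≡ Vec.lookup g (vertexOf i)
        -- Both `pos k` and `i` carry `name k ⁺`, and both are glued to the corner `next (neg k)`;
        -- hence they are the same vertex.
        at (k , inj₁ e) = trans (cong (start _) e) (trans (cong proj₁ (ρ-from g k))
          (cong (Vec.lookup g) (vertexOf-cong (∼.trans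
            (glue (pos k , neg k , paired⁻ k (pos k) (pos-name k) , inj₁ (refl , refl)))
            (∼.sym (glue (i , neg k , paired⁻ k i e , inj₁ (refl , refl))))))))
        at (k , inj₂ e) = trans (cong (start _) e) (trans (cong proj₂ (ρ-from g k))
          (cong (Vec.lookup g) (vertexOf-cong (glue (pos k , i , paired⁺ k i e , inj₂ (refl , refl))))))

      end-from : ∀ g i → end (ρ (fromVertices g)) (lookup w i) ≡ Vec.lookup g (vertexOf (next i))
      end-from g i = at (named i)
        where
        at : (∃ λ k → lookup w i ≡ name k ⁺ ⊎ lookup w i ≡ name k ⁻) →
          end (ρ (fromVertices g)) (lookup w i) ≡ Vec.lookup g (vertexOf (next i))
        at (k , inj₁ e) = trans (cong (end _) e) (trans (cong proj₂ (ρ-from g k))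
          (cong (Vec.lookup g) (vertexOf-cong (∼.trans
            (glue (pos k , neg k , paired⁻ k (pos k) (pos-name k) , inj₂ (refl , refl)))
            (∼.sym (glue (i , neg k , paired⁻ k i e , inj₂ (refl , refl))))))))
        at (k , inj₂ e) = trans (cong (end _) e) (trans (cong proj₁ (ρ-from g k))
          (cong (Vec.lookup g) (vertexOf-cong (glue (pos k , i , paired⁺ k i e , inj₁ (refl , refl))))))

      from-consistent : ∀ g → Consistent (ρ (fromVertices g))
      from-consistent g i = trans (end-from g i) (sym (start-from g (next i)))

      to∘from : ∀ g → toVertices (fromVertices g) ≡ g
      to∘from g = trans
        (Vec.tabulate-cong λ v → trans (start-from g (vertexRep v)) (cong (Vec.lookup g) (vertexOf-vertexRep v)))
        (Vec.tabulate∘lookup g)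

      from∘to : ∀ θ → Consistent (ρ θ) → fromVertices (toVertices θ) ≡ θ
      from∘to θ cons = trans
        (Vec.tabulate-cong λ k → trans (cong₂ _,_
          (trans (at (pos k)) (cong (start (ρ θ)) (pos-name k)))
          (trans (at (next (pos k))) (trans (sym (cons (pos k))) (cong (end (ρ θ)) (pos-name k)))))
          (ρ-name θ k))
        (Vec.tabulate∘lookup θ)
        where
        at : ∀ c → Vec.lookup (toVertices θ) (vertexOf c) ≡ start (ρ θ) (lookup w c)
        at c = trans (Vec.lookup∘tabulate _ (vertexOf c)) (start-∼ cons (vertexRep∼ c))

    -- `toVertices` and `fromVertices` are inverse to each other on consistent tuples; each
    -- direction gives one inequality between the two lengths.
    consistent-count : length (filter (consistent? ∘ ρ) (tuples pairs M)) ≡ 2 ^ #vertices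
    consistent-count = trans
      (ℕ.≤-antisym
        (injection⇒length≤ toVertices (Unique.filter⁺ (consistent? ∘ ρ) (tuples-unique pairs-unique M))
          (λ _ → ∈-tuples ∈-bools _)
          (λ {θ} {θ′} θ∈ θ′∈ e → trans (sym (from∘to θ (consistent θ∈)))
            (trans (cong fromVertices e) (from∘to θ′ (consistent θ′∈)))))
        (injection⇒length≤ fromVertices (tuples-unique bools-unique #vertices)
          (λ {g} _ → ∈-filter⁺ (consistent? ∘ ρ) (∈-tuples ∈-pairs _) (from-consistent g))
          (λ {g} {g′} _ _ e → trans (sym (to∘from g)) (trans (cong toVertices e) (to∘from g′)))))
      (length-tuples bools #vertices)
      where
      consistent : ∀ {θ} → θ ∈ filter (consistent? ∘ ρ) (tuples pairs M) → Consistent (ρ θ)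
      consistent θ∈ = proj₂ (∈-filter⁻ (consistent? ∘ ρ) {xs = tuples pairs M} θ∈)

-- Sums over lists and over the two labels.

∑ : ∀ {A : Set} → List A → (A → ℕ) → ℕ
∑ xs f = sum (map f xs)

module _ {A : Set} where

  ∑-cong : ∀ (xs : List A) {f g : A → ℕ} → (∀ x → f x ≡ g x) → ∑ xs f ≡ ∑ xs g
  ∑-cong []       e = refl
  ∑-cong (x ∷ xs) e = cong₂ _+_ (e x) (∑-cong xs e)

  ∑-++ : ∀ (xs ys : List A) f → ∑ (xs ++ ys) f ≡ ∑ xs f + ∑ ys f
  ∑-++ xs ys f = trans (cong sum (map-++ f xs ys)) (sum-++ (map f xs) (map f ys))

  ∑-*ˡ : ∀ (xs : List A) c f → ∑ xs (λ x → c * f x) ≡ c * ∑ xs f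
  ∑-*ˡ []       c f = sym (ℕ.*-zeroʳ c)
  ∑-*ˡ (x ∷ xs) c f = trans (cong (c * f x +_) (∑-*ˡ xs c f)) (sym (ℕ.*-distribˡ-+ c (f x) _))

  ∑-+ : ∀ (xs : List A) f g → ∑ xs (λ x → f x + g x) ≡ ∑ xs f + ∑ xs g
  ∑-+ []       f g = refl
  ∑-+ (x ∷ xs) f g = trans (cong (f x + g x +_) (∑-+ xs f g)) (shuffle (f x) (g x) (∑ xs f) (∑ xs g))
    where
    shuffle : ∀ p q r s → p + q + (r + s) ≡ p + r + (q + s)
    shuffle = solve-∀

  ∑-map : ∀ {B : Set} (g : B → A) xs (f : A → ℕ) → ∑ (map g xs) f ≡ ∑ xs (f ∘ g)
  ∑-map g xs f = cong sum (sym (map-∘ xs))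

  ∑-count : ∀ {P : A → Set} (P? : Decidable P) (f : A → ℕ) → (∀ x → P x → f x ≡ 1) → (∀ x → ¬ P x → f x ≡ 0) →
    ∀ xs → ∑ xs f ≡ length (filter P? xs)
  ∑-count P? f one zero′ []       = refl
  ∑-count P? f one zero′ (x ∷ xs) with P? x
  ... | yes p = cong₂ _+_ (one x p) (∑-count P? f one zero′ xs)
  ... | no ¬p = cong₂ _+_ (zero′ x ¬p) (∑-count P? f one zero′ xs)

∑-cartesianProductWith : ∀ {A B C : Set} (g : A → B → C) xs ys f →
  ∑ (cartesianProductWith g xs ys) f ≡ ∑ xs λ x → ∑ ys λ y → f (g x y)
∑-cartesianProductWith g []       ys f = refl
∑-cartesianProductWith g (x ∷ xs) ys f =
  trans (∑-++ (map (g x) ys) (cartesianProductWith g xs ys) f)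
    (cong₂ _+_ (∑-map (g x) ys f) (∑-cartesianProductWith g xs ys f))

δ : Bool → Bool → ℕ
δ false false = 1
δ false true  = 0
δ true  false = 0
δ true  true  = 1

opaque
  -- Opaque, so that nested sums stay folded and their summands can be found by unification. Only
  -- this block and the base cases `base₁₀`, `base₇` compute with the two values.
  ΣB : (Bool → ℕ) → ℕ
  ΣB f = f false + f true

  ΣB-cong : ∀ {f g : Bool → ℕ} → (∀ x → f x ≡ g x) → ΣB f ≡ ΣB g
  ΣB-cong e = cong₂ _+_ (e false) (e true)

  ΣB-const : ∀ m → ΣB (λ _ → m) ≡ 2 * m
  ΣB-const m = cong (m +_) (sym (ℕ.+-identityʳ m))

  ΣB-swap : ∀ (f : Bool → Bool → ℕ) → ΣB (λ x → ΣB λ y → f x y) ≡ ΣB λ y → ΣB λ x → f x y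
  ΣB-swap f = shuffle (f false false) (f false true) (f true false) (f true true)
    where
    shuffle : ∀ p q r s → p + q + (r + s) ≡ p + r + (q + s)
    shuffle = solve-∀

  ΣB-*ˡ : ∀ c f → ΣB (λ x → c * f x) ≡ c * ΣB f
  ΣB-*ˡ c f = sym (ℕ.*-distribˡ-+ c (f false) (f true))

  ∑-ΣB : ∀ {A : Set} (xs : List A) (f : A → Bool → ℕ) → ∑ xs (λ x → ΣB (f x)) ≡ ΣB λ y → ∑ xs λ x → f x y
  ∑-ΣB xs f = ∑-+ xs (λ x → f x false) (λ x → f x true)

  ∑-pairs : ∀ (f : Bool² → ℕ) → ∑ pairs f ≡ ΣB λ u → ΣB λ v → f (u , v)
  ∑-pairs f = shuffle (f (false , false)) (f (false , true)) (f (true , false)) (f (true , true))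
    where
    shuffle : ∀ p q r s → p + (q + (r + (s + 0))) ≡ p + q + (r + s)
    shuffle = solve-∀

  ΣB-δ : ∀ x (f : Bool → ℕ) → ΣB (λ z → δ z x * f z) ≡ f x
  ΣB-δ false f = trans (ℕ.+-identityʳ _) (ℕ.+-identityʳ _)
  ΣB-δ true  f = ℕ.+-identityʳ _

∑-tuples : ∀ n f → ∑ (tuples pairs (suc n)) f ≡ ΣB λ u → ΣB λ v → ∑ (tuples pairs n) λ r → f ((u , v) ∷ r)
∑-tuples n f = trans (∑-cartesianProductWith _∷_ pairs (tuples pairs n) f) (∑-pairs λ p → ∑ (tuples pairs n) λ r → f (p ∷ r))

δ-refl : ∀ x → δ x x ≡ 1
δ-refl false = refl
δ-refl true  = refl

δ⇒≡ : ∀ x y → δ x y ≡ 1 → x ≡ y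
δ⇒≡ false false _ = refl
δ⇒≡ true  true  _ = refl

δ-sym : ∀ x y → δ x y ≡ δ y x
δ-sym false false = refl
δ-sym false true  = refl
δ-sym true  false = refl
δ-sym true  true  = refl

ΣB-δʳ : ∀ x (f : Bool → ℕ) → ΣB (λ z → δ x z * f z) ≡ f x
ΣB-δʳ x f = trans (ΣB-cong λ z → cong (_* f z) (δ-sym x z)) (ΣB-δ x f)

-- Words as products of transfer matrices.

-- The entry at `x`, `y` of a product of 2 by 2 matrices, where a symbol has a single entry 1, in
-- row `start` and column `end`. Then `chain-++` is matrix multiplication and `cycle` is the trace.
chain : (Letter → Bool²) → Bool → Word → Bool → ℕ
chain ρ x []      y = δ x y
chain ρ x (s ∷ w) y = δ x (start ρ s) * chain ρ (end ρ s) w y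

chain-++ : ∀ ρ x w w′ y → chain ρ x (w ++ w′) y ≡ ΣB λ z → chain ρ x w z * chain ρ z w′ y
chain-++ ρ x []      w′ y = sym (ΣB-δʳ x (λ z → chain ρ z w′ y))
chain-++ ρ x (s ∷ w) w′ y = begin-equality
  δ x (start ρ s) * chain ρ (end ρ s) (w ++ w′) y
    ≡⟨ cong (δ x (start ρ s) *_) (chain-++ ρ (end ρ s) w w′ y) ⟩
  δ x (start ρ s) * ΣB (λ z → chain ρ (end ρ s) w z * chain ρ z w′ y)
    ≡⟨ ΣB-*ˡ (δ x (start ρ s)) (λ z → chain ρ (end ρ s) w z * chain ρ z w′ y) ⟨
  ΣB (λ z → δ x (start ρ s) * (chain ρ (end ρ s) w z * chain ρ z w′ y))
    ≡⟨ ΣB-cong (λ z → sym (ℕ.*-assoc (δ x (start ρ s)) (chain ρ (end ρ s) w z) (chain ρ z w′ y))) ⟩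
  ΣB (λ z → δ x (start ρ s) * chain ρ (end ρ s) w z * chain ρ z w′ y) ∎

cycle : (Letter → Bool²) → Word → ℕ
cycle ρ w = ΣB λ x → chain ρ x w x

-- y is the label expected after the last symbol.
startAt : (Letter → Bool²) → Bool → Word → ℕ → Bool
startAt ρ y []      _       = y
startAt ρ y (s ∷ w) zero    = start ρ s
startAt ρ y (s ∷ w) (suc k) = startAt ρ y w k

startAt-lookup : ∀ ρ y w (i : Fin (length w)) → startAt ρ y w (toℕ i) ≡ start ρ (lookup w i)
startAt-lookup ρ y (s ∷ w) zero    = refl
startAt-lookup ρ y (s ∷ w) (suc i) = startAt-lookup ρ y w i

startAt-length : ∀ ρ y w → startAt ρ y w (length w) ≡ y
startAt-length ρ y []      = refl
startAt-length ρ y (s ∷ w) = startAt-length ρ y w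

-- The second case is the wrap-around of `next`: after the last position the expected label is that
-- of the first symbol `s`.
startAt-next : ∀ ρ s w (i : Fin (suc (length w))) →
  startAt ρ (start ρ s) w (toℕ i) ≡ start ρ (lookup (s ∷ w) (next i))
startAt-next ρ s w i with ℕ.m≤n⇒m<n∨m≡n (ℕ.≤-pred (Fin.toℕ<n i))
... | inj₁ lt = trans (cong (startAt ρ (start ρ s) w) (sym (Fin.toℕ-fromℕ< lt)))
  (trans (startAt-lookup ρ (start ρ s) w (fromℕ< lt))
    (cong (start ρ ∘ lookup (s ∷ w)) (Fin.toℕ-injective
      (trans (cong suc (Fin.toℕ-fromℕ< lt)) (sym (trans (Fin.toℕ-fromℕ< _) (m<n⇒m%n≡m (s≤s lt))))))))
... | inj₂ eq = trans (cong (startAt ρ (start ρ s) w) eq)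
  (trans (startAt-length ρ (start ρ s) w)
    (cong (start ρ ∘ lookup (s ∷ w)) (Fin.toℕ-injective {i = zero} {j = next i}
      (sym (trans (Fin.toℕ-fromℕ< _) (trans (cong (λ k → suc k % suc (length w)) eq) (n%n≡0 (suc (length w)))))))))

chain⇒linked : ∀ ρ s w y → chain ρ (end ρ s) w y ≡ 1 →
  ∀ i → end ρ (lookup (s ∷ w) i) ≡ startAt ρ y w (toℕ i)
chain⇒linked ρ s []       y e zero    = δ⇒≡ _ _ e
chain⇒linked ρ s (s′ ∷ w) y e zero    = δ⇒≡ _ _ (ℕ.m*n≡1⇒m≡1 (δ (end ρ s) (start ρ s′)) (chain ρ (end ρ s′) w y) e)
chain⇒linked ρ s (s′ ∷ w) y e (suc i) =
  chain⇒linked ρ s′ w y (ℕ.m*n≡1⇒n≡1 (δ (end ρ s) (start ρ s′)) (chain ρ (end ρ s′) w y) e) i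

linked⇒chain : ∀ ρ s w y → (∀ i → end ρ (lookup (s ∷ w) i) ≡ startAt ρ y w (toℕ i)) →
  chain ρ (end ρ s) w y ≡ 1
linked⇒chain ρ s []       y l = trans (cong (λ x → δ x y) (l zero)) (δ-refl y)
linked⇒chain ρ s (s′ ∷ w) y l = cong₂ _*_
  (trans (cong (λ x → δ x (start ρ s′)) (l zero)) (δ-refl _))
  (linked⇒chain ρ s′ w y (l ∘ suc))

δ-01 : ∀ x y → δ x y ≡ 0 ⊎ δ x y ≡ 1
δ-01 false false = inj₂ refl
δ-01 false true  = inj₁ refl
δ-01 true  false = inj₁ refl
δ-01 true  true  = inj₂ refl

-- This makes a sum of `cycle` over labellings the number of consistent ones.
chain-01 : ∀ ρ x w y → chain ρ x w y ≡ 0 ⊎ chain ρ x w y ≡ 1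
chain-01 ρ x []      y = δ-01 x y
chain-01 ρ x (s ∷ w) y with δ-01 x (start ρ s)
... | inj₁ e rewrite e = inj₁ refl
... | inj₂ e rewrite e | ℕ.+-identityʳ (chain ρ (end ρ s) w y) = chain-01 ρ (end ρ s) w y

cycle-∷ : ∀ ρ s w → cycle ρ (s ∷ w) ≡ chain ρ (end ρ s) w (start ρ s)
cycle-∷ ρ s w = ΣB-δ (start ρ s) (chain ρ (end ρ s) w)

cycle-consistent : ∀ ρ s w → Vertices.Consistent (s ∷ w) ρ → cycle ρ (s ∷ w) ≡ 1
cycle-consistent ρ s w cons = trans (cycle-∷ ρ s w)
  (linked⇒chain ρ s w _ λ i → trans (cons i) (sym (startAt-next ρ s w i)))

cycle-inconsistent : ∀ ρ s w → ¬ Vertices.Consistent (s ∷ w) ρ → cycle ρ (s ∷ w) ≡ 0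
cycle-inconsistent ρ s w ¬cons with chain-01 ρ (end ρ s) w (start ρ s)
... | inj₁ e = trans (cycle-∷ ρ s w) e
... | inj₂ e = contradiction (λ i → trans (chain⇒linked ρ s w _ e i) (startAt-next ρ s w i)) ¬cons

-- Summing out the rungs: matchings of corners.

Weight₄ Weight₆ : Set
Weight₄ = (x₁ x₂ x₃ x₄ : Bool) → ℕ
Weight₆ = (x₁ x₂ x₃ x₄ y z : Bool) → ℕ

-- 1, …, 4 are the corners at the inner ends of what is left of R₁, …, R₄ once the
-- letters of smaller index are summed out; y and z are two of the corners at the
-- outer ends.  The matching tells which of them carry the same label.
data Matching : Set where
  14∣2y∣3z 12∣3z∣4y 1z∣2y∣34 14∣23∣yz 1z∣23∣4y 12∣34∣yz : Matching

Σ₃ : (Bool → Bool → Bool → ℕ) → ℕ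
Σ₃ f = ΣB λ p → ΣB λ q → ΣB λ r → f p q r

∑ₘ : Matching → Weight₆ → ℕ
∑ₘ 14∣2y∣3z h = Σ₃ λ p q r → h p q r p q r
∑ₘ 12∣3z∣4y h = Σ₃ λ p q r → h p p q r r q
∑ₘ 1z∣2y∣34 h = Σ₃ λ p q r → h p q r r q p
∑ₘ 14∣23∣yz h = Σ₃ λ p q r → h p q q p r r
∑ₘ 1z∣23∣4y h = Σ₃ λ p q r → h p q q r r p
∑ₘ 12∣34∣yz h = Σ₃ λ p q r → h p p q q r r

-- The remaining letter of smallest index is the last symbol of `R₁` or the first of `R₂`, and its
-- inverse the last of `R₃` or the first of `R₄`. If both are last, or both first, the two ends of
-- the letter exchange the corners 1 and 3, or 2 and 4. Otherwise one end equates 4 with 1, or 3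
-- with 2, and the other end is the free label `w` of a new pair.
rung : Bool → Bool → Weight₄ → Weight₄
rung inside  inside  h x₁ x₂ x₃ x₄ = h x₃ x₂ x₁ x₄
rung outside outside h x₁ x₂ x₃ x₄ = h x₁ x₄ x₃ x₂
rung inside  outside h x₁ x₂ x₃ x₄ = δ x₄ x₁ * ΣB λ w → h w x₂ x₃ w
rung outside inside  h x₁ x₂ x₃ x₄ = δ x₃ x₂ * ΣB λ w → h x₁ w w x₄

step : Matching → Bool → Bool → Matching
step 14∣2y∣3z inside  inside  = 1z∣2y∣34
step 14∣2y∣3z outside outside = 12∣3z∣4y
step 14∣2y∣3z inside  outside = 14∣2y∣3z
step 14∣2y∣3z outside inside  = 14∣23∣yz
step 1z∣2y∣34 inside  inside  = 14∣2y∣3z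
step 1z∣2y∣34 outside outside = 1z∣23∣4y
step 1z∣2y∣34 inside  outside = 14∣2y∣3z
step 1z∣2y∣34 outside inside  = 1z∣23∣4y
step 12∣3z∣4y inside  inside  = 1z∣23∣4y
step 12∣3z∣4y outside outside = 14∣2y∣3z
step 12∣3z∣4y inside  outside = 14∣2y∣3z
step 12∣3z∣4y outside inside  = 1z∣23∣4y
step 14∣23∣yz inside  inside  = 12∣34∣yz
step 14∣23∣yz outside outside = 12∣34∣yz
step 14∣23∣yz inside  outside = 14∣23∣yz
step 14∣23∣yz outside inside  = 14∣23∣yz
step 1z∣23∣4y inside  inside  = 12∣3z∣4y
step 1z∣23∣4y outside outside = 1z∣2y∣34
step 1z∣23∣4y inside  outside = 14∣23∣yz
step 1z∣23∣4y outside inside  = 1z∣23∣4y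
step 12∣34∣yz _       _       = 14∣23∣yz

-- Equal to 1 when the joined corners were already matched: their common label is then unconstrained
-- from there on, that is, a vertex is completed.
closes : Matching → Bool → Bool → ℕ
closes 14∣2y∣3z inside  outside = 1
closes 14∣23∣yz inside  outside = 1
closes 14∣23∣yz outside inside  = 1
closes 1z∣23∣4y outside inside  = 1
closes _        _       _       = 0

vertices : (Matching → ℕ) → Matching → ∀ {n} → Subset n → Subset n → ℕ
vertices κ s []      []      = κ s
vertices κ s (k ∷ K) (t ∷ T) = closes s k t + vertices κ (step s k t) K T

module _ {f g : Bool → Bool → Bool → ℕ} where
  Σ₃-cong : (∀ p q r → f p q r ≡ g p q r) → Σ₃ f ≡ Σ₃ g
  Σ₃-cong e = ΣB-cong λ p → ΣB-cong λ q → ΣB-cong λ r → e p q r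

Σ₃-swap₁₂ : ∀ f → Σ₃ f ≡ Σ₃ λ p q r → f q p r
Σ₃-swap₁₂ f = ΣB-swap λ p q → ΣB (f p q)

Σ₃-swap₂₃ : ∀ f → Σ₃ f ≡ Σ₃ λ p q r → f p r q
Σ₃-swap₂₃ f = ΣB-cong λ p → ΣB-swap (f p)

Σ₃-swap₁₃ : ∀ f → Σ₃ f ≡ Σ₃ λ p q r → f r q p
Σ₃-swap₁₃ f = trans (Σ₃-swap₁₂ f) (trans (Σ₃-swap₂₃ λ p q r → f q p r) (Σ₃-swap₁₂ λ p q r → f r p q))

Σ₃-δ₁₂ : ∀ (f : Bool → Bool → Bool → ℕ) → Σ₃ (λ p q r → δ q p * f p q r) ≡ ΣB λ p → ΣB λ r → f p p r
Σ₃-δ₁₂ f = ΣB-cong λ p → trans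
  (ΣB-cong λ q → ΣB-*ˡ (δ q p) (f p q))
  (ΣB-δ p λ q → ΣB (f p q))

Σ₃-δ₂₃ : ∀ (f : Bool → Bool → Bool → ℕ) → Σ₃ (λ p q r → δ r q * f p q r) ≡ ΣB λ p → ΣB λ q → f p q q
Σ₃-δ₂₃ f = ΣB-cong λ p → ΣB-cong λ q → ΣB-δ q (f p q)

Σ₃-δ₁₃ : ∀ (f : Bool → Bool → Bool → ℕ) → Σ₃ (λ p q r → δ r p * f p q r) ≡ ΣB λ p → ΣB λ q → f p q p
Σ₃-δ₁₃ f = ΣB-cong λ p → ΣB-cong λ q → ΣB-δ p (f p q)

-- The delta compares a label with itself, so `p` occurs nowhere else and its sum is the factor 2.
Σ₃-closed : ∀ (f : Bool → Bool → Bool → ℕ) →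
  Σ₃ (λ p q r → δ p p * ΣB λ w → f w q r) ≡ 2 * Σ₃ f
Σ₃-closed f = begin-equality
  Σ₃ (λ p q r → δ p p * ΣB λ w → f w q r)
    ≡⟨ Σ₃-cong (λ p q r → trans (cong (_* ΣB λ w → f w q r) (δ-refl p)) (ℕ.*-identityˡ _)) ⟩
  Σ₃ (λ p q r → ΣB λ w → f w q r)
    ≡⟨ ΣB-const (ΣB λ q → ΣB λ r → ΣB λ w → f w q r) ⟩
  2 * (ΣB λ q → ΣB λ r → ΣB λ w → f w q r)
    ≡⟨ cong (2 *_) (Σ₃-swap₁₃ (λ q r w → f w q r)) ⟩
  2 * Σ₃ (λ w r q → f w q r)
    ≡⟨ cong (2 *_) (Σ₃-swap₂₃ (λ w r q → f w q r)) ⟩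
  2 * Σ₃ f ∎

lift : (Weight₄ → Weight₄) → Weight₆ → Weight₆
lift φ h x₁ x₂ x₃ x₄ y z = φ (λ x₁ x₂ x₃ x₄ → h x₁ x₂ x₃ x₄ y z) x₁ x₂ x₃ x₄

-- A swap of corners only renames the three summation variables. Joining two pairs evaluates a delta
-- first, and joining a pair with itself is `Σ₃-closed`.
∑ₘ-rung : ∀ s k t h → ∑ₘ s (lift (rung k t) h) ≡ 2 ^ closes s k t * ∑ₘ (step s k t) h
∑ₘ-rung s k t h = go s k t
  where
  one : ∀ {m m′} → m ≡ m′ → m ≡ 1 * m′
  one e = trans e (sym (ℕ.*-identityˡ _))
  go : ∀ s k t → ∑ₘ s (lift (rung k t) h) ≡ 2 ^ closes s k t * ∑ₘ (step s k t) h
  go 14∣2y∣3z true  true  = one (Σ₃-swap₁₃ λ p q r → h r q p p q r)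
  go 14∣2y∣3z false false = one (Σ₃-swap₂₃ λ p q r → h p p r q q r)
  go 14∣2y∣3z true  false = Σ₃-closed λ p q r → h p q r p q r
  go 14∣2y∣3z false true  = one (trans (Σ₃-δ₂₃ λ p q r → ΣB λ w → h p w w p q r) (Σ₃-swap₂₃ λ p q w → h p w w p q q))
  go 1z∣2y∣34 true  true  = one (Σ₃-swap₁₃ λ p q r → h r q p r q p)
  go 1z∣2y∣34 false false = one (Σ₃-swap₂₃ λ p q r → h p r r q q p)
  go 1z∣2y∣34 true  false = one (trans (Σ₃-δ₁₃ λ p q r → ΣB λ w → h w q r w q p) (Σ₃-swap₁₃ λ p q w → h w q p w q p))
  go 1z∣2y∣34 false true  = one (trans (Σ₃-δ₂₃ λ p q r → ΣB λ w → h p w w r q p) (Σ₃-swap₂₃ λ p q w → h p w w q q p))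
  go 12∣3z∣4y true  true  = one (Σ₃-swap₁₂ λ p q r → h q p p r r q)
  go 12∣3z∣4y false false = one (Σ₃-swap₂₃ λ p q r → h p r q p r q)
  go 12∣3z∣4y true  false = one (trans (Σ₃-δ₁₃ λ p q r → ΣB λ w → h w p q w r q) (trans (Σ₃-swap₁₃ λ p q w → h w p q w p q) (Σ₃-swap₂₃ λ w q p → h w p q w p q)))
  go 12∣3z∣4y false true  = one (trans (Σ₃-δ₁₂ λ p q r → ΣB λ w → h p w w r r q) (Σ₃-swap₂₃ λ p r w → h p w w r r p))
  go 14∣23∣yz true  true  = one (Σ₃-swap₁₂ λ p q r → h q q p p r r)
  go 14∣23∣yz false false = one refl
  go 14∣23∣yz true  false = Σ₃-closed λ p q r → h p q q p r r
  go 14∣23∣yz false true  = trans (Σ₃-swap₁₂ λ p q r → δ q q * ΣB λ w → h p w w p r r)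
    (trans (Σ₃-closed λ w p r → h p w w p r r) (cong (2 *_) (Σ₃-swap₁₂ λ w p r → h p w w p r r)))
  go 1z∣23∣4y true  true  = one (Σ₃-swap₁₂ λ p q r → h q q p r r p)
  go 1z∣23∣4y false false = one (Σ₃-swap₂₃ λ p q r → h p r q q r p)
  go 1z∣23∣4y true  false = one (trans (Σ₃-δ₁₃ λ p q r → ΣB λ w → h w q q w r p) (Σ₃-swap₁₃ λ p q w → h w q q w p p))
  go 1z∣23∣4y false true  = trans (Σ₃-swap₁₂ λ p q r → δ q q * ΣB λ w → h p w w r r p)
    (trans (Σ₃-closed λ w p r → h p w w r r p) (cong (2 *_) (Σ₃-swap₁₂ λ w p r → h p w w r r p)))
  go 12∣34∣yz true  true  = one (Σ₃-swap₁₂ λ p q r → h q p p q r r)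
  go 12∣34∣yz false false = one refl
  go 12∣34∣yz true  false = one (trans (Σ₃-δ₁₂ λ p q r → ΣB λ w → h w p q w r r)
    (trans (Σ₃-swap₂₃ λ p r w → h w p p w r r) (Σ₃-swap₁₂ λ p w r → h w p p w r r)))
  go 12∣34∣yz false true  = one (trans (Σ₃-δ₁₂ λ p q r → ΣB λ w → h p w w q r r) (Σ₃-swap₂₃ λ p r w → h p w w p r r))

∑ₘ-cong : ∀ s {h h′ : Weight₆} → (∀ x₁ x₂ x₃ x₄ y z → h x₁ x₂ x₃ x₄ y z ≡ h′ x₁ x₂ x₃ x₄ y z) → ∑ₘ s h ≡ ∑ₘ s h′
∑ₘ-cong 14∣2y∣3z e = Σ₃-cong λ p q r → e p q r p q r
∑ₘ-cong 12∣3z∣4y e = Σ₃-cong λ p q r → e p p q r r q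
∑ₘ-cong 1z∣2y∣34 e = Σ₃-cong λ p q r → e p q r r q p
∑ₘ-cong 14∣23∣yz e = Σ₃-cong λ p q r → e p q q p r r
∑ₘ-cong 1z∣23∣4y e = Σ₃-cong λ p q r → e p q q r r p
∑ₘ-cong 12∣34∣yz e = Σ₃-cong λ p q r → e p p q q r r

-- `x` is the label at the inner end, next to the smallest index, and `y` the one at the outer end.
-- The arguments stand in reading order, so a word of decreasing indices takes `y` first.
up down : ∀ {n} → Subset n → Vec Bool² n → Bool → Bool → ℕ
up []            []            x y = δ x y
up (inside  ∷ K) ((u , v) ∷ r) x y = δ x u * up K r v y
up (outside ∷ K) (_       ∷ r) x y = up K r x y
down []            []            y x = δ y x
down (inside  ∷ K) ((u , v) ∷ r) y x = down K r y u * δ v x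
down (outside ∷ K) (_       ∷ r) y x = down K r y x

-- `R₃` and `R₄` consist of inverse letters, whose ends are read in the opposite order; hence the
-- `swap`.
ladderTerm : ∀ {n} (K T : Subset n) (x₁ x₂ x₃ x₄ y₁ y₂ y₃ y₄ : Bool) → Vec Bool² n → ℕ
ladderTerm K T x₁ x₂ x₃ x₄ y₁ y₂ y₃ y₄ r =
  down K r y₁ x₁ * up (∁ K) r x₂ y₂ * (down T (Vec.map swap r) y₃ x₃ * up (∁ T) (Vec.map swap r) x₄ y₄)

ladder : ∀ {n} (K T : Subset n) (x₁ x₂ x₃ x₄ y₁ y₂ y₃ y₄ : Bool) → ℕ
ladder {n} K T x₁ x₂ x₃ x₄ y₁ y₂ y₃ y₄ = ∑ (tuples pairs n) (ladderTerm K T x₁ x₂ x₃ x₄ y₁ y₂ y₃ y₄)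

∑-δδ : ∀ {A : Set} (xs : List A) x y (f : Bool → Bool → A → ℕ) →
  ΣB (λ u → ΣB λ v → ∑ xs λ r → δ u x * (δ v y * f u v r)) ≡ ∑ xs (f x y)
∑-δδ xs x y f = begin-equality
  ΣB (λ u → ΣB λ v → ∑ xs λ r → δ u x * (δ v y * f u v r))
    ≡⟨ (ΣB-cong λ u → ΣB-cong λ v → trans (∑-*ˡ xs (δ u x) _) (cong (δ u x *_) (∑-*ˡ xs (δ v y) _))) ⟩
  ΣB (λ u → ΣB λ v → δ u x * (δ v y * ∑ xs (f u v)))
    ≡⟨ (ΣB-cong λ u → trans (ΣB-*ˡ (δ u x) _) (cong (δ u x *_) (ΣB-δ y λ v → ∑ xs (f u v)))) ⟩
  ΣB (λ u → δ u x * ∑ xs (f u y))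
    ≡⟨ ΣB-δ x (λ u → ∑ xs (f u y)) ⟩
  ∑ xs (f x y) ∎

-- The letter of smallest index lies at the inner end of the words that contain it, so its labels
-- `u`, `v` enter through just two deltas; evaluating these leaves the same expression for the
-- tails.
ladder-∷ : ∀ {n} k t (K T : Subset n) x₁ x₂ x₃ x₄ y₁ y₂ y₃ y₄ →
  ladder (k ∷ K) (t ∷ T) x₁ x₂ x₃ x₄ y₁ y₂ y₃ y₄ ≡
  rung k t (λ x₁ x₂ x₃ x₄ → ladder K T x₁ x₂ x₃ x₄ y₁ y₂ y₃ y₄) x₁ x₂ x₃ x₄
ladder-∷ {n} inside inside K T x₁ x₂ x₃ x₄ y₁ y₂ y₃ y₄ = begin-equality
  ladder (inside ∷ K) (inside ∷ T) x₁ x₂ x₃ x₄ y₁ y₂ y₃ y₄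
    ≡⟨ ∑-tuples n (ladderTerm (inside ∷ K) (inside ∷ T) x₁ x₂ x₃ x₄ y₁ y₂ y₃ y₄) ⟩
  ΣB (λ u → ΣB λ v → ∑ (tuples pairs n) λ r →
    down K r y₁ u * δ v x₁ * up (∁ K) r x₂ y₂ *
    (down T (Vec.map swap r) y₃ v * δ u x₃ * up (∁ T) (Vec.map swap r) x₄ y₄))
    ≡⟨ (ΣB-cong λ u → ΣB-cong λ v → ∑-cong (tuples pairs n) λ r →
        shuffle (down K r y₁ u) (δ v x₁) (up (∁ K) r x₂ y₂) (down T (Vec.map swap r) y₃ v) (δ u x₃) _) ⟩
  ΣB (λ u → ΣB λ v → ∑ (tuples pairs n) λ r →
    δ u x₃ * (δ v x₁ * ladderTerm K T u x₂ v x₄ y₁ y₂ y₃ y₄ r))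
    ≡⟨ ∑-δδ (tuples pairs n) x₃ x₁ (λ u v → ladderTerm K T u x₂ v x₄ y₁ y₂ y₃ y₄) ⟩
  ladder K T x₃ x₂ x₁ x₄ y₁ y₂ y₃ y₄ ∎
  where
  shuffle : ∀ d v u d′ e u′ → d * v * u * (d′ * e * u′) ≡ e * (v * (d * u * (d′ * u′)))
  shuffle = solve-∀
ladder-∷ {n} outside outside K T x₁ x₂ x₃ x₄ y₁ y₂ y₃ y₄ = begin-equality
  ladder (outside ∷ K) (outside ∷ T) x₁ x₂ x₃ x₄ y₁ y₂ y₃ y₄
    ≡⟨ ∑-tuples n (ladderTerm (outside ∷ K) (outside ∷ T) x₁ x₂ x₃ x₄ y₁ y₂ y₃ y₄) ⟩
  ΣB (λ u → ΣB λ v → ∑ (tuples pairs n) λ r →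
    down K r y₁ x₁ * (δ x₂ u * up (∁ K) r v y₂) *
    (down T (Vec.map swap r) y₃ x₃ * (δ x₄ v * up (∁ T) (Vec.map swap r) u y₄)))
    ≡⟨ (ΣB-cong λ u → ΣB-cong λ v → ∑-cong (tuples pairs n) λ r → trans
        (shuffle (down K r y₁ x₁) (δ x₂ u) (up (∁ K) r v y₂) (down T (Vec.map swap r) y₃ x₃) (δ x₄ v) _)
        (cong₂ (λ c d → c * (d * ladderTerm K T x₁ v x₃ u y₁ y₂ y₃ y₄ r)) (δ-sym x₂ u) (δ-sym x₄ v))) ⟩
  ΣB (λ u → ΣB λ v → ∑ (tuples pairs n) λ r →
    δ u x₂ * (δ v x₄ * ladderTerm K T x₁ v x₃ u y₁ y₂ y₃ y₄ r))
    ≡⟨ ∑-δδ (tuples pairs n) x₂ x₄ (λ u v → ladderTerm K T x₁ v x₃ u y₁ y₂ y₃ y₄) ⟩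
  ladder K T x₁ x₄ x₃ x₂ y₁ y₂ y₃ y₄ ∎
  where
  shuffle : ∀ d u w d′ v w′ → d * (u * w) * (d′ * (v * w′)) ≡ u * (v * (d * w * (d′ * w′)))
  shuffle = solve-∀
ladder-∷ {n} inside outside K T x₁ x₂ x₃ x₄ y₁ y₂ y₃ y₄ = begin-equality
  ladder (inside ∷ K) (outside ∷ T) x₁ x₂ x₃ x₄ y₁ y₂ y₃ y₄
    ≡⟨ ∑-tuples n (ladderTerm (inside ∷ K) (outside ∷ T) x₁ x₂ x₃ x₄ y₁ y₂ y₃ y₄) ⟩
  ΣB (λ u → ΣB λ v → ∑ (tuples pairs n) λ r →
    down K r y₁ u * δ v x₁ * up (∁ K) r x₂ y₂ *
    (down T (Vec.map swap r) y₃ x₃ * (δ x₄ v * up (∁ T) (Vec.map swap r) u y₄)))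
    ≡⟨ (ΣB-cong λ u → ΣB-cong λ v → trans
        (∑-cong (tuples pairs n) λ r →
          shuffle (down K r y₁ u) (δ v x₁) (up (∁ K) r x₂ y₂) (down T (Vec.map swap r) y₃ x₃) (δ x₄ v) _)
        (trans (∑-*ˡ (tuples pairs n) (δ v x₁) _) (cong (δ v x₁ *_) (∑-*ˡ (tuples pairs n) (δ x₄ v) _)))) ⟩
  ΣB (λ u → ΣB λ v → δ v x₁ * (δ x₄ v * ladder K T u x₂ x₃ u y₁ y₂ y₃ y₄))
    ≡⟨ (ΣB-cong λ u → ΣB-δ x₁ λ v → δ x₄ v * ladder K T u x₂ x₃ u y₁ y₂ y₃ y₄) ⟩
  ΣB (λ u → δ x₄ x₁ * ladder K T u x₂ x₃ u y₁ y₂ y₃ y₄)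
    ≡⟨ ΣB-*ˡ (δ x₄ x₁) _ ⟩
  δ x₄ x₁ * ΣB (λ u → ladder K T u x₂ x₃ u y₁ y₂ y₃ y₄) ∎
  where
  shuffle : ∀ d v u d′ e u′ → d * v * u * (d′ * (e * u′)) ≡ v * (e * (d * u * (d′ * u′)))
  shuffle = solve-∀
ladder-∷ {n} outside inside K T x₁ x₂ x₃ x₄ y₁ y₂ y₃ y₄ = begin-equality
  ladder (outside ∷ K) (inside ∷ T) x₁ x₂ x₃ x₄ y₁ y₂ y₃ y₄
    ≡⟨ ∑-tuples n (ladderTerm (outside ∷ K) (inside ∷ T) x₁ x₂ x₃ x₄ y₁ y₂ y₃ y₄) ⟩
  ΣB (λ u → ΣB λ v → ∑ (tuples pairs n) λ r →
    down K r y₁ x₁ * (δ x₂ u * up (∁ K) r v y₂) *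
    (down T (Vec.map swap r) y₃ v * δ u x₃ * up (∁ T) (Vec.map swap r) x₄ y₄))
    -- Both deltas contain `u`, so its sum is moved inside and evaluated; `v` survives as the label
    -- of the new pair 23.
    ≡⟨ ΣB-swap (λ u v → ∑ (tuples pairs n) λ r →
        down K r y₁ x₁ * (δ x₂ u * up (∁ K) r v y₂) *
        (down T (Vec.map swap r) y₃ v * δ u x₃ * up (∁ T) (Vec.map swap r) x₄ y₄)) ⟩
  ΣB (λ v → ΣB λ u → ∑ (tuples pairs n) λ r →
    down K r y₁ x₁ * (δ x₂ u * up (∁ K) r v y₂) *
    (down T (Vec.map swap r) y₃ v * δ u x₃ * up (∁ T) (Vec.map swap r) x₄ y₄))
    ≡⟨ (ΣB-cong λ v → ΣB-cong λ u → trans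
        (∑-cong (tuples pairs n) λ r → trans
          (shuffle (down K r y₁ x₁) (δ x₂ u) (up (∁ K) r v y₂) (down T (Vec.map swap r) y₃ v) (δ u x₃) _)
          (cong₂ (λ c d → c * (d * ladderTerm K T x₁ v v x₄ y₁ y₂ y₃ y₄ r)) (δ-sym x₂ u) (δ-sym u x₃)))
        (trans (∑-*ˡ (tuples pairs n) (δ u x₂) _) (cong (δ u x₂ *_) (∑-*ˡ (tuples pairs n) (δ x₃ u) _)))) ⟩
  ΣB (λ v → ΣB λ u → δ u x₂ * (δ x₃ u * ladder K T x₁ v v x₄ y₁ y₂ y₃ y₄))
    ≡⟨ (ΣB-cong λ v → ΣB-δ x₂ λ u → δ x₃ u * ladder K T x₁ v v x₄ y₁ y₂ y₃ y₄) ⟩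
  ΣB (λ v → δ x₃ x₂ * ladder K T x₁ v v x₄ y₁ y₂ y₃ y₄)
    ≡⟨ ΣB-*ˡ (δ x₃ x₂) _ ⟩
  δ x₃ x₂ * ΣB (λ v → ladder K T x₁ v v x₄ y₁ y₂ y₃ y₄) ∎
  where
  shuffle : ∀ d u w d′ e w′ → d * (u * w) * (d′ * e * w′) ≡ u * (e * (d * w * (d′ * w′)))
  shuffle = solve-∀

-- The outer ends of R₁, …, R₄ in terms of the corners y, z of a matching and the
-- label t shared by the two other outer ends.
Outer : Set
Outer = (t y z : Bool) → Bool × Bool × Bool × Bool

module Framed (outer : Outer) where
  framed : ∀ {n} → Subset n → Subset n → Weight₆
  framed K T x₁ x₂ x₃ x₄ y z = ΣB λ t →
    let y₁ , y₂ , y₃ , y₄ = outer t y z in ladder K T x₁ x₂ x₃ x₄ y₁ y₂ y₃ y₄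

  -- `rung` is linear in the weight, so the sum over the outer label passes through it.
  rung-ΣB : ∀ k t (h : Bool → Weight₄) x₁ x₂ x₃ x₄ →
    ΣB (λ u → rung k t (h u) x₁ x₂ x₃ x₄) ≡ rung k t (λ x₁ x₂ x₃ x₄ → ΣB λ u → h u x₁ x₂ x₃ x₄) x₁ x₂ x₃ x₄
  rung-ΣB inside  inside  h x₁ x₂ x₃ x₄ = refl
  rung-ΣB outside outside h x₁ x₂ x₃ x₄ = refl
  rung-ΣB inside  outside h x₁ x₂ x₃ x₄ =
    trans (ΣB-*ˡ (δ x₄ x₁) _) (cong (δ x₄ x₁ *_) (ΣB-swap λ u w → h u w x₂ x₃ w))
  rung-ΣB outside inside  h x₁ x₂ x₃ x₄ =
    trans (ΣB-*ˡ (δ x₃ x₂) _) (cong (δ x₃ x₂ *_) (ΣB-swap λ u w → h u x₁ w w x₄))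

  framed-∷ : ∀ {n} k t (K T : Subset n) x₁ x₂ x₃ x₄ y z →
    framed (k ∷ K) (t ∷ T) x₁ x₂ x₃ x₄ y z ≡ lift (rung k t) (framed K T) x₁ x₂ x₃ x₄ y z
  framed-∷ k t K T x₁ x₂ x₃ x₄ y z = trans
    (ΣB-cong λ u → ladder-∷ k t K T x₁ x₂ x₃ x₄ _ _ _ _)
    (rung-ΣB k t (λ u x₁ x₂ x₃ x₄ →
      let y₁ , y₂ , y₃ , y₄ = outer u y z in ladder K T x₁ x₂ x₃ x₄ y₁ y₂ y₃ y₄) x₁ x₂ x₃ x₄)

  module _ {κ : Matching → ℕ} (base : ∀ s → ∑ₘ s (framed [] []) ≡ 2 ^ κ s) where

    ∑ₘ-framed : ∀ s {n} (K T : Subset n) → ∑ₘ s (framed K T) ≡ 2 ^ vertices κ s K T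
    ∑ₘ-framed s []      []      = base s
    ∑ₘ-framed s (k ∷ K) (t ∷ T) = begin-equality
      ∑ₘ s (framed (k ∷ K) (t ∷ T))
        ≡⟨ ∑ₘ-cong s (framed-∷ k t K T) ⟩
      ∑ₘ s (lift (rung k t) (framed K T))
        ≡⟨ ∑ₘ-rung s k t (framed K T) ⟩
      2 ^ closes s k t * ∑ₘ (step s k t) (framed K T)
        ≡⟨ cong (2 ^ closes s k t *_) (∑ₘ-framed (step s k t) K T) ⟩
      2 ^ closes s k t * 2 ^ vertices κ (step s k t) K T
        ≡⟨ ℕ.^-distribˡ-+-* 2 (closes s k t) _ ⟨
      2 ^ (closes s k t + vertices κ (step s k t) K T) ∎

-- Read off the words. In `surface₁₀`, `a` and `b` start where `R₁` starts and `R₄` ends (`t`),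
-- while `R₂` and `R₃` are loops at the far ends of `a` and `b`. In `surface₇`, `R₁` is a loop at
-- the far end of `a`, and `a` starts where `R₃` starts and `R₄` ends.
outer₁₀ outer₇ : Outer
outer₁₀ t y z = t , y , z , t
outer₇  t y z = z , y , t , t

-- The number of distinct labels left when no letters remain and each inner corner meets its own
-- outer end.
κ₁₀ κ₇ : Matching → ℕ
κ₁₀ 14∣2y∣3z = 3
κ₁₀ 12∣3z∣4y = 2
κ₁₀ 1z∣2y∣34 = 2
κ₁₀ 14∣23∣yz = 2
κ₁₀ 1z∣23∣4y = 1
κ₁₀ 12∣34∣yz = 1
κ₇  14∣2y∣3z = 2
κ₇  12∣3z∣4y = 1
κ₇  1z∣2y∣34 = 3
κ₇  14∣23∣yz = 1
κ₇  1z∣23∣4y = 2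
κ₇  12∣34∣yz = 2

opaque
  unfolding ΣB

  base₁₀ : ∀ s → ∑ₘ s (Framed.framed outer₁₀ [] []) ≡ 2 ^ κ₁₀ s
  base₁₀ 14∣2y∣3z = refl
  base₁₀ 12∣3z∣4y = refl
  base₁₀ 1z∣2y∣34 = refl
  base₁₀ 14∣23∣yz = refl
  base₁₀ 1z∣23∣4y = refl
  base₁₀ 12∣34∣yz = refl

  base₇ : ∀ s → ∑ₘ s (Framed.framed outer₇ [] []) ≡ 2 ^ κ₇ s
  base₇ 14∣2y∣3z = refl
  base₇ 12∣3z∣4y = refl
  base₇ 1z∣2y∣34 = refl
  base₇ 14∣23∣yz = refl
  base₇ 1z∣23∣4y = refl
  base₇ 12∣34∣yz = refl

-- From cyclic sums of labels to numbers of vertices.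

2^-injective : ∀ {m n} → 2 ^ m ≡ 2 ^ n → m ≡ n
2^-injective {m} {n} e = ℕ.≤-antisym
  (ℕ.≮⇒≥ λ n<m → ℕ.<⇒≢ (ℕ.^-monoʳ-< 2 ℕ.≤-refl n<m) (sym e))
  (ℕ.≮⇒≥ λ m<n → ℕ.<⇒≢ (ℕ.^-monoʳ-< 2 ℕ.≤-refl m<n) e)

∑-cycle : ∀ {A : Set} (ρ : A → Letter → Bool²) w {s} → s ∈ w → ∀ xs →
  ∑ xs (λ θ → cycle (ρ θ) w) ≡ length (filter (Vertices.consistent? w ∘ ρ) xs)
∑-cycle ρ (s ∷ w) _ = ∑-count (Vertices.consistent? (s ∷ w) ∘ ρ) (λ θ → cycle (ρ θ) (s ∷ w))
  (λ θ → cycle-consistent (ρ θ) s w) (λ θ → cycle-inconsistent (ρ θ) s w)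

module _ (w : Word) {M : ℕ} (name : Fin M → Letter) (ρ : Vec Bool² M → Letter → Bool²)
  (ρ-name : ∀ θ k → ρ θ (name k) ≡ Vec.lookup θ k)
  (pos : ∀ k → name k ⁺ ∈ w) (neg : ∀ k → name k ⁻ ∈ w)
  (named : ∀ {s} → s ∈ w → ∃ λ k → s ≡ name k ⁺ ⊎ s ≡ name k ⁻) where

  ∑-cycle-vertices : ∀ {s} → s ∈ w → ∑ (tuples pairs M) (λ θ → cycle (ρ θ) w) ≡ 2 ^ Polygon.#vertices w
  ∑-cycle-vertices s∈ = trans (∑-cycle ρ w s∈ (tuples pairs M))
    (Vertices.consistent-count w name ρ ρ-name (λ k → index (pos k)) (λ k → index (neg k))
      (λ k → sym (lookup-index (pos k))) (λ k → sym (lookup-index (neg k)))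
      (λ i → named (∈-lookup i)))

-- The offset `d` is needed for induction: in the tail of a subset every position stands for an
-- index one larger.
labels : ℕ → ∀ {n} → Subset n → List Letter
labels d []            = []
labels d (inside  ∷ K) = a⟨ suc d ⟩ ∷ labels (suc d) K
labels d (outside ∷ K) = labels (suc d) K

filter-map-suc : ∀ {n} x (K : Subset n) xs →
  filter (_∈? (x ∷ K)) (map suc xs) ≡ map suc (filter (_∈? K) xs)
filter-map-suc x K []       = refl
filter-map-suc x K (i ∷ xs) with i ∈? K
... | yes _ = cong (suc i ∷_) (filter-map-suc x K xs)
... | no  _ = filter-map-suc x K xs

labels-filter : ∀ d {n} (K : Subset n) →
  map (λ k → a⟨ suc (d + toℕ k) ⟩) (filter (_∈? K) (allFin n)) ≡ labels d K
labels-filter-suc : ∀ d {n} x (K : Subset n) →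
  map (λ k → a⟨ suc (d + toℕ k) ⟩) (filter (_∈? (x ∷ K)) (tabulate suc)) ≡ labels (suc d) K

labels-filter d []            = refl
labels-filter d (inside  ∷ K) = cong₂ _∷_ (cong (a⟨_⟩ ∘ suc) (ℕ.+-identityʳ d)) (labels-filter-suc d inside K)
labels-filter d (outside ∷ K) = labels-filter-suc d outside K

labels-filter-suc d {n} x K =
  trans (cong (map label ∘ filter (_∈? (x ∷ K))) (sym (map-tabulate (λ i → i) suc)))
  (trans (cong (map label) (filter-map-suc x K (allFin n)))
  (trans (sym (map-∘ _))
  (trans (map-cong (λ k → cong (a⟨_⟩ ∘ suc) (ℕ.+-suc d (toℕ k))) _)
  (labels-filter (suc d) K))))
  where
  label : Fin (suc n) → Letter
  label k = a⟨ suc (d + toℕ k) ⟩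

-- Abstracting the sign `σ` lets one induction serve `R₁`, `R₂` (with `r`) and `R₃`, `R₄` (with
-- `Vec.map swap r`).
Realises : (Letter → Symbol) → (Letter → Bool²) → ℕ → ∀ {n} → Vec Bool² n → Set
Realises σ ρ d r = ∀ k → (start ρ (σ a⟨ suc (d + toℕ k) ⟩) , end ρ (σ a⟨ suc (d + toℕ k) ⟩)) ≡ Vec.lookup r k

-- A symbol fixes the labels on both its sides, so cutting a word there leaves no sum, unlike
-- `chain-++`.
chain-snoc : ∀ ρ x w s w′ y → chain ρ x (w ++ s ∷ w′) y ≡ chain ρ x w (start ρ s) * chain ρ (end ρ s) w′ y
chain-snoc ρ x w s w′ y = begin-equality
  chain ρ x (w ++ s ∷ w′) y
    ≡⟨ chain-++ ρ x w (s ∷ w′) y ⟩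
  ΣB (λ z → chain ρ x w z * (δ z (start ρ s) * chain ρ (end ρ s) w′ y))
    ≡⟨ ΣB-cong (λ z → shuffle (chain ρ x w z) (δ z (start ρ s)) _) ⟩
  ΣB (λ z → δ z (start ρ s) * (chain ρ x w z * chain ρ (end ρ s) w′ y))
    ≡⟨ ΣB-δ (start ρ s) _ ⟩
  chain ρ x w (start ρ s) * chain ρ (end ρ s) w′ y ∎
  where
  shuffle : ∀ l m n → l * (m * n) ≡ m * (l * n)
  shuffle = solve-∀

module _ {σ : Letter → Symbol} {ρ : Letter → Bool²} where

  module _ {d n p} {r : Vec Bool² n} (real : Realises σ ρ d (p ∷ r)) where

    realises-tail : Realises σ ρ (suc d) r
    realises-tail k = subst (λ m → (start ρ (σ a⟨ suc m ⟩) , end ρ (σ a⟨ suc m ⟩)) ≡ Vec.lookup r k)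
      (ℕ.+-suc d (toℕ k)) (real (suc k))

    realises-head : (start ρ (σ a⟨ suc d ⟩) , end ρ (σ a⟨ suc d ⟩)) ≡ p
    realises-head = subst (λ m → (start ρ (σ a⟨ suc m ⟩) , end ρ (σ a⟨ suc m ⟩)) ≡ p)
      (ℕ.+-identityʳ d) (real zero)

  chain-up : ∀ d {n} (K : Subset n) r → Realises σ ρ d r → ∀ x y →
    chain ρ x (map σ (labels d K)) y ≡ up K r x y
  chain-up d []            []            real x y = refl
  chain-up d (inside  ∷ K) ((u , v) ∷ r) real x y = cong₂ _*_
    (cong (δ x ∘ proj₁) (realises-head real))
    (trans (cong (λ z → chain ρ (proj₂ z) (map σ (labels (suc d) K)) y) (realises-head real))
      (chain-up (suc d) K r (realises-tail real) v y))
  chain-up d (outside ∷ K) (_       ∷ r) real x y = chain-up (suc d) K r (realises-tail real) x y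

  chain-down : ∀ d {n} (K : Subset n) r → Realises σ ρ d r → ∀ y x →
    chain ρ y (map σ (reverse (labels d K))) x ≡ down K r y x
  chain-down d []            []            real y x = refl
  chain-down d (inside  ∷ K) ((u , v) ∷ r) real y x = begin-equality
    chain ρ y (map σ (reverse (a⟨ suc d ⟩ ∷ labels (suc d) K))) x
      ≡⟨ cong (λ ls → chain ρ y (map σ ls) x) (unfold-reverse a⟨ suc d ⟩ (labels (suc d) K)) ⟩
    chain ρ y (map σ (reverse (labels (suc d) K) ++ [ a⟨ suc d ⟩ ])) x
      ≡⟨ cong (λ w → chain ρ y w x) (map-++ σ (reverse (labels (suc d) K)) [ a⟨ suc d ⟩ ]) ⟩
    chain ρ y (map σ (reverse (labels (suc d) K)) ++ [ σ a⟨ suc d ⟩ ]) x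
      ≡⟨ chain-snoc ρ y (map σ (reverse (labels (suc d) K))) (σ a⟨ suc d ⟩) [] x ⟩
    chain ρ y (map σ (reverse (labels (suc d) K))) (start ρ (σ a⟨ suc d ⟩)) * δ (end ρ (σ a⟨ suc d ⟩)) x
      ≡⟨ cong₂ (λ p q → chain ρ y (map σ (reverse (labels (suc d) K))) (proj₁ p) * δ (proj₂ q) x)
           (realises-head real) (realises-head real) ⟩
    chain ρ y (map σ (reverse (labels (suc d) K))) u * δ v x
      ≡⟨ cong (_* δ v x) (chain-down (suc d) K r (realises-tail real) y u) ⟩
    down K r y u * δ v x ∎
  chain-down d (outside ∷ K) (_       ∷ r) real y x = chain-down (suc d) K r (realises-tail real) y x

increasing≡labels : ∀ {n} (K : Subset n) → increasing K ≡ labels 0 K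
increasing≡labels = labels-filter 0

decreasing≡labels : ∀ {n} (K : Subset n) → decreasing K ≡ reverse (labels 0 K)
decreasing≡labels K = cong reverse (increasing≡labels K)

at : ∀ {n} → Vec Bool² n → ℕ → Bool²
at []      _       = false , false
at (p ∷ r) zero    = p
at (p ∷ r) (suc k) = at r k

at-lookup : ∀ {n} (r : Vec Bool² n) k → at r (toℕ k) ≡ Vec.lookup r k
at-lookup (p ∷ r) zero    = refl
at-lookup (p ∷ r) (suc k) = at-lookup r k

module Rungs {n} (K T : Subset n) (ρ : Letter → Bool²) (r : Vec Bool² n) (ρ-at : ∀ k → ρ a⟨ suc k ⟩ ≡ at r k) where

  private
    real⁺ : Realises _⁺ ρ 0 r
    real⁺ k = trans (ρ-at (toℕ k)) (at-lookup r k)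
    real⁻ : Realises _⁻ ρ 0 (Vec.map swap r)
    real⁻ k = trans (cong swap (real⁺ k)) (sym (Vec.lookup-map k swap r))

  chain-R₁ : ∀ y x → chain ρ y (R₁ K T) x ≡ down K r y x
  chain-R₁ y x = trans (cong (λ ls → chain ρ y (map _⁺ ls) x) (decreasing≡labels K)) (chain-down 0 K r real⁺ y x)
  chain-R₂ : ∀ x y → chain ρ x (R₂ K T) y ≡ up (∁ K) r x y
  chain-R₂ x y = trans (cong (λ ls → chain ρ x (map _⁺ ls) y) (increasing≡labels (∁ K))) (chain-up 0 (∁ K) r real⁺ x y)
  chain-R₃ : ∀ y x → chain ρ y (R₃ K T) x ≡ down T (Vec.map swap r) y x
  chain-R₃ y x = trans (cong (λ ls → chain ρ y (map _⁻ ls) x) (decreasing≡labels T)) (chain-down 0 T _ real⁻ y x)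
  chain-R₄ : ∀ x y → chain ρ x (R₄ K T) y ≡ up (∁ T) (Vec.map swap r) x y
  chain-R₄ x y = trans (cong (λ ls → chain ρ x (map _⁻ ls) y) (increasing≡labels (∁ T))) (chain-up 0 (∁ T) _ real⁻ x y)

δ-subst : ∀ x y (f : Bool → ℕ) → δ x y * f y ≡ δ x y * f x
δ-subst false false f = refl
δ-subst false true  f = refl
δ-subst true  false f = refl
δ-subst true  true  f = refl

ΣB-Σ₃ : ∀ (f : Bool → Bool → Bool → Bool → ℕ) →
  (ΣB λ u → Σ₃ (f u)) ≡ (Σ₃ λ p q r → ΣB λ u → f u p q r)
ΣB-Σ₃ f = trans (ΣB-swap λ u p → ΣB λ q → ΣB λ r → f u p q r) (ΣB-cong λ p →
  trans (ΣB-swap λ u q → ΣB λ r → f u p q r) (ΣB-cong λ q → ΣB-swap λ u r → f u p q r))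

-- Vertex counts for the two ladder words.

ρ₁₀ : ∀ {n} → Vec Bool² (2 + n) → Letter → Bool²
ρ₁₀ (α ∷ β ∷ r) a           = α
ρ₁₀ (α ∷ β ∷ r) b           = β
-- Indices start at 1, so this letter occurs in no ladder word and its label is arbitrary.
ρ₁₀ (α ∷ β ∷ r) a⟨ zero ⟩   = false , false
ρ₁₀ (α ∷ β ∷ r) a⟨ suc k ⟩  = at r k

ρ₇ : ∀ {n} → Vec Bool² (1 + n) → Letter → Bool²
ρ₇ (α ∷ r) a           = α
ρ₇ (α ∷ r) b           = false , false
ρ₇ (α ∷ r) a⟨ zero ⟩   = false , false
ρ₇ (α ∷ r) a⟨ suc k ⟩  = at r k

module _ {n} (K T : Subset n) where

  private
    c₁ c₂ c₃ c₄ : Vec Bool² n → Bool → Bool → ℕ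
    c₁ r = down K r
    c₂ r = up (∁ K) r
    c₃ r = down T (Vec.map swap r)
    c₄ r = up (∁ T) (Vec.map swap r)

  -- `x` is the corner between `R₁` and `R₄`. The delta comes from the adjacent symbols `a ⁻` and
  -- `b ⁺`: both letters start at the same vertex.
  cycle₁₀ : ∀ u v p q r → cycle (ρ₁₀ ((u , v) ∷ (p , q) ∷ r)) (surface₁₀ K T) ≡
    δ u p * ΣB λ x → ladderTerm K T x v q x u v q u r
  cycle₁₀ u v p q r = begin-equality
    ΣB (λ z → chain ρ z (surface₁₀ K T) z)
      ≡⟨ (ΣB-cong λ z → trans (chain-++ ρ z (R₁ K T) _ z) (ΣB-cong λ x → cong₂ _*_ (chain-R₁ z x)
          (trans (chain-snoc ρ x (R₄ K T) (a ⁺) _ z) (cong₂ _*_ (chain-R₄ x u)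
          (trans (chain-snoc ρ v (R₂ K T) (a ⁻) _ z) (cong₂ _*_ (chain-R₂ v v)
          (cong (δ u p *_) (trans (chain-snoc ρ q (R₃ K T) (b ⁻) [] z) (cong (_* δ p z) (chain-R₃ q q)))))))))) ⟩
    ΣB (λ z → ΣB λ x → c₁ r z x * (c₄ r x u * (c₂ r v v * (δ u p * (c₃ r q q * δ p z)))))
      ≡⟨ (ΣB-cong λ z → trans
          (ΣB-cong λ x → shuffle (c₁ r z x) (c₄ r x u) (c₂ r v v) (δ u p) (c₃ r q q) (δ p z))
          (ΣB-*ˡ (δ p z) _)) ⟩
    ΣB (λ z → δ p z * ΣB λ x → δ u p * (c₁ r z x * c₂ r v v * (c₃ r q q * c₄ r x u)))
      ≡⟨ ΣB-δʳ p _ ⟩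
    ΣB (λ x → δ u p * (c₁ r p x * c₂ r v v * (c₃ r q q * c₄ r x u)))
      ≡⟨ ΣB-*ˡ (δ u p) _ ⟩
    δ u p * ΣB (λ x → c₁ r p x * c₂ r v v * (c₃ r q q * c₄ r x u))
      ≡⟨ δ-subst u p (λ p → ΣB (λ x → c₁ r p x * c₂ r v v * (c₃ r q q * c₄ r x u))) ⟩
    δ u p * ΣB (λ x → ladderTerm K T x v q x u v q u r) ∎
    where
    ρ = ρ₁₀ ((u , v) ∷ (p , q) ∷ r)
    open Rungs K T ρ r (λ _ → refl)
    shuffle : ∀ c₁ c₄ c₂ d c₃ e → c₁ * (c₄ * (c₂ * (d * (c₃ * e)))) ≡ e * (d * (c₁ * c₂ * (c₃ * c₄)))
    shuffle = solve-∀

  ∑-cycle₁₀ : ∑ (tuples pairs (2 + n)) (λ θ → cycle (ρ₁₀ θ) (surface₁₀ K T)) ≡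
    ∑ₘ 14∣2y∣3z (Framed.framed outer₁₀ K T)
  ∑-cycle₁₀ = begin-equality
    ∑ (tuples pairs (2 + n)) (λ θ → cycle (ρ₁₀ θ) (surface₁₀ K T))
      ≡⟨ ∑-tuples (suc n) _ ⟩
    ΣB (λ u → ΣB λ v → ∑ (tuples pairs (1 + n)) λ θ → cycle (ρ₁₀ ((u , v) ∷ θ)) (surface₁₀ K T))
      ≡⟨ (ΣB-cong λ u → ΣB-cong λ v → trans (∑-tuples n _) (ΣB-cong λ p → ΣB-cong λ q →
          trans (∑-cong (tuples pairs n) λ r → cycle₁₀ u v p q r) (∑-*ˡ (tuples pairs n) (δ u p) _))) ⟩
    ΣB (λ u → ΣB λ v → ΣB λ p → ΣB λ q → δ u p * ∑ (tuples pairs n) λ r → ΣB λ x → ladderTerm K T x v q x u v q u r)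
      ≡⟨ (ΣB-cong λ u → ΣB-cong λ v → trans (ΣB-cong λ p → ΣB-*ˡ (δ u p) _) (ΣB-δʳ u _)) ⟩
    ΣB (λ u → ΣB λ v → ΣB λ q → ∑ (tuples pairs n) λ r → ΣB λ x → ladderTerm K T x v q x u v q u r)
      ≡⟨ (ΣB-cong λ u → ΣB-cong λ v → ΣB-cong λ q → ∑-ΣB (tuples pairs n) _) ⟩
    ΣB (λ u → Σ₃ λ v q x → L x v q u)
      ≡⟨ (ΣB-cong λ u → Σ₃-swap₁₃ λ v q x → L x v q u) ⟩
    ΣB (λ u → Σ₃ λ x q v → L x v q u)
      ≡⟨ (ΣB-cong λ u → Σ₃-swap₂₃ λ x q v → L x v q u) ⟩
    ΣB (λ u → Σ₃ λ x v q → L x v q u)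
      ≡⟨ ΣB-Σ₃ (λ u x v q → L x v q u) ⟩
    Σ₃ (λ x v q → ΣB λ u → L x v q u) ∎
    where
    L : Bool → Bool → Bool → Bool → ℕ
    L x v q u = ladder K T x v q x u v q u

  -- `x` is the corner between `R₃` and `R₂`, and `y` the one between `R₂` and `R₄`.
  cycle₇ : ∀ u v r → cycle (ρ₇ ((u , v) ∷ r)) (surface₇ K T) ≡
    ΣB λ x → ΣB λ y → ladderTerm K T v x x y v y u u r
  cycle₇ u v r = begin-equality
    ΣB (λ z → chain ρ z (surface₇ K T) z)
      ≡⟨ ΣB-δ u _ ⟩
    chain ρ v (R₁ K T ++ a ⁻ ∷ (R₃ K T ++ R₂ K T ++ R₄ K T)) u
      ≡⟨ chain-snoc ρ v (R₁ K T) (a ⁻) _ u ⟩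
    chain ρ v (R₁ K T) v * chain ρ u (R₃ K T ++ R₂ K T ++ R₄ K T) u
      ≡⟨ cong₂ _*_ (chain-R₁ v v) (trans (chain-++ ρ u (R₃ K T) _ u) (ΣB-cong λ x → cong₂ _*_ (chain-R₃ u x)
          (trans (chain-++ ρ x (R₂ K T) _ u) (ΣB-cong λ y → cong₂ _*_ (chain-R₂ x y) (chain-R₄ y u))))) ⟩
    c₁ r v v * ΣB (λ x → c₃ r u x * ΣB λ y → c₂ r x y * c₄ r y u)
      ≡⟨ ΣB-*ˡ (c₁ r v v) _ ⟨
    ΣB (λ x → c₁ r v v * (c₃ r u x * ΣB λ y → c₂ r x y * c₄ r y u))
      ≡⟨ (ΣB-cong λ x → trans (cong (c₁ r v v *_) (sym (ΣB-*ˡ (c₃ r u x) _))) (trans (sym (ΣB-*ˡ (c₁ r v v) _))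
          (ΣB-cong λ y → shuffle (c₁ r v v) (c₃ r u x) (c₂ r x y) (c₄ r y u)))) ⟩
    ΣB (λ x → ΣB λ y → ladderTerm K T v x x y v y u u r) ∎
    where
    ρ = ρ₇ ((u , v) ∷ r)
    open Rungs K T ρ r (λ _ → refl)
    shuffle : ∀ c₁ c₃ c₂ c₄ → c₁ * (c₃ * (c₂ * c₄)) ≡ c₁ * c₂ * (c₃ * c₄)
    shuffle = solve-∀

  ∑-cycle₇ : ∑ (tuples pairs (1 + n)) (λ θ → cycle (ρ₇ θ) (surface₇ K T)) ≡
    ∑ₘ 1z∣23∣4y (Framed.framed outer₇ K T)
  ∑-cycle₇ = begin-equality
    ∑ (tuples pairs (1 + n)) (λ θ → cycle (ρ₇ θ) (surface₇ K T))
      ≡⟨ ∑-tuples n _ ⟩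
    ΣB (λ u → ΣB λ v → ∑ (tuples pairs n) λ r → cycle (ρ₇ ((u , v) ∷ r)) (surface₇ K T))
      ≡⟨ (ΣB-cong λ u → ΣB-cong λ v → trans (∑-cong (tuples pairs n) (cycle₇ u v))
          (trans (∑-ΣB (tuples pairs n) _) (ΣB-cong λ x → ∑-ΣB (tuples pairs n) _))) ⟩
    ΣB (λ u → Σ₃ λ v x y → ladder K T v x x y v y u u)
      ≡⟨ ΣB-Σ₃ (λ u v x y → ladder K T v x x y v y u u) ⟩
    Σ₃ (λ v x y → ΣB λ u → ladder K T v x x y v y u u) ∎

name₁₀ : ∀ {n} → Fin (2 + n) → Letter
name₁₀ zero          = a
name₁₀ (suc zero)    = b
name₁₀ (suc (suc k)) = a⟨ suc (toℕ k) ⟩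

name₇ : ∀ {n} → Fin (1 + n) → Letter
name₇ zero    = a
name₇ (suc k) = a⟨ suc (toℕ k) ⟩

ρ₁₀-name : ∀ {n} (θ : Vec Bool² (2 + n)) k → ρ₁₀ θ (name₁₀ k) ≡ Vec.lookup θ k
ρ₁₀-name (α ∷ β ∷ r) zero          = refl
ρ₁₀-name (α ∷ β ∷ r) (suc zero)    = refl
ρ₁₀-name (α ∷ β ∷ r) (suc (suc k)) = at-lookup r k

ρ₇-name : ∀ {n} (θ : Vec Bool² (1 + n)) k → ρ₇ θ (name₇ k) ≡ Vec.lookup θ k
ρ₇-name (α ∷ r) zero    = refl
ρ₇-name (α ∷ r) (suc k) = at-lookup r k

increasing-∈ : ∀ {n} (K : Subset n) k → a⟨ suc (toℕ k) ⟩ ∈ increasing K ⊎ a⟨ suc (toℕ k) ⟩ ∈ increasing (∁ K)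
increasing-∈ K k with k ∈? K
... | yes k∈K = inj₁ (∈-map⁺ _ (∈-filter⁺ (_∈? K) (∈-allFin k) k∈K))
... | no  k∉K = inj₂ (∈-map⁺ _ (∈-filter⁺ (_∈? ∁ K) (∈-allFin k) (x∉p⇒x∈∁p k∉K)))

increasing-named : ∀ {n} (K : Subset n) {x} → x ∈ increasing K → ∃ λ k → x ≡ a⟨ suc (toℕ k) ⟩
increasing-named K x∈ = let k , _ , eq = ∈-map⁻ _ x∈ in k , eq

module _ {n} (K T : Subset n) where

  R₁∪R₂ : ∀ k → a⟨ suc (toℕ k) ⟩ ⁺ ∈ R₁ K T ⊎ a⟨ suc (toℕ k) ⟩ ⁺ ∈ R₂ K T
  R₁∪R₂ k with increasing-∈ K k
  ... | inj₁ x∈ = inj₁ (∈-map⁺ _⁺ (reverse⁺ x∈))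
  ... | inj₂ x∈ = inj₂ (∈-map⁺ _⁺ x∈)

  R₃∪R₄ : ∀ k → a⟨ suc (toℕ k) ⟩ ⁻ ∈ R₃ K T ⊎ a⟨ suc (toℕ k) ⟩ ⁻ ∈ R₄ K T
  R₃∪R₄ k with increasing-∈ T k
  ... | inj₁ x∈ = inj₁ (∈-map⁺ _⁻ (reverse⁺ x∈))
  ... | inj₂ x∈ = inj₂ (∈-map⁺ _⁻ x∈)

  private
    Indexed : Symbol → Set
    Indexed s = ∃ λ (k : Fin n) → s ≡ a⟨ suc (toℕ k) ⟩ ⁺ ⊎ s ≡ a⟨ suc (toℕ k) ⟩ ⁻

    indexed⁺ : ∀ {ls} → (∀ {x} → x ∈ ls → ∃ λ (k : Fin n) → x ≡ a⟨ suc (toℕ k) ⟩) → All Indexed (map _⁺ ls)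
    indexed⁺ named = All.map⁺ (All.tabulate λ x∈ → let k , e = named x∈ in k , inj₁ (cong _⁺ e))

    indexed⁻ : ∀ {ls} → (∀ {x} → x ∈ ls → ∃ λ (k : Fin n) → x ≡ a⟨ suc (toℕ k) ⟩) → All Indexed (map _⁻ ls)
    indexed⁻ named = All.map⁺ (All.tabulate λ x∈ → let k , e = named x∈ in k , inj₂ (cong _⁻ e))

    R₁-indexed : All Indexed (R₁ K T)
    R₁-indexed = indexed⁺ λ x∈ → increasing-named K (reverse⁻ x∈)
    R₂-indexed : All Indexed (R₂ K T)
    R₂-indexed = indexed⁺ (increasing-named (∁ K))
    R₃-indexed : All Indexed (R₃ K T)
    R₃-indexed = indexed⁻ λ x∈ → increasing-named T (reverse⁻ x∈)
    R₄-indexed : All Indexed (R₄ K T)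
    R₄-indexed = indexed⁻ (increasing-named (∁ T))

    Named₁₀ Named₇ : Symbol → Set
    Named₁₀ s = ∃ λ k → s ≡ name₁₀ {n} k ⁺ ⊎ s ≡ name₁₀ {n} k ⁻
    Named₇  s = ∃ λ k → s ≡ name₇ {n} k ⁺ ⊎ s ≡ name₇ {n} k ⁻

    indexed⇒named₁₀ : ∀ {s} → Indexed s → Named₁₀ s
    indexed⇒named₁₀ (k , e) = suc (suc k) , e
    indexed⇒named₇ : ∀ {s} → Indexed s → Named₇ s
    indexed⇒named₇ (k , e) = suc k , e

    named₁₀ : All Named₁₀ (surface₁₀ K T)
    named₁₀ =
      All.++⁺ (All.map indexed⇒named₁₀ R₁-indexed) (All.++⁺ (All.map indexed⇒named₁₀ R₄-indexed)
      ((zero , inj₁ refl) ∷ All.++⁺ (All.map indexed⇒named₁₀ R₂-indexed)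
      ((zero , inj₂ refl) ∷ (suc zero , inj₁ refl) ∷ All.++⁺ (All.map indexed⇒named₁₀ R₃-indexed)
      ((suc zero , inj₂ refl) ∷ []))))

    named₇ : All Named₇ (surface₇ K T)
    named₇ = (zero , inj₁ refl) ∷ All.++⁺ (All.map indexed⇒named₇ R₁-indexed)
      ((zero , inj₂ refl) ∷ All.++⁺ (All.map indexed⇒named₇ R₃-indexed)
      (All.++⁺ (All.map indexed⇒named₇ R₂-indexed) (All.map indexed⇒named₇ R₄-indexed)))

    pos₁₀ : ∀ (k : Fin (2 + n)) → name₁₀ k ⁺ ∈ surface₁₀ K T
    pos₁₀ zero = ∈-++⁺ʳ (R₁ K T) (∈-++⁺ʳ (R₄ K T) (here refl))
    pos₁₀ (suc zero) = ∈-++⁺ʳ (R₁ K T) (∈-++⁺ʳ (R₄ K T) (there (∈-++⁺ʳ (R₂ K T) (there (here refl)))))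
    pos₁₀ (suc (suc k)) with R₁∪R₂ k
    ... | inj₁ s∈ = ∈-++⁺ˡ s∈
    ... | inj₂ s∈ = ∈-++⁺ʳ (R₁ K T) (∈-++⁺ʳ (R₄ K T) (there (∈-++⁺ˡ s∈)))

    neg₁₀ : ∀ (k : Fin (2 + n)) → name₁₀ k ⁻ ∈ surface₁₀ K T
    neg₁₀ zero = ∈-++⁺ʳ (R₁ K T) (∈-++⁺ʳ (R₄ K T) (there (∈-++⁺ʳ (R₂ K T) (here refl))))
    neg₁₀ (suc zero) = ∈-++⁺ʳ (R₁ K T) (∈-++⁺ʳ (R₄ K T) (there (∈-++⁺ʳ (R₂ K T)
      (there (there (∈-++⁺ʳ (R₃ K T) (here refl)))))))
    neg₁₀ (suc (suc k)) with R₃∪R₄ k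
    ... | inj₁ s∈ = ∈-++⁺ʳ (R₁ K T) (∈-++⁺ʳ (R₄ K T) (there (∈-++⁺ʳ (R₂ K T) (there (there (∈-++⁺ˡ s∈))))))
    ... | inj₂ s∈ = ∈-++⁺ʳ (R₁ K T) (∈-++⁺ˡ s∈)

    pos₇ : ∀ (k : Fin (1 + n)) → name₇ k ⁺ ∈ surface₇ K T
    pos₇ zero = here refl
    pos₇ (suc k) with R₁∪R₂ k
    ... | inj₁ s∈ = there (∈-++⁺ˡ s∈)
    ... | inj₂ s∈ = there (∈-++⁺ʳ (R₁ K T) (there (∈-++⁺ʳ (R₃ K T) (∈-++⁺ˡ s∈))))

    neg₇ : ∀ (k : Fin (1 + n)) → name₇ k ⁻ ∈ surface₇ K T
    neg₇ zero = there (∈-++⁺ʳ (R₁ K T) (here refl))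
    neg₇ (suc k) with R₃∪R₄ k
    ... | inj₁ s∈ = there (∈-++⁺ʳ (R₁ K T) (there (∈-++⁺ˡ s∈)))
    ... | inj₂ s∈ = there (∈-++⁺ʳ (R₁ K T) (there (∈-++⁺ʳ (R₃ K T) (∈-++⁺ʳ (R₂ K T) s∈))))

  -- One sum over labellings is evaluated twice, globally over the vertices and rung by rung; the
  -- exponents of the two powers of 2 must agree.
  #vertices₁₀ : Polygon.#vertices (surface₁₀ K T) ≡ vertices κ₁₀ 14∣2y∣3z K T
  #vertices₁₀ = 2^-injective (trans
    (sym (∑-cycle-vertices (surface₁₀ K T) name₁₀ ρ₁₀ ρ₁₀-name pos₁₀ neg₁₀ (All.lookup named₁₀) (pos₁₀ zero)))
    (trans (∑-cycle₁₀ K T) (Framed.∑ₘ-framed outer₁₀ base₁₀ 14∣2y∣3z K T)))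

  #vertices₇ : Polygon.#vertices (surface₇ K T) ≡ vertices κ₇ 1z∣23∣4y K T
  #vertices₇ = 2^-injective (trans
    (sym (∑-cycle-vertices (surface₇ K T) name₇ ρ₇ ρ₇-name pos₇ neg₇ (All.lookup named₇) (pos₇ zero)))
    (trans (∑-cycle₇ K T) (Framed.∑ₘ-framed outer₇ base₇ 1z∣23∣4y K T)))

-- Edge counts, Euler characteristic and genus.

#positive : Word → ℕ
#positive w = length (filter positive? w)

#positive-++ : ∀ w w′ → #positive (w ++ w′) ≡ #positive w + #positive w′
#positive-++ w w′ = trans (cong length (filter-++ positive? w w′)) (length-++ (filter positive? w))

#positive-⁺ : ∀ ls → #positive (map _⁺ ls) ≡ length ls
#positive-⁺ ls = trans
  (cong length (filter-all positive? (All.map⁺ {xs = ls} (All.tabulate λ _ → positive))))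
  (length-map _⁺ ls)

#positive-⁻ : ∀ ls → #positive (map _⁻ ls) ≡ 0
#positive-⁻ ls = cong length (filter-none positive? (All.map⁺ {xs = ls} (All.tabulate λ _ ())))

length-labels : ∀ d {n} (K : Subset n) → length (labels d K) + length (labels d (∁ K)) ≡ n
length-labels d []            = refl
length-labels d (inside  ∷ K) = cong suc (length-labels (suc d) K)
length-labels d (outside ∷ K) = trans (ℕ.+-suc _ _) (cong suc (length-labels (suc d) K))

module _ {n} (K T : Subset n) where

  private
    #R₁ : #positive (R₁ K T) ≡ length (labels 0 K)
    #R₁ = trans (#positive-⁺ (decreasing K)) (trans (length-reverse (increasing K)) (cong length (increasing≡labels K)))
    #R₂ : #positive (R₂ K T) ≡ length (labels 0 (∁ K))
    #R₂ = trans (#positive-⁺ (increasing (∁ K))) (cong length (increasing≡labels (∁ K)))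
    #R₃ : #positive (R₃ K T) ≡ 0
    #R₃ = #positive-⁻ (decreasing T)
    #R₄ : #positive (R₄ K T) ≡ 0
    #R₄ = #positive-⁻ (increasing (∁ T))

  #edges₁₀ : Polygon.#edges (surface₁₀ K T) ≡ 2 + n
  #edges₁₀ = begin-equality
    #positive (R₁ K T ++ R₄ K T ++ a ⁺ ∷ (R₂ K T ++ a ⁻ ∷ b ⁺ ∷ (R₃ K T ++ b ⁻ ∷ [])))
      ≡⟨ trans (#positive-++ (R₁ K T) _) (cong₂ _+_ #R₁ (trans (#positive-++ (R₄ K T) _) (cong₂ _+_ #R₄
         (cong suc (trans (#positive-++ (R₂ K T) _) (cong₂ _+_ #R₂
         (cong suc (trans (#positive-++ (R₃ K T) _) (cong (_+ 0) #R₃))))))))) ⟩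
    length (labels 0 K) + (suc (length (labels 0 (∁ K)) + 1))
      ≡⟨ shuffle (length (labels 0 K)) (length (labels 0 (∁ K))) ⟩
    2 + (length (labels 0 K) + length (labels 0 (∁ K)))
      ≡⟨ cong (2 +_) (length-labels 0 K) ⟩
    2 + n ∎
    where
    shuffle : ∀ x y → x + suc (y + 1) ≡ 2 + (x + y)
    shuffle = solve-∀

  #edges₇ : Polygon.#edges (surface₇ K T) ≡ 1 + n
  #edges₇ = begin-equality
    suc (#positive (R₁ K T ++ a ⁻ ∷ (R₃ K T ++ R₂ K T ++ R₄ K T)))
      ≡⟨ cong suc (trans (#positive-++ (R₁ K T) _) (cong₂ _+_ #R₁ (trans (#positive-++ (R₃ K T) _) (cong₂ _+_ #R₃
         (trans (#positive-++ (R₂ K T) _) (cong₂ _+_ #R₂ #R₄)))))) ⟩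
    suc (length (labels 0 K) + (length (labels 0 (∁ K)) + 0))
      ≡⟨ cong suc (trans (cong (length (labels 0 K) +_) (ℕ.+-identityʳ _)) (length-labels 0 K)) ⟩
    1 + n ∎

hasGenus⇔ : ∀ w γ → Polygon.#vertices w + 2 * γ ≡ suc (Polygon.#edges w) →
  ∀ {g} → (HasGenus w g → γ ≡ g) × (γ ≡ g → HasGenus w g)
hasGenus⇔ w γ e {g} = (λ h → ℕ.*-cancelˡ-≡ γ g 2 (ℤ.+-injective (cancel (trans (sym χ-γ) h)))) , λ { refl → χ-γ }
  where
  V = Polygon.#vertices w
  E = Polygon.#edges w
  χ-γ : χ w ≡ ℤ.+ 2 ℤ.- ℤ.+ (2 * γ)
  χ-γ = trans (solve₁ (ℤ.+ V) (ℤ.+ E) (ℤ.+ (2 * γ)))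
    (trans (cong (λ m → ℤ.+ m ℤ.- ℤ.+ E ℤ.+ ℤ.+ 1 ℤ.- ℤ.+ (2 * γ)) e) (solve₂ (ℤ.+ E) (ℤ.+ (2 * γ))))
    where
    solve₁ : ∀ V E x → V ℤ.- E ℤ.+ ℤ.+ 1 ≡ V ℤ.+ x ℤ.- E ℤ.+ ℤ.+ 1 ℤ.- x
    solve₁ = ℤ-Solver.solve-∀
    solve₂ : ∀ E x → ℤ.+ 1 ℤ.+ E ℤ.- E ℤ.+ ℤ.+ 1 ℤ.- x ≡ ℤ.+ 2 ℤ.- x
    solve₂ = ℤ-Solver.solve-∀
  cancel : ∀ {x y} → ℤ.+ 2 ℤ.- x ≡ ℤ.+ 2 ℤ.- y → x ≡ y
  cancel p = ℤ.neg-injective (cancelˡ ℤ.+-0-abelianGroup (ℤ.+ 2) _ _ p)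

-- The subtraction and the halving are exact for κ₁₀ and κ₇: this is Balanced.
genusStep : (Matching → ℕ) → Matching → Bool → Bool → ℕ
genusStep κ s k t = ⌊ suc (κ s) ∸ (κ (step s k t) + closes s k t) /2⌋

genus : (Matching → ℕ) → Matching → ∀ {n} → Subset n → Subset n → ℕ
genus κ s []      []      = 0
genus κ s (k ∷ K) (t ∷ T) = genusStep κ s k t + genus κ (step s k t) K T

-- A rung adds one edge, so by Euler's formula it must raise vertices plus twice the genus by
-- exactly one.
Balanced : (Matching → ℕ) → Set
Balanced κ = ∀ s k t → κ (step s k t) + closes s k t + 2 * genusStep κ s k t ≡ suc (κ s)

-- At the initial matchings `κ` is 3 and 2, one more than the number of edges without rungs: the
-- induction starts from a sphere, and `n + κ s` is one more than the number of edges.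
vertices+genus : ∀ {κ} → Balanced κ → ∀ s {n} (K T : Subset n) → vertices κ s K T + 2 * genus κ s K T ≡ n + κ s
vertices+genus     bal s []      []      = ℕ.+-identityʳ _
vertices+genus {κ} bal s {suc n} (k ∷ K) (t ∷ T) = begin-equality
  c + v + 2 * (i + γ)
    ≡⟨ shuffle₁ c v i γ ⟩
  c + 2 * i + (v + 2 * γ)
    ≡⟨ cong (c + 2 * i +_) (vertices+genus bal (step s k t) K T) ⟩
  c + 2 * i + (n + κ (step s k t))
    ≡⟨ shuffle₂ c i n (κ (step s k t)) ⟩
  n + (κ (step s k t) + c + 2 * i)
    ≡⟨ cong (n +_) (bal s k t) ⟩
  n + suc (κ s)
    ≡⟨ ℕ.+-suc n (κ s) ⟩
  suc n + κ s ∎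
  where
  c = closes s k t
  i = genusStep κ s k t
  v = vertices κ (step s k t) K T
  γ = genus κ (step s k t) K T
  shuffle₁ : ∀ c v i γ → c + v + 2 * (i + γ) ≡ c + 2 * i + (v + 2 * γ)
  shuffle₁ = solve-∀
  shuffle₂ : ∀ c i n k → c + 2 * i + (n + k) ≡ n + (k + c + 2 * i)
  shuffle₂ = solve-∀

balanced₁₀ : Balanced κ₁₀
balanced₁₀ 14∣2y∣3z true  true  = refl
balanced₁₀ 14∣2y∣3z true  false = refl
balanced₁₀ 14∣2y∣3z false true  = refl
balanced₁₀ 14∣2y∣3z false false = refl
balanced₁₀ 12∣3z∣4y true  true  = refl
balanced₁₀ 12∣3z∣4y true  false = refl
balanced₁₀ 12∣3z∣4y false true  = refl
balanced₁₀ 12∣3z∣4y false false = refl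
balanced₁₀ 1z∣2y∣34 true  true  = refl
balanced₁₀ 1z∣2y∣34 true  false = refl
balanced₁₀ 1z∣2y∣34 false true  = refl
balanced₁₀ 1z∣2y∣34 false false = refl
balanced₁₀ 14∣23∣yz true  true  = refl
balanced₁₀ 14∣23∣yz true  false = refl
balanced₁₀ 14∣23∣yz false true  = refl
balanced₁₀ 14∣23∣yz false false = refl
balanced₁₀ 1z∣23∣4y true  true  = refl
balanced₁₀ 1z∣23∣4y true  false = refl
balanced₁₀ 1z∣23∣4y false true  = refl
balanced₁₀ 1z∣23∣4y false false = refl
balanced₁₀ 12∣34∣yz true  true  = refl
balanced₁₀ 12∣34∣yz true  false = refl
balanced₁₀ 12∣34∣yz false true  = refl
balanced₁₀ 12∣34∣yz false false = refl

balanced₇ : Balanced κ₇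
balanced₇ 14∣2y∣3z true  true  = refl
balanced₇ 14∣2y∣3z true  false = refl
balanced₇ 14∣2y∣3z false true  = refl
balanced₇ 14∣2y∣3z false false = refl
balanced₇ 12∣3z∣4y true  true  = refl
balanced₇ 12∣3z∣4y true  false = refl
balanced₇ 12∣3z∣4y false true  = refl
balanced₇ 12∣3z∣4y false false = refl
balanced₇ 1z∣2y∣34 true  true  = refl
balanced₇ 1z∣2y∣34 true  false = refl
balanced₇ 1z∣2y∣34 false true  = refl
balanced₇ 1z∣2y∣34 false false = refl
balanced₇ 14∣23∣yz true  true  = refl
balanced₇ 14∣23∣yz true  false = refl
balanced₇ 14∣23∣yz false true  = refl
balanced₇ 14∣23∣yz false false = refl
balanced₇ 1z∣23∣4y true  true  = refl
balanced₇ 1z∣23∣4y true  false = refl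
balanced₇ 1z∣23∣4y false true  = refl
balanced₇ 1z∣23∣4y false false = refl
balanced₇ 12∣34∣yz true  true  = refl
balanced₇ 12∣34∣yz true  false = refl
balanced₇ 12∣34∣yz false true  = refl
balanced₇ 12∣34∣yz false false = refl

hasGenus₁₀ : ∀ {n} (K T : Subset n) {g} → let γ = genus κ₁₀ 14∣2y∣3z K T in
  (HasGenus (surface₁₀ K T) g → γ ≡ g) × (γ ≡ g → HasGenus (surface₁₀ K T) g)
hasGenus₁₀ {n} K T = hasGenus⇔ (surface₁₀ K T) _ (begin-equality
  Polygon.#vertices (surface₁₀ K T) + 2 * genus κ₁₀ 14∣2y∣3z K T
    ≡⟨ cong (_+ 2 * genus κ₁₀ 14∣2y∣3z K T) (#vertices₁₀ K T) ⟩
  vertices κ₁₀ 14∣2y∣3z K T + 2 * genus κ₁₀ 14∣2y∣3z K T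
    ≡⟨ vertices+genus balanced₁₀ 14∣2y∣3z K T ⟩
  n + 3
    ≡⟨ ℕ.+-comm n 3 ⟩
  3 + n
    ≡⟨ cong suc (#edges₁₀ K T) ⟨
  suc (Polygon.#edges (surface₁₀ K T)) ∎)

hasGenus₇ : ∀ {n} (K T : Subset n) {g} → let γ = genus κ₇ 1z∣23∣4y K T in
  (HasGenus (surface₇ K T) g → γ ≡ g) × (γ ≡ g → HasGenus (surface₇ K T) g)
hasGenus₇ {n} K T = hasGenus⇔ (surface₇ K T) _ (begin-equality
  Polygon.#vertices (surface₇ K T) + 2 * genus κ₇ 1z∣23∣4y K T
    ≡⟨ cong (_+ 2 * genus κ₇ 1z∣23∣4y K T) (#vertices₇ K T) ⟩
  vertices κ₇ 1z∣23∣4y K T + 2 * genus κ₇ 1z∣23∣4y K T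
    ≡⟨ vertices+genus balanced₇ 1z∣23∣4y K T ⟩
  n + 2
    ≡⟨ ℕ.+-comm n 2 ⟩
  2 + n
    ≡⟨ cong suc (#edges₇ K T) ⟨
  suc (Polygon.#edges (surface₇ K T)) ∎)

-- Genus distributions and their recursion.

∑-zero : ∀ {A : Set} (xs : List A) → ∑ xs (λ _ → 0) ≡ 0
∑-zero []       = refl
∑-zero (_ ∷ xs) = ∑-zero xs

length-filter-map : ∀ {A B : Set} {P : B → Set} (P? : Decidable P) (f : A → B) xs →
  length (filter P? (map f xs)) ≡ length (filter (P? ∘ f) xs)
length-filter-map P? f []       = refl
length-filter-map P? f (x ∷ xs) with P? (f x)
... | yes _ = cong suc (length-filter-map P? f xs)
... | no  _ = length-filter-map P? f xs

ε : ℕ → ℕ → ℕ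
ε zero    zero    = 1
ε zero    (suc _) = 0
ε (suc _) zero    = 0
ε (suc m) (suc n) = ε m n

ε-≡ : ∀ {m n} → m ≡ n → ε m n ≡ 1
ε-≡ {zero}  refl = refl
ε-≡ {suc m} refl = ε-≡ {m} refl

ε-≢ : ∀ m n → ¬ m ≡ n → ε m n ≡ 0
ε-≢ zero    zero    m≢n = contradiction refl m≢n
ε-≢ zero    (suc n) _   = refl
ε-≢ (suc m) zero    _   = refl
ε-≢ (suc m) (suc n) m≢n = ε-≢ m n (m≢n ∘ cong suc)

-- Multiplication of generating functions by the i-th power of the variable.
shift : ℕ → (ℕ → ℕ) → ℕ → ℕ
shift zero    f g       = f g
shift (suc i) f zero    = 0
shift (suc i) f (suc g) = shift i f g

shift-∑ : ∀ {A : Set} i (xs : List A) (f : A → ℕ → ℕ) g →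
  ∑ xs (λ x → shift i (f x) g) ≡ shift i (λ g → ∑ xs λ x → f x g) g
shift-∑ zero    xs f g       = refl
shift-∑ (suc i) xs f zero    = ∑-zero xs
shift-∑ (suc i) xs f (suc g) = shift-∑ i xs f g

ε-+ : ∀ i γ g → ε (i + γ) g ≡ shift i (ε γ) g
ε-+ zero    γ g       = refl
ε-+ (suc i) γ zero    = refl
ε-+ (suc i) γ (suc g) = ε-+ i γ g

∑-subsets : ∀ n (f : Subset (suc n) → ℕ) →
  ∑ (subsets (suc n)) f ≡ ∑ (subsets n) (λ K → f (outside ∷ K)) + ∑ (subsets n) (λ K → f (inside ∷ K))
∑-subsets n f = trans (∑-++ (map (outside ∷_) (subsets n)) (map (inside ∷_) (subsets n)) f)
  (cong₂ _+_ (∑-map (outside ∷_) (subsets n) f) (∑-map (inside ∷_) (subsets n) f))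

#genus : (Matching → ℕ) → Matching → ℕ → ℕ → ℕ
#genus κ s n g = ∑ (subsets n) λ K → ∑ (subsets n) λ T → ε (genus κ s K T) g

module _ (κ : Matching → ℕ) (s : Matching) where

  private
    branch : Bool → Bool → ℕ → ℕ → ℕ
    branch k t n = shift (genusStep κ s k t) (#genus κ (step s k t) n)

    branch-∑ : ∀ k t n g →
      (∑ (subsets n) λ K → ∑ (subsets n) λ T → ε (genus κ s (k ∷ K) (t ∷ T)) g) ≡ branch k t n g
    branch-∑ k t n g = trans
      (∑-cong (subsets n) λ K → trans
        (∑-cong (subsets n) λ T → ε-+ i (genus κ (step s k t) K T) g)
        (shift-∑ i (subsets n) (λ T → ε (genus κ (step s k t) K T)) g))
      (shift-∑ i (subsets n) (λ K g → ∑ (subsets n) λ T → ε (genus κ (step s k t) K T) g) g)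
      where i = genusStep κ s k t

  -- The four terms follow the order of `subsets`, `outside` before `inside`. At a concrete matching
  -- and genus the shifts compute, and this becomes the linear recursion used below.
  #genus-suc : ∀ n g → #genus κ s (suc n) g ≡
    branch outside outside n g + branch outside inside n g + (branch inside outside n g + branch inside inside n g)
  #genus-suc n g = trans (∑-subsets n _) (cong₂ _+_ (half outside) (half inside))
    where
    half : ∀ k → (∑ (subsets n) λ K → ∑ (subsets (suc n)) λ T → ε (genus κ s (k ∷ K) T) g) ≡
      branch k outside n g + branch k inside n g
    half k = trans (∑-cong (subsets n) λ K → ∑-subsets n (λ T → ε (genus κ s (k ∷ K) T) g))
      (trans (∑-+ (subsets n) _ _) (cong₂ _+_ (branch-∑ k outside n g) (branch-∑ k inside n g)))

genusCount-surfaces : ∀ {n} (surface : Subset n → Subset n → Word) (γ : Subset n → Subset n → ℕ) g →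
  (∀ K T → (HasGenus (surface K T) g → γ K T ≡ g) × (γ K T ≡ g → HasGenus (surface K T) g)) →
  genusCount (map (uncurry surface) (cartesianProduct (subsets n) (subsets n))) g ≡
  (∑ (subsets n) λ K → ∑ (subsets n) λ T → ε (γ K T) g)
genusCount-surfaces {n} surface γ g iff = trans
  (length-filter-map (λ w → hasGenus? w g) (uncurry surface) (cartesianProduct (subsets n) (subsets n)))
  (trans
    (sym (∑-count (λ x → hasGenus? (uncurry surface x) g) (λ x → ε (uncurry γ x) g)
      (λ (K , T) h → ε-≡ (proj₁ (iff K T) h))
      (λ (K , T) ¬h → ε-≢ _ g (¬h ∘ proj₂ (iff K T)))
      (cartesianProduct (subsets n) (subsets n))))
    (∑-cartesianProductWith _,_ (subsets n) (subsets n) (λ x → ε (uncurry γ x) g)))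

genusCount₁₀ : ∀ n g → genusCount (S₁₀ n) g ≡ #genus κ₁₀ 14∣2y∣3z n g
genusCount₁₀ n g = genusCount-surfaces {n} surface₁₀ (genus κ₁₀ 14∣2y∣3z) g λ K T → hasGenus₁₀ K T

genusCount₇ : ∀ n g → genusCount (S₇ n) g ≡ #genus κ₇ 1z∣23∣4y n g
genusCount₇ n g = genusCount-surfaces {n} surface₇ (genus κ₇ 1z∣23∣4y) g λ K T → hasGenus₇ K T

-- Solving the recursion.

-- Row `n` holds the coefficients of the Fibonacci-type polynomial p(n), where p(0) = 2, p(1) = 2 +
-- x and p(n+2) = p(n+1) + x p(n).
L : ℕ → ℕ → ℕ
L n             zero          = 2
L zero          (suc i)       = 0
L (suc zero)    (suc zero)    = 1
L (suc zero)    (suc (suc i)) = 0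
L (suc (suc n)) (suc i)       = L (suc n) (suc i) + L n i

-- The subtraction comes last and is exact: `s+L` shows that a natural number plus the subtrahend
-- gives the minuend.
F : ℕ → ℕ → ℕ
F n zero    = 2
F n (suc j) = 2 ^ (n + suc j) * L n j + 8 ^ suc j * L n (suc j) ∸ 8 ^ j * L n j

module _ (c : ℕ → ℕ → ℕ)
  (c₀₀ : c 0 0 ≡ 4) (c₀ : ∀ i → c 0 (suc i) ≡ 0)
  (c₁₀ : c 1 0 ≡ 8) (c₁₁ : c 1 1 ≡ 8) (c₁ : ∀ i → c 1 (2 + i) ≡ 0)
  (c-zero : ∀ n → c (2 + n) 0 ≡ 2 * c (1 + n) 0)
  (c-suc : ∀ n i → c (2 + n) (suc i) ≡ 2 * c (1 + n) (suc i) + 8 * c n i) where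

  -- The weight `2 ^ (n + suc i)` absorbs the factors 2 and 8 of the recursion and leaves that of
  -- `L`.
  c≡2^*L : ∀ n i → c n i ≡ 2 ^ (n + suc i) * L n i
  c≡2^*L zero          zero          = c₀₀
  c≡2^*L zero          (suc i)       = trans (c₀ i) (sym (ℕ.*-zeroʳ (2 ^ (2 + i))))
  c≡2^*L (suc zero)    zero          = c₁₀
  c≡2^*L (suc zero)    (suc zero)    = c₁₁
  c≡2^*L (suc zero)    (suc (suc i)) = trans (c₁ i) (sym (ℕ.*-zeroʳ (2 ^ (4 + i))))
  c≡2^*L (suc (suc n)) zero          = begin-equality
    c (2 + n) 0                  ≡⟨ c-zero n ⟩
    2 * c (1 + n) 0              ≡⟨ cong (2 *_) (c≡2^*L (suc n) zero) ⟩
    2 * (2 ^ (suc n + 1) * 2)    ≡⟨ ℕ.*-assoc 2 (2 ^ (suc n + 1)) 2 ⟨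
    2 ^ (2 + n + 1) * 2          ∎
  c≡2^*L (suc (suc n)) (suc i) = begin-equality
    c (2 + n) (suc i)
      ≡⟨ c-suc n i ⟩
    2 * c (1 + n) (suc i) + 8 * c n i
      ≡⟨ cong₂ (λ p q → 2 * p + 8 * q) (c≡2^*L (suc n) (suc i)) (c≡2^*L n i) ⟩
    2 * (2 * 2 ^ (n + (2 + i)) * x) + 8 * (2 ^ (n + suc i) * y)
      ≡⟨ cong (λ m → 2 * (2 * 2 ^ m * x) + 8 * (2 ^ (n + suc i) * y)) (ℕ.+-suc n (suc i)) ⟩
    2 * (2 * (2 * 2 ^ (n + suc i)) * x) + 8 * (2 ^ (n + suc i) * y)
      ≡⟨ collect (2 ^ (n + suc i)) x y ⟩
    2 * (2 * (2 * 2 ^ (n + suc i))) * (x + y)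
      ≡⟨ cong (λ m → 2 * (2 * 2 ^ m) * (x + y)) (ℕ.+-suc n (suc i)) ⟨
    2 ^ (2 + n + (2 + i)) * (x + y) ∎
    where
    x = L (suc n) (suc i)
    y = L n i
    collect : ∀ p x y → 2 * (2 * (2 * p) * x) + 8 * (p * y) ≡ 2 * (2 * (2 * p)) * (x + y)
    collect = solve-∀

module _ (s : ℕ → ℕ → ℕ)
  (s-zero : ∀ n → s n 0 ≡ 2) (s₀₁ : s 0 1 ≡ 2) (s₀ : ∀ i → s 0 (2 + i) ≡ 0)
  (s₁₁ : s 1 1 ≡ 14) (s₁ : ∀ i → s 1 (2 + i) ≡ 0)
  (s-suc : ∀ n i → s (2 + n) (suc i) ≡ s (1 + n) (suc i) + 8 * s n i + 2 ^ (suc n + suc i) * L (suc n) i) where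

  -- In generating functions, with c(n) the polynomial of coefficients `2 ^ (n + suc i) * L n i`,
  -- this says s(n) = z c(n) + (1 - z) p(n)(8z). The first part is a particular solution because
  -- c(n+2) = 2 c(n+1) + 8z c(n); p(n)(8z) solves the homogeneous recursion, and the factor 1 - z
  -- fits the initial values.
  s+L : ∀ n j → s n (suc j) + 8 ^ j * L n j ≡ 2 ^ (n + suc j) * L n j + 8 ^ suc j * L n (suc j)
  s+L zero zero = cong (_+ 2) s₀₁
  s+L zero (suc j) = trans
    (cong₂ _+_ (s₀ j) (ℕ.*-zeroʳ (8 ^ suc j)))
    (sym (cong₂ _+_ (ℕ.*-zeroʳ (2 ^ (2 + j))) (ℕ.*-zeroʳ (8 ^ (2 + j)))))
  s+L (suc zero) zero = cong (_+ 2) s₁₁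
  s+L (suc zero) (suc zero) = cong (_+ 8) (s₁ 0)
  s+L (suc zero) (suc (suc j)) = trans
    (cong₂ _+_ (s₁ (suc j)) (ℕ.*-zeroʳ (8 ^ (2 + j))))
    (sym (cong₂ _+_ (ℕ.*-zeroʳ (2 ^ (4 + j))) (ℕ.*-zeroʳ (8 ^ (3 + j)))))
  s+L (suc (suc n)) zero = begin-equality
    s (2 + n) 1 + 2
      ≡⟨ cong (_+ 2) (s-suc n 0) ⟩
    s (1 + n) 1 + 8 * s n 0 + p * 2 + 2
      ≡⟨ cong (λ m → s (1 + n) 1 + 8 * m + p * 2 + 2) (s-zero n) ⟩
    s (1 + n) 1 + 16 + p * 2 + 2
      ≡⟨ shuffle₁ (s (1 + n) 1) p ⟩
    (s (1 + n) 1 + 2) + 16 + p * 2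
      ≡⟨ cong (λ m → m + 16 + p * 2) (s+L (suc n) zero) ⟩
    p * 2 + 8 * x + 16 + p * 2
      ≡⟨ shuffle₂ p x ⟩
    2 * p * 2 + 8 * (x + 2) ∎
    where
    p = 2 ^ (suc n + 1)
    x = L (suc n) 1
    shuffle₁ : ∀ s p → s + 16 + p * 2 + 2 ≡ s + 2 + 16 + p * 2
    shuffle₁ = solve-∀
    shuffle₂ : ∀ p x → p * 2 + 8 * x + 16 + p * 2 ≡ 2 * p * 2 + 8 * (x + 2)
    shuffle₂ = solve-∀
  s+L (suc (suc n)) (suc j) = begin-equality
    s (2 + n) (2 + j) + 8 * q * (x + y)
      ≡⟨ cong (_+ 8 * q * (x + y)) (s-suc n (suc j)) ⟩
    s (1 + n) (2 + j) + 8 * s n (suc j) + p * x + 8 * q * (x + y)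
      ≡⟨ shuffle₁ (s (1 + n) (2 + j)) (s n (suc j)) (p * x) q x y ⟩
    (s (1 + n) (2 + j) + 8 * q * x) + 8 * (s n (suc j) + q * y) + p * x
      ≡⟨ cong₂ (λ l m → l + 8 * m + p * x) (s+L (suc n) (suc j)) (s+L n j) ⟩
    (p * x + 8 * (8 * q) * u) + 8 * (r * y + 8 * q * v) + p * x
      ≡⟨ cong (λ m → (m * x + 8 * (8 * q) * u) + 8 * (r * y + 8 * q * v) + m * x) p≡4r ⟩
    (4 * r * x + 8 * (8 * q) * u) + 8 * (r * y + 8 * q * v) + 4 * r * x
      ≡⟨ shuffle₂ q r x y u v ⟩
    2 * (4 * r) * (x + y) + 8 * (8 * q) * (u + v)
      ≡⟨ cong (λ m → 2 * m * (x + y) + 8 * (8 * q) * (u + v)) p≡4r ⟨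
    2 * p * (x + y) + 8 * (8 * q) * (u + v) ∎
    where
    p = 2 ^ (suc n + (2 + j))
    q = 8 ^ j
    r = 2 ^ (n + suc j)
    x = L (suc n) (suc j)
    y = L n j
    u = L (suc n) (2 + j)
    v = L n (suc j)
    p≡4r : p ≡ 4 * r
    p≡4r = trans (cong (λ m → 2 * 2 ^ m) (ℕ.+-suc n (suc j))) (sym (ℕ.*-assoc 2 2 r))
    shuffle₁ : ∀ s t p q x y → s + 8 * t + p + 8 * q * (x + y) ≡ (s + 8 * q * x) + 8 * (t + q * y) + p
    shuffle₁ = solve-∀
    shuffle₂ : ∀ q r x y u v → (4 * r * x + 8 * (8 * q) * u) + 8 * (r * y + 8 * q * v) + 4 * r * x ≡
      2 * (4 * r) * (x + y) + 8 * (8 * q) * (u + v)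
    shuffle₂ = solve-∀

  s≡F : ∀ n g → s n g ≡ F n g
  s≡F n zero    = s-zero n
  s≡F n (suc j) = trans (sym (ℕ.m+n∸n≡m (s n (suc j)) (8 ^ j * L n j))) (cong (_∸ 8 ^ j * L n j) (s+L n j))

-- A, B, B′, C, D, E abbreviate 14∣2y∣3z, 1z∣2y∣34, 12∣3z∣4y, 14∣23∣yz, 1z∣23∣4y, 12∣34∣yz.
module Distribution₇ where

  private
    N : Matching → ℕ → ℕ → ℕ
    N = #genus κ₇

  -- Under `κ₇` both matchings lead to B, B′ and C with equal genus increments, and each leads to
  -- itself with increment 0. This reduces B and B′ to multiples of D.
  A≡D : ∀ n g → N 14∣2y∣3z n g ≡ N 1z∣23∣4y n g
  A≡D zero    g       = refl
  A≡D (suc n) zero    = begin-equality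
    N 14∣2y∣3z (suc n) 0
      ≡⟨ #genus-suc κ₇ 14∣2y∣3z n 0 ⟩
    N 14∣2y∣3z n 0 + N 1z∣2y∣34 n 0
      ≡⟨ cong (_+ N 1z∣2y∣34 n 0) (A≡D n 0) ⟩
    N 1z∣23∣4y n 0 + N 1z∣2y∣34 n 0
      ≡⟨ shuffle (N 1z∣23∣4y n 0) (N 1z∣2y∣34 n 0) ⟩
    N 1z∣2y∣34 n 0 + N 1z∣23∣4y n 0 + 0
      ≡⟨ #genus-suc κ₇ 1z∣23∣4y n 0 ⟨
    N 1z∣23∣4y (suc n) 0 ∎
    where
    shuffle : ∀ d b → d + b ≡ b + d + 0
    shuffle = solve-∀
  A≡D (suc n) (suc g) = begin-equality
    N 14∣2y∣3z (suc n) (suc g)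
      ≡⟨ #genus-suc κ₇ 14∣2y∣3z n (suc g) ⟩
    N 12∣3z∣4y n g + N 14∣23∣yz n g + (N 14∣2y∣3z n (suc g) + N 1z∣2y∣34 n (suc g))
      ≡⟨ cong (λ m → N 12∣3z∣4y n g + N 14∣23∣yz n g + (m + N 1z∣2y∣34 n (suc g))) (A≡D n (suc g)) ⟩
    N 12∣3z∣4y n g + N 14∣23∣yz n g + (N 1z∣23∣4y n (suc g) + N 1z∣2y∣34 n (suc g))
      ≡⟨ shuffle (N 12∣3z∣4y n g) (N 14∣23∣yz n g) (N 1z∣23∣4y n (suc g)) (N 1z∣2y∣34 n (suc g)) ⟩
    N 1z∣2y∣34 n (suc g) + N 1z∣23∣4y n (suc g) + (N 14∣23∣yz n g + N 12∣3z∣4y n g)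
      ≡⟨ #genus-suc κ₇ 1z∣23∣4y n (suc g) ⟨
    N 1z∣23∣4y (suc n) (suc g) ∎
    where
    shuffle : ∀ b c d e → b + c + (d + e) ≡ e + d + (c + b)
    shuffle = solve-∀

  C-suc : ∀ n g → N 14∣23∣yz (suc n) g ≡ 2 * N 12∣34∣yz n g + 2 * N 14∣23∣yz n g
  C-suc n g = trans (#genus-suc κ₇ 14∣23∣yz n g) (shuffle (N 12∣34∣yz n g) (N 14∣23∣yz n g))
    where
    shuffle : ∀ e c → e + c + (c + e) ≡ 2 * e + 2 * c
    shuffle = solve-∀

  E-suc : ∀ n g → N 12∣34∣yz (suc n) (suc g) ≡ 4 * N 14∣23∣yz n g
  E-suc n g = trans (#genus-suc κ₇ 12∣34∣yz n (suc g)) (shuffle (N 14∣23∣yz n g))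
    where
    shuffle : ∀ c → c + c + (c + c) ≡ 4 * c
    shuffle = solve-∀

  -- One rung is needed to reach the initial value 4 of the recursion; this is the origin of the
  -- shift by which `F n` describes `S₇ (suc n)`.
  C≡L : ∀ n i → N 14∣23∣yz (suc n) i ≡ 2 ^ (n + suc i) * L n i
  C≡L = c≡2^*L (λ n → N 14∣23∣yz (suc n)) refl (λ _ → refl) refl refl (λ _ → refl)
    (λ n → C-zero (suc n)) (λ n i → trans (C-suc (2 + n) (suc i))
      (trans (cong (λ m → 2 * m + 2 * N 14∣23∣yz (2 + n) (suc i)) (E-suc (suc n) i))
        (shuffle (N 14∣23∣yz (suc n) i) (N 14∣23∣yz (2 + n) (suc i)))))
    where
    C-zero : ∀ n → N 14∣23∣yz (2 + n) 0 ≡ 2 * N 14∣23∣yz (1 + n) 0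
    C-zero n = trans (C-suc (1 + n) 0) (cong (λ m → 2 * m + 2 * N 14∣23∣yz (suc n) 0) (#genus-suc κ₇ 12∣34∣yz n 0))
    shuffle : ∀ c d → 2 * (4 * c) + 2 * d ≡ 2 * d + 8 * c
    shuffle = solve-∀

  B-suc : ∀ n g → N 1z∣2y∣34 (suc n) (suc g) ≡ 4 * N 1z∣23∣4y n g
  B-suc n g = trans (#genus-suc κ₇ 1z∣2y∣34 n (suc g))
    (trans (cong (λ m → D + D + (m + m)) (A≡D n g)) (shuffle D))
    where
    D = N 1z∣23∣4y n g
    shuffle : ∀ d → d + d + (d + d) ≡ 4 * d
    shuffle = solve-∀

  B′-suc : ∀ n g → N 12∣3z∣4y (suc n) g ≡ 4 * N 1z∣23∣4y n g
  B′-suc n g = trans (#genus-suc κ₇ 12∣3z∣4y n g)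
    (trans (cong (λ m → m + D + (m + D)) (A≡D n g)) (shuffle D))
    where
    D = N 1z∣23∣4y n g
    shuffle : ∀ d → d + d + (d + d) ≡ 4 * d
    shuffle = solve-∀

  D-zero : ∀ n → N 1z∣23∣4y (suc n) 0 ≡ 2
  D-zero zero    = refl
  D-zero (suc n) = begin-equality
    N 1z∣23∣4y (2 + n) 0
      ≡⟨ #genus-suc κ₇ 1z∣23∣4y (suc n) 0 ⟩
    N 1z∣2y∣34 (suc n) 0 + N 1z∣23∣4y (suc n) 0 + 0
      ≡⟨ cong₂ (λ l m → l + m + 0) (#genus-suc κ₇ 1z∣2y∣34 n 0) (D-zero n) ⟩
    2 ∎

  D-suc : ∀ n i → N 1z∣23∣4y (3 + n) (suc i) ≡
    N 1z∣23∣4y (2 + n) (suc i) + 8 * N 1z∣23∣4y (suc n) i + 2 ^ (suc n + suc i) * L (suc n) i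
  D-suc n i = begin-equality
    N 1z∣23∣4y (3 + n) (suc i)
      ≡⟨ #genus-suc κ₇ 1z∣23∣4y (2 + n) (suc i) ⟩
    N 1z∣2y∣34 (2 + n) (suc i) + d + (N 14∣23∣yz (2 + n) i + N 12∣3z∣4y (2 + n) i)
      ≡⟨ cong₂ (λ l m → l + d + (N 14∣23∣yz (2 + n) i + m)) (B-suc (suc n) i) (B′-suc (suc n) i) ⟩
    4 * d′ + d + (N 14∣23∣yz (2 + n) i + 4 * d′)
      ≡⟨ cong (λ m → 4 * d′ + d + (m + 4 * d′)) (C≡L (suc n) i) ⟩
    4 * d′ + d + (c + 4 * d′)
      ≡⟨ shuffle d d′ c ⟩
    d + 8 * d′ + c ∎
    where
    d = N 1z∣23∣4y (2 + n) (suc i)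
    d′ = N 1z∣23∣4y (suc n) i
    c = 2 ^ (suc n + suc i) * L (suc n) i
    shuffle : ∀ d d′ c → 4 * d′ + d + (c + 4 * d′) ≡ d + 8 * d′ + c
    shuffle = solve-∀

  D-equation : ∀ n j → N 1z∣23∣4y (suc n) (suc j) + 8 ^ j * L n j ≡ 2 ^ (n + suc j) * L n j + 8 ^ suc j * L n (suc j)
  D-equation = s+L (λ n → N 1z∣23∣4y (suc n)) D-zero refl (λ _ → refl) refl (λ _ → refl) D-suc

  D≡F : ∀ n g → N 1z∣23∣4y (suc n) g ≡ F n g
  D≡F = s≡F (λ n → N 1z∣23∣4y (suc n)) D-zero refl (λ _ → refl) refl (λ _ → refl) D-suc

module Distribution₁₀ where

  private
    N : Matching → ℕ → ℕ → ℕ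
    N = #genus κ₁₀

  C≡L : ∀ n i → 4 * N 14∣23∣yz n i ≡ 2 ^ (n + suc i) * L n i
  C≡L = c≡2^*L (λ n i → 4 * N 14∣23∣yz n i) refl (λ _ → refl) refl refl (λ _ → refl) C-zero C-suc
    where
    C-zero : ∀ n → 4 * N 14∣23∣yz (2 + n) 0 ≡ 2 * (4 * N 14∣23∣yz (1 + n) 0)
    C-zero n = trans (cong (4 *_) (#genus-suc κ₁₀ 14∣23∣yz (1 + n) 0)) (shuffle (N 14∣23∣yz (1 + n) 0))
      where
      shuffle : ∀ c → 4 * (c + (c + 0)) ≡ 2 * (4 * c)
      shuffle = solve-∀
    C-suc : ∀ n i → 4 * N 14∣23∣yz (2 + n) (suc i) ≡ 2 * (4 * N 14∣23∣yz (1 + n) (suc i)) + 8 * (4 * N 14∣23∣yz n i)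
    C-suc n i = trans (cong (4 *_) (#genus-suc κ₁₀ 14∣23∣yz (1 + n) (suc i)))
      (trans (cong (λ m → 4 * (m + c + (c + m))) (#genus-suc κ₁₀ 12∣34∣yz n i)) (shuffle c (N 14∣23∣yz n i)))
      where
      c = N 14∣23∣yz (1 + n) (suc i)
      shuffle : ∀ c d → 4 * (d + d + (d + d) + c + (c + (d + d + (d + d)))) ≡ 2 * (4 * c) + 8 * (4 * d)
      shuffle = solve-∀

  A-zero : ∀ n → N 14∣2y∣3z n 0 ≡ 1
  A-zero zero    = refl
  A-zero (suc n) = trans (#genus-suc κ₁₀ 14∣2y∣3z n 0) (trans (ℕ.+-identityʳ _) (A-zero n))

  private
    A-suc : ∀ n g → N 14∣2y∣3z (suc n) (suc g) ≡
      N 12∣3z∣4y n g + N 14∣23∣yz n g + (N 14∣2y∣3z n (suc g) + N 1z∣2y∣34 n g)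
    A-suc n g = #genus-suc κ₁₀ 14∣2y∣3z n (suc g)
    D-suc : ∀ n g → N 1z∣23∣4y (suc n) g ≡
      N 1z∣2y∣34 n g + N 1z∣23∣4y n g + (N 14∣23∣yz n g + N 12∣3z∣4y n g)
    D-suc n g = #genus-suc κ₁₀ 1z∣23∣4y n g

  -- The term ε 0 g is the genus 1 coefficient of A - z D = 1 - z.
  A≡D : ∀ n g → N 14∣2y∣3z n (suc g) + ε 0 g ≡ N 1z∣23∣4y n g
  A≡D zero    g = sym (trans (ℕ.+-identityʳ _) (ℕ.+-identityʳ (ε 0 g)))
  A≡D (suc n) g = begin-equality
    N 14∣2y∣3z (suc n) (suc g) + ε 0 g
      ≡⟨ cong (_+ ε 0 g) (A-suc n g) ⟩
    N 12∣3z∣4y n g + N 14∣23∣yz n g + (N 14∣2y∣3z n (suc g) + N 1z∣2y∣34 n g) + ε 0 g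
      ≡⟨ shuffle (N 12∣3z∣4y n g) (N 14∣23∣yz n g) (N 14∣2y∣3z n (suc g)) (N 1z∣2y∣34 n g) (ε 0 g) ⟩
    N 1z∣2y∣34 n g + (N 14∣2y∣3z n (suc g) + ε 0 g) + (N 14∣23∣yz n g + N 12∣3z∣4y n g)
      ≡⟨ cong (λ m → N 1z∣2y∣34 n g + m + (N 14∣23∣yz n g + N 12∣3z∣4y n g)) (A≡D n g) ⟩
    N 1z∣2y∣34 n g + N 1z∣23∣4y n g + (N 14∣23∣yz n g + N 12∣3z∣4y n g)
      ≡⟨ D-suc n g ⟨
    N 1z∣23∣4y (suc n) g ∎
    where
    shuffle : ∀ b′ c a b e → b′ + c + (a + b) + e ≡ b + (a + e) + (c + b′)
    shuffle = solve-∀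

  private
    -- The combination 2 A + 2 z D, to which both B and B′ reduce after one rung. By `A≡D` it equals
    -- 4 A - 2 + 2 z, which explains the exceptions at genus 0 and 1.
    s : ℕ → ℕ → ℕ
    s n zero    = 2 * N 14∣2y∣3z n 0
    s n (suc g) = 2 * N 14∣2y∣3z n (suc g) + 2 * N 1z∣23∣4y n g

    B-suc : ∀ n g → N 1z∣2y∣34 (suc n) g ≡ s n g
    B-suc n zero    = trans (#genus-suc κ₁₀ 1z∣2y∣34 n 0) (shuffle (N 14∣2y∣3z n 0))
      where
      shuffle : ∀ a → a + a ≡ 2 * a
      shuffle = solve-∀
    B-suc n (suc g) = trans (#genus-suc κ₁₀ 1z∣2y∣34 n (suc g)) (shuffle (N 14∣2y∣3z n (suc g)) (N 1z∣23∣4y n g))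
      where
      shuffle : ∀ a d → d + d + (a + a) ≡ 2 * a + 2 * d
      shuffle = solve-∀

    B′-suc : ∀ n g → N 12∣3z∣4y (suc n) g ≡ s n g
    B′-suc n zero    = trans (#genus-suc κ₁₀ 12∣3z∣4y n 0) (shuffle (N 14∣2y∣3z n 0))
      where
      shuffle : ∀ a → a + 0 + (a + 0) ≡ 2 * a
      shuffle = solve-∀
    B′-suc n (suc g) = trans (#genus-suc κ₁₀ 12∣3z∣4y n (suc g)) (shuffle (N 14∣2y∣3z n (suc g)) (N 1z∣23∣4y n g))
      where
      shuffle : ∀ a d → a + d + (a + d) ≡ 2 * a + 2 * d
      shuffle = solve-∀

    s-suc : ∀ n i → s (2 + n) (suc i) ≡ s (1 + n) (suc i) + 8 * s n i + 2 ^ (suc n + suc i) * L (suc n) i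
    s-suc n i = begin-equality
      2 * N 14∣2y∣3z (2 + n) (suc i) + 2 * N 1z∣23∣4y (2 + n) i
        ≡⟨ cong₂ (λ l m → 2 * l + 2 * m) (A-suc (suc n) i) (D-suc (suc n) i) ⟩
      2 * (b′ + c + (α + β)) + 2 * (β + d + (c + b′))
        ≡⟨ cong₂ (λ l m → 2 * (l + c + (α + m)) + 2 * (m + d + (c + l))) (B′-suc n i) (B-suc n i) ⟩
      2 * (s n i + c + (α + s n i)) + 2 * (s n i + d + (c + s n i))
        ≡⟨ shuffle (s n i) α c d ⟩
      2 * α + 2 * d + 8 * s n i + 4 * c
        ≡⟨ cong (2 * α + 2 * d + 8 * s n i +_) (C≡L (suc n) i) ⟩
      2 * α + 2 * d + 8 * s n i + 2 ^ (suc n + suc i) * L (suc n) i ∎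
      where
      b′ = N 12∣3z∣4y (suc n) i
      c  = N 14∣23∣yz (suc n) i
      α  = N 14∣2y∣3z (suc n) (suc i)
      β  = N 1z∣2y∣34 (suc n) i
      d  = N 1z∣23∣4y (suc n) i
      shuffle : ∀ s a c d → 2 * (s + c + (a + s)) + 2 * (s + d + (c + s)) ≡ 2 * a + 2 * d + 8 * s + 4 * c
      shuffle = solve-∀

    s≡ : ∀ n g → s n g ≡ F n g
    s≡ = s≡F s (λ n → cong (2 *_) (A-zero n)) refl (λ _ → refl) refl (λ _ → refl) s-suc

  A₁-F : ∀ n → 4 * N 14∣2y∣3z n 1 + 2 ≡ F n 1
  A₁-F n = trans (shuffle (N 14∣2y∣3z n 1))
    (trans (cong (λ m → 2 * N 14∣2y∣3z n 1 + 2 * m) (A≡D n 0)) (s≡ n 1))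
    where
    shuffle : ∀ a → 4 * a + 2 ≡ 2 * a + 2 * (a + 1)
    shuffle = solve-∀

  A-F : ∀ n g → 4 * N 14∣2y∣3z n (2 + g) ≡ F n (2 + g)
  A-F n g = trans (shuffle (N 14∣2y∣3z n (2 + g)))
    (trans (cong (λ m → 2 * N 14∣2y∣3z n (2 + g) + 2 * m) (A≡D n (suc g))) (s≡ n (2 + g)))
    where
    shuffle : ∀ a → 4 * a ≡ 2 * a + 2 * (a + 0)
    shuffle = solve-∀

-- Binomial form of `L` and the ratio of neighbouring entries.

-- The binomial coefficient C(e + j, j), indexed by the complement `e` so that no index contains a
-- subtraction.
binom : ℕ → ℕ → ℕ
binom e       zero    = 1
binom zero    (suc j) = 1
binom (suc e) (suc j) = binom e (suc j) + binom (suc e) j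

binom-zero : ∀ j → binom 0 j ≡ 1
binom-zero zero    = refl
binom-zero (suc j) = refl

absorb : ∀ e j → suc e * binom (suc e) j ≡ suc (e + j) * binom e j
exchange : ∀ e j → suc j * binom e (suc j) ≡ suc e * binom (suc e) j

absorb e zero    = cong (λ m → suc m * 1) (sym (ℕ.+-identityʳ e))
absorb e (suc j) = begin-equality
  suc e * (binom e (suc j) + binom (suc e) j)
    ≡⟨ ℕ.*-distribˡ-+ (suc e) (binom e (suc j)) _ ⟩
  suc e * binom e (suc j) + suc e * binom (suc e) j
    ≡⟨ cong (suc e * binom e (suc j) +_) (exchange e j) ⟨
  suc e * binom e (suc j) + suc j * binom e (suc j)
    ≡⟨ ℕ.*-distribʳ-+ (binom e (suc j)) (suc e) (suc j) ⟨
  suc (e + suc j) * binom e (suc j) ∎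

exchange zero    j = trans (ℕ.*-identityʳ (suc j)) (sym (begin-equality
  1 * binom 1 j     ≡⟨ absorb 0 j ⟩
  suc j * binom 0 j ≡⟨ cong (suc j *_) (binom-zero j) ⟩
  suc j * 1         ≡⟨ ℕ.*-identityʳ (suc j) ⟩
  suc j             ∎))
exchange (suc e) j = begin-equality
  suc j * (binom e (suc j) + binom (suc e) j)
    ≡⟨ ℕ.*-distribˡ-+ (suc j) (binom e (suc j)) _ ⟩
  suc j * binom e (suc j) + suc j * binom (suc e) j
    ≡⟨ cong (_+ suc j * binom (suc e) j) (exchange e j) ⟩
  suc e * binom (suc e) j + suc j * binom (suc e) j
    ≡⟨ ℕ.*-distribʳ-+ (binom (suc e) j) (suc e) (suc j) ⟨
  (suc e + suc j) * binom (suc e) j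
    ≡⟨ cong (λ m → suc m * binom (suc e) j) (ℕ.+-suc e j) ⟩
  suc (suc e + j) * binom (suc e) j
    ≡⟨ absorb (suc e) j ⟨
  (2 + e) * binom (2 + e) j ∎

-- C(e + j - 1, j) + C(e + j, j), which is `L n j` for `suc n = e + 2 * j`. For `e = 0` the first
-- term vanishes, as `j` is then positive.
ℓ : ℕ → ℕ → ℕ
ℓ zero    j = binom 0 j
ℓ (suc e) j = binom e j + binom (suc e) j

suc-index : ∀ {n} e j → 3 + n ≡ e + 2 * suc j → suc n ≡ e + 2 * j
suc-index e j eq = ℕ.suc-injective (ℕ.suc-injective (trans eq (shuffle e j)))
  where
  shuffle : ∀ e j → e + 2 * suc j ≡ 2 + (e + 2 * j)
  shuffle = solve-∀

double-suc : ∀ i → 2 * suc i ≡ 2 + 2 * i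
double-suc i = ℕ.*-suc 2 i

L-zero : ∀ n i → suc n < 2 * i → L n i ≡ 0
L-zero zero          (suc i)       lt = refl
L-zero (suc zero)    (suc zero)    (s≤s (s≤s ()))
L-zero (suc zero)    (suc (suc i)) lt = refl
L-zero (suc (suc n)) (suc i)       lt = cong₂ _+_ (L-zero (suc n) (suc i) (ℕ.<-trans (ℕ.n<1+n _) lt))
  (L-zero n i (ℕ.≤-pred (ℕ.≤-pred (subst (4 + n ≤_) (double-suc i) lt))))

L-positive : ∀ n i → 2 * i ≤ suc n → 0 < L n i
L-positive n             zero          le = s≤s z≤n
L-positive zero          (suc i)       le = contradiction (subst (_≤ 1) (double-suc i) le) λ { (s≤s ()) }
L-positive (suc zero)    (suc zero)    le = s≤s z≤n
L-positive (suc zero)    (suc (suc i)) le = contradiction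
  (subst (_≤ 2) (trans (double-suc (suc i)) (cong (2 +_) (double-suc i))) le) λ { (s≤s (s≤s ())) }
L-positive (suc (suc n)) (suc i)       le = ℕ.≤-trans
  (L-positive n i (ℕ.≤-pred (ℕ.≤-pred (subst (_≤ 3 + n) (double-suc i) le)))) (ℕ.m≤n+m _ _)

L≡ℓ : ∀ n e j → suc n ≡ e + 2 * j → L n j ≡ ℓ e j
L≡ℓ n             (suc e)       zero          eq = refl
L≡ℓ zero          e             (suc j)       eq = contradiction (trans eq (shuffle e j)) λ ()
  where
  shuffle : ∀ e j → e + 2 * suc j ≡ 2 + (e + 2 * j)
  shuffle = solve-∀
L≡ℓ (suc zero)    zero          (suc zero)    eq = refl
L≡ℓ (suc zero)    e             (suc (suc j)) eq = contradiction (trans eq (shuffle e j)) λ ()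
  where
  shuffle : ∀ e j → e + 2 * suc (suc j) ≡ 3 + (1 + e + 2 * j)
  shuffle = solve-∀
L≡ℓ (suc zero)    (suc e)       (suc zero)    eq = contradiction (trans eq (shuffle e)) λ ()
  where
  shuffle : ∀ e → suc e + 2 ≡ 3 + e
  shuffle = solve-∀
L≡ℓ (suc (suc n)) zero          (suc j)       eq = cong₂ _+_
  (L-zero (suc n) (suc j) (ℕ.≤-reflexive eq))
  (trans (L≡ℓ n 0 j (suc-index 0 j eq)) (binom-zero j))
L≡ℓ (suc (suc n)) (suc zero)    (suc j)       eq = trans
  (cong₂ _+_ (L≡ℓ (suc n) 0 (suc j) (ℕ.suc-injective eq)) (L≡ℓ n 1 j (suc-index 1 j eq)))
  (cong (λ m → 1 + (m + binom 1 j)) (binom-zero j))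
L≡ℓ (suc (suc n)) (suc (suc e)) (suc j)       eq = trans
  (cong₂ _+_ (L≡ℓ (suc n) (suc e) (suc j) (ℕ.suc-injective eq)) (L≡ℓ n (2 + e) j (suc-index (2 + e) j eq)))
  (shuffle (binom e (suc j)) (binom (suc e) (suc j)) (binom (suc e) j) (binom (2 + e) j))
  where
  shuffle : ∀ p q r s → p + q + (r + s) ≡ p + r + (q + s)
  shuffle = solve-∀

-- C(e + j - 1, j) is the fraction e / (e + j) of C(e + j, j), so the two terms merge into one
-- binomial coefficient.
ℓ-binom : ∀ e j → (e + j) * ℓ e j ≡ (2 * e + j) * binom e j
ℓ-binom zero    j = refl
ℓ-binom (suc e) j = begin-equality
  suc (e + j) * (binom e j + binom (suc e) j)
    ≡⟨ ℕ.*-distribˡ-+ (suc (e + j)) (binom e j) _ ⟩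
  suc (e + j) * binom e j + suc (e + j) * binom (suc e) j
    ≡⟨ cong (_+ suc (e + j) * binom (suc e) j) (absorb e j) ⟨
  suc e * binom (suc e) j + suc (e + j) * binom (suc e) j
    ≡⟨ shuffle e j (binom (suc e) j) ⟩
  (2 * suc e + j) * binom (suc e) j ∎
  where
  shuffle : ∀ e j c → (1 + e) * c + (1 + (e + j)) * c ≡ (2 * (1 + e) + j) * c
  shuffle = solve-∀

-- ℓ (2 + e) j and ℓ e (suc j) are consecutive entries of a row of L, with quotient β e j / α e j.
α β : ℕ → ℕ → ℕ
α e j = suc e * (2 + e) * (2 * e + suc j)
β e j = suc j * suc (2 * e + (3 + j)) * suc (e + j)

ℓ-ratio : ∀ e j → α e j * ℓ (2 + e) j ≡ β e j * ℓ e (suc j)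
ℓ-ratio e j = ℕ.*-cancelˡ-≡ _ _ (2 + e + j) (begin-equality
  (2 + e + j) * (α e j * ℓ (2 + e) j)
    ≡⟨ swap-out (2 + e + j) (α e j) (ℓ (2 + e) j) ⟩
  α e j * ((2 + e + j) * ℓ (2 + e) j)
    ≡⟨ cong (α e j *_) (ℓ-binom (2 + e) j) ⟩
  α e j * ((2 * (2 + e) + j) * binom (2 + e) j)
    ≡⟨ shuffle₁ e j (binom (2 + e) j) ⟩
  (suc e * ((2 + e) * binom (2 + e) j)) * ((2 * e + suc j) * suc (2 * e + (3 + j)))
    ≡⟨ cong (λ m → suc e * m * ((2 * e + suc j) * suc (2 * e + (3 + j)))) (absorb (suc e) j) ⟩
  (suc e * ((2 + e + j) * binom (suc e) j)) * ((2 * e + suc j) * suc (2 * e + (3 + j)))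
    ≡⟨ shuffle₂ e j (binom (suc e) j) ⟩
  ((2 + e + j) * (suc e * binom (suc e) j)) * ((2 * e + suc j) * suc (2 * e + (3 + j)))
    ≡⟨ cong (λ m → (2 + e + j) * m * ((2 * e + suc j) * suc (2 * e + (3 + j)))) (exchange e j) ⟨
  ((2 + e + j) * (suc j * binom e (suc j))) * ((2 * e + suc j) * suc (2 * e + (3 + j)))
    ≡⟨ shuffle₃ e j (binom e (suc j)) ⟩
  (2 + e + j) * (suc j * suc (2 * e + (3 + j)) * ((2 * e + suc j) * binom e (suc j)))
    ≡⟨ cong (λ m → (2 + e + j) * (suc j * suc (2 * e + (3 + j)) * m)) (ℓ-binom e (suc j)) ⟨
  (2 + e + j) * (suc j * suc (2 * e + (3 + j)) * ((e + suc j) * ℓ e (suc j)))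
    ≡⟨ cong ((2 + e + j) *_) (shuffle₄ e j (ℓ e (suc j))) ⟩
  (2 + e + j) * (β e j * ℓ e (suc j)) ∎)
  where
  swap-out : ∀ x y z → x * (y * z) ≡ y * (x * z)
  swap-out = solve-∀
  shuffle₁ : ∀ e j c → (1 + e) * (2 + e) * (2 * e + (1 + j)) * ((2 * (2 + e) + j) * c) ≡
    ((1 + e) * ((2 + e) * c)) * ((2 * e + (1 + j)) * (1 + (2 * e + (3 + j))))
  shuffle₁ = solve-∀
  shuffle₂ : ∀ e j c → ((1 + e) * ((2 + e + j) * c)) * ((2 * e + (1 + j)) * (1 + (2 * e + (3 + j)))) ≡
    ((2 + e + j) * ((1 + e) * c)) * ((2 * e + (1 + j)) * (1 + (2 * e + (3 + j))))
  shuffle₂ = solve-∀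
  shuffle₃ : ∀ e j c → ((2 + e + j) * ((1 + j) * c)) * ((2 * e + (1 + j)) * (1 + (2 * e + (3 + j)))) ≡
    (2 + e + j) * ((1 + j) * (1 + (2 * e + (3 + j))) * ((2 * e + (1 + j)) * c))
  shuffle₃ = solve-∀
  shuffle₄ : ∀ e j c → (1 + j) * (1 + (2 * e + (3 + j))) * ((e + (1 + j)) * c) ≡
    (1 + j) * (1 + (2 * e + (3 + j))) * (1 + (e + j)) * c
  shuffle₄ = solve-∀

module _ {n e j : ℕ} (eq : suc n ≡ 2 + e + 2 * j) where

  L-ratio : α e j * L n j ≡ β e j * L n (suc j)
  L-ratio = begin-equality
    α e j * L n j          ≡⟨ cong (α e j *_) (L≡ℓ n (2 + e) j eq) ⟩
    α e j * ℓ (2 + e) j    ≡⟨ ℓ-ratio e j ⟩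
    β e j * ℓ e (suc j)    ≡⟨ cong (β e j *_) (L≡ℓ n e (suc j) (trans eq (shuffle e j))) ⟨
    β e j * L n (suc j)    ∎
    where
    shuffle : ∀ e j → 2 + e + 2 * j ≡ e + 2 * suc j
    shuffle = solve-∀

  private
    instance
      β≢0 : NonZero (β e j)
      β≢0 = ℕ.m*n≢0 (suc j * suc (2 * e + (3 + j))) (suc (e + j))

    β-cL : ∀ c → β e j * (c * L n (suc j)) ≡ c * α e j * L n j
    β-cL c = begin-equality
      β e j * (c * L n (suc j)) ≡⟨ swap-out (β e j) c _ ⟩
      c * (β e j * L n (suc j)) ≡⟨ cong (c *_) L-ratio ⟨
      c * (α e j * L n j)       ≡⟨ ℕ.*-assoc c (α e j) _ ⟨
      c * α e j * L n j         ∎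
      where
      swap-out : ∀ x y z → x * (y * z) ≡ y * (x * z)
      swap-out = solve-∀

    β-dL : ∀ d → β e j * (d * L n j) ≡ d * β e j * L n j
    β-dL d = shuffle (β e j) d (L n j)
      where
      shuffle : ∀ x y z → x * (y * z) ≡ y * x * z
      shuffle = solve-∀

  -- By `L-ratio`, comparing neighbours of a row becomes a polynomial inequality between `α` and
  -- `β`; `L≤suc` is the converse comparison.
  L-suc≤ : ∀ c d → c * α e j ≤ d * β e j → c * L n (suc j) ≤ d * L n j
  L-suc≤ c d le = ℕ.*-cancelˡ-≤ (β e j) (ℕ.≤-trans (ℕ.≤-reflexive (β-cL c))
    (ℕ.≤-trans (ℕ.*-monoˡ-≤ (L n j) le) (ℕ.≤-reflexive (sym (β-dL d)))))

  L≤suc : ∀ c d → d * β e j ≤ c * α e j → d * L n j ≤ c * L n (suc j)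
  L≤suc c d le = ℕ.*-cancelˡ-≤ (β e j) (ℕ.≤-trans (ℕ.≤-reflexive (β-dL d))
    (ℕ.≤-trans (ℕ.*-monoˡ-≤ (L n j) le) (ℕ.≤-reflexive (sym (β-cL c)))))

L-suc-zero : ∀ {n} E j → suc n ≡ E + 2 * j → E < 2 → L n (suc j) ≡ 0
L-suc-zero {n} E j eq lt = L-zero n (suc j)
  (subst (_< 2 * suc j) (sym eq) (subst (E + 2 * j <_) (sym (double-suc j)) (ℕ.+-monoˡ-< (2 * j) lt)))

2*e≤ : ∀ {e j} → 2 + e ≤ suc j → 2 * suc e ≤ suc (e + j)
2*e≤ {e} {j} le = ℕ.≤-trans (ℕ.≤-reflexive (cong (suc e +_) (ℕ.+-identityʳ (suc e))))
  (s≤s (ℕ.+-monoʳ-≤ e (ℕ.≤-pred le)))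

L-quarter : ∀ {n} E j → suc n ≡ E + 2 * j → 2 * E ≤ suc j → 4 * L n (suc j) ≤ L n j
L-quarter zero          j eq le rewrite L-suc-zero 0 j eq (s≤s z≤n) = z≤n
L-quarter (suc zero)    j eq le rewrite L-suc-zero 1 j eq (s≤s (s≤s z≤n)) = z≤n
L-quarter {n} (suc (suc e)) j eq le = subst (4 * L n (suc j) ≤_) (ℕ.*-identityˡ _)
  (L-suc≤ {n} {e} {j} eq 4 1 (ℕ.≤-trans (ℕ.≤-reflexive (shuffle₁ e j))
    (ℕ.≤-trans (ℕ.*-mono-≤ (ℕ.*-mono-≤ le′ S≤) e≤) (ℕ.≤-reflexive (sym (ℕ.*-identityˡ (β e j)))))))
  where
  le′ : 2 * (2 + e) ≤ suc j
  le′ = le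
  S≤ : 2 * e + suc j ≤ suc (2 * e + (3 + j))
  S≤ = ℕ.≤-trans (ℕ.+-monoʳ-≤ (2 * e) (ℕ.m≤n+m (suc j) 2)) (ℕ.n≤1+n _)
  e≤ : 2 * suc e ≤ suc (e + j)
  e≤ = 2*e≤ (ℕ.≤-trans (ℕ.m≤m+n (2 + e) _) le′)
  shuffle₁ : ∀ e j → 4 * ((1 + e) * (2 + e) * (2 * e + (1 + j))) ≡ 2 * (2 + e) * (2 * e + (1 + j)) * (2 * (1 + e))
  shuffle₁ = solve-∀

L-half : ∀ {n} E j → suc n ≡ E + 2 * j → E ≤ suc j → 2 * L n (suc j) ≤ L n j
L-half zero          j eq le rewrite L-suc-zero 0 j eq (s≤s z≤n) = z≤n
L-half (suc zero)    j eq le rewrite L-suc-zero 1 j eq (s≤s (s≤s z≤n)) = z≤n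
L-half {n} (suc (suc e)) j eq le = subst (2 * L n (suc j) ≤_) (ℕ.*-identityˡ _)
  (L-suc≤ {n} {e} {j} eq 2 1 (ℕ.≤-trans (ℕ.≤-reflexive (shuffle e j))
    (ℕ.≤-trans (ℕ.*-mono-≤ (ℕ.*-mono-≤ le S≤) (2*e≤ le)) (ℕ.≤-reflexive (sym (ℕ.*-identityˡ (β e j)))))))
  where
  S≤ : 2 * e + suc j ≤ suc (2 * e + (3 + j))
  S≤ = ℕ.≤-trans (ℕ.+-monoʳ-≤ (2 * e) (ℕ.m≤n+m (suc j) 2)) (ℕ.n≤1+n _)
  shuffle : ∀ e j → 2 * ((1 + e) * (2 + e) * (2 * e + (1 + j))) ≡ (2 + e) * (2 * e + (1 + j)) * (2 * (1 + e))
  shuffle = solve-∀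

-- A sharper `L-half`: with S = 2 E + j and E = 2 + e, twice the ratio is at most 1 - 3 / S. The
-- factors S of `β` and S - 3 of `α` produce this gap, which has to pay for the lower-order terms in
-- `drop-slope`.
L-slope : ∀ {n} e j → suc n ≡ 2 + e + 2 * j → 2 + e ≤ suc j →
  2 * (2 * (2 + e) + j) * L n (suc j) + 3 * L n j ≤ (2 * (2 + e) + j) * L n j
L-slope {n} e j eq le = ℕ.≤-trans
  (ℕ.+-monoˡ-≤ (3 * L n j) (L-suc≤ {n} {e} {j} eq (2 * (2 * (2 + e) + j)) (2 * e + suc j)
    (ℕ.≤-trans (ℕ.≤-reflexive (shuffle₁ e j))
      (ℕ.*-monoʳ-≤ (2 * e + suc j) (ℕ.*-mono-≤ (ℕ.*-monoˡ-≤ (suc (2 * e + (3 + j))) le) (2*e≤ le))))))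
  (ℕ.≤-reflexive (shuffle₂ e j (L n j)))
  where
  shuffle₁ : ∀ e j → 2 * (2 * (2 + e) + j) * ((1 + e) * (2 + e) * (2 * e + (1 + j))) ≡
    (2 * e + (1 + j)) * ((2 + e) * (1 + (2 * e + (3 + j))) * (2 * (1 + e)))
  shuffle₁ = solve-∀
  shuffle₂ : ∀ e j l → (2 * e + (1 + j)) * l + 3 * l ≡ (2 * (2 + e) + j) * l
  shuffle₂ = solve-∀

-- With `E = 2 + j + u` the required difference is the polynomial added in `shuffle₂`, whose
-- coefficients are all positive. `L≤4L` works in the same way with `E = 9 + v`.
L≤2L : ∀ {n} E j → suc n ≡ E + 2 * j → 2 + j ≤ E → L n j ≤ 2 * L n (suc j)
L≤2L {n} E j eq le with ℕ.m≤n⇒∃[o]m+o≡n le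
... | u , refl = subst (_≤ 2 * L n (suc j)) (ℕ.*-identityˡ _) (L≤suc {n} {j + u} {j} eq 2 1
  (ℕ.≤-trans (ℕ.≤-reflexive (shuffle₁ j u)) (ℕ.≤-trans
    (ℕ.*-mono-≤ (s≤s (ℕ.m≤m+n j u)) (ℕ.≤-trans (ℕ.m≤m+n ((3 * j + 2 * u + 4) * (2 * j + u + 1)) (3 * j + 3 * j * u + 4 * u + 2 * u * u)) (ℕ.≤-reflexive (shuffle₂ j u))))
    (ℕ.≤-reflexive (shuffle₃ j u)))))
  where
  shuffle₁ : ∀ j u → 1 * ((1 + j) * (1 + (2 * (j + u) + (3 + j))) * (1 + (j + u + j))) ≡
    (1 + j) * ((3 * j + 2 * u + 4) * (2 * j + u + 1))
  shuffle₁ = solve-∀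
  shuffle₂ : ∀ j u → (3 * j + 2 * u + 4) * (2 * j + u + 1) + (3 * j + 3 * j * u + 4 * u + 2 * u * u) ≡
    2 * (2 + (j + u)) * (3 * j + 2 * u + 1)
  shuffle₂ = solve-∀
  shuffle₃ : ∀ j u → (1 + (j + u)) * (2 * (2 + (j + u)) * (3 * j + 2 * u + 1)) ≡
    2 * ((1 + (j + u)) * (2 + (j + u)) * (2 * (j + u) + (1 + j)))
  shuffle₃ = solve-∀

L≤4L : ∀ {n} E j → suc n ≡ E + 2 * j → 2 + j ≤ E → 9 ≤ E → L n (suc j) ≤ 4 * L n (2 + j)
L≤4L {n} E j eq le 9≤E with ℕ.m≤n⇒∃[o]m+o≡n 9≤E
... | v , refl = subst (_≤ 4 * L n (2 + j)) (ℕ.*-identityˡ _) (L≤suc {n} {5 + v} {suc j} (trans eq (shuffle₀ v j)) 4 1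
  (ℕ.≤-trans (ℕ.≤-reflexive (shuffle₁ v j)) (ℕ.≤-trans
    (ℕ.*-mono-≤ (ℕ.*-monoˡ-≤ (15 + 2 * v + j) le) (ℕ.+-monoʳ-≤ (5 + v) le))
    (ℕ.≤-trans (ℕ.≤-reflexive (shuffle₂ v j)) (ℕ.≤-trans
      (ℕ.*-monoʳ-≤ (2 * (7 + v)) (ℕ.≤-trans (ℕ.m≤m+n ((9 + v) * (15 + 2 * v + j)) (9 + 15 * v + 3 * j + 2 * v * v + v * j)) (ℕ.≤-reflexive (shuffle₃ v j))))
      (ℕ.≤-reflexive (shuffle₄ v j)))))))
  where
  shuffle₀ : ∀ v j → 9 + v + 2 * j ≡ 2 + (5 + v) + 2 * (1 + j)
  shuffle₀ = solve-∀
  shuffle₁ : ∀ v j → 1 * ((2 + j) * (1 + (2 * (5 + v) + (4 + j))) * (1 + (5 + v + (1 + j)))) ≡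
    (2 + j) * (15 + 2 * v + j) * (5 + v + (2 + j))
  shuffle₁ = solve-∀
  shuffle₂ : ∀ v j → (9 + v) * (15 + 2 * v + j) * (5 + v + (9 + v)) ≡
    2 * (7 + v) * ((9 + v) * (15 + 2 * v + j))
  shuffle₂ = solve-∀
  shuffle₃ : ∀ v j → (9 + v) * (15 + 2 * v + j) + (9 + 15 * v + 3 * j + 2 * v * v + v * j) ≡
    2 * (6 + v) * (12 + 2 * v + j)
  shuffle₃ = solve-∀
  shuffle₄ : ∀ v j → 2 * (7 + v) * (2 * (6 + v) * (12 + 2 * v + j)) ≡
    4 * ((1 + (5 + v)) * (2 + (5 + v)) * (2 * (5 + v) + (2 + j)))
  shuffle₄ = solve-∀

-- When consecutive values of `F` rise or drop.

-- The comparison of `F n (suc j)` with `F n (2 + j)` after adding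
-- `8 ^ j * (L n j + 8 * L n (suc j))` to both sides, which clears the subtractions, and dividing by
-- `8 ^ j`.
Rise Drop : ℕ → ℕ → ℕ → Set
Rise n E j = 2 ^ E * L n j + 16 * L n (suc j) < 2 * (2 ^ E * L n (suc j)) + 64 * L n (2 + j) + L n j
Drop n E j = 2 * (2 ^ E * L n (suc j)) + 64 * L n (2 + j) + L n j < 2 ^ E * L n j + 16 * L n (suc j)

rise? : ∀ n E j → Dec (Rise n E j)
rise? n E j = _ <? _

drop? : ∀ n E j → Dec (Drop n E j)
drop? n E j = _ <? _

rise : ∀ P l₀ l₁ l₂ → 0 < l₀ → l₀ ≤ 2 * l₁ → l₁ ≤ 4 * l₂ →
  P * l₀ + 16 * l₁ < 2 * (P * l₁) + 64 * l₂ + l₀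
rise P l₀ l₁ l₂ pos l₀≤ l₁≤ = begin-strict
  P * l₀ + 16 * l₁                ≤⟨ ℕ.+-mono-≤ (ℕ.*-monoʳ-≤ P l₀≤) (ℕ.*-monoʳ-≤ 16 l₁≤) ⟩
  P * (2 * l₁) + 16 * (4 * l₂)    <⟨ ℕ.m<m+n _ pos ⟩
  P * (2 * l₁) + 16 * (4 * l₂) + l₀ ≡⟨ shuffle P l₀ l₁ l₂ ⟩
  2 * (P * l₁) + 64 * l₂ + l₀ ∎
  where
  shuffle : ∀ P l₀ l₁ l₂ → P * (2 * l₁) + 16 * (4 * l₂) + l₀ ≡ 2 * (P * l₁) + 64 * l₂ + l₀
  shuffle = solve-∀

-- For steep rows: a ratio of at most 1/4 works with `P` as small as 3, so no lower bound on `E` in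
-- terms of `j` is required.
drop-quarter : ∀ P l₀ l₁ l₂ → 0 < l₀ → 2 < P → 4 * l₁ ≤ l₀ → 4 * l₂ ≤ l₁ →
  2 * (P * l₁) + 64 * l₂ + l₀ < P * l₀ + 16 * l₁
drop-quarter P l₀@(suc _) l₁ l₂ pos 2<P l₁≤ l₂≤ = begin-strict
  2 * (P * l₁) + 64 * l₂ + l₀        ≡⟨ shuffle₁ P l₀ l₁ l₂ ⟩
  2 * (P * l₁) + l₀ + 16 * (4 * l₂)  <⟨ ℕ.+-mono-<-≤ (ℕ.*-cancelˡ-< 2 (2 * (P * l₁) + l₀) (P * l₀) doubled) (ℕ.*-monoʳ-≤ 16 l₂≤) ⟩
  P * l₀ + 16 * l₁ ∎
  where
  shuffle₁ : ∀ P l₀ l₁ l₂ → 2 * (P * l₁) + 64 * l₂ + l₀ ≡ 2 * (P * l₁) + l₀ + 16 * (4 * l₂)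
  shuffle₁ = solve-∀
  shuffle₂ : ∀ P l₀ l₁ → 2 * (2 * (P * l₁) + l₀) ≡ P * (4 * l₁) + 2 * l₀
  shuffle₂ = solve-∀
  doubled : 2 * (2 * (P * l₁) + l₀) < 2 * (P * l₀)
  doubled = begin-strict
    2 * (2 * (P * l₁) + l₀)  ≡⟨ shuffle₂ P l₀ l₁ ⟩
    P * (4 * l₁) + 2 * l₀    <⟨ ℕ.+-mono-≤-< (ℕ.*-monoʳ-≤ P l₁≤) (ℕ.*-monoˡ-< l₀ 2<P) ⟩
    P * l₀ + P * l₀          ≡⟨ cong (P * l₀ +_) (ℕ.+-identityʳ (P * l₀)) ⟨
    2 * (P * l₀) ∎

-- The lower-order terms cost at most `9 * l₀`. Multiplied by `S` this is `3 * S * (3 * l₀)`, less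
-- than the gain `P * (3 * l₀)` from the slope.
drop-slope : ∀ P S l₀ l₁ l₂ → 0 < l₀ → 3 * S < P → 2 * S * l₁ + 3 * l₀ ≤ S * l₀ → 2 * l₁ ≤ l₀ → 2 * l₂ ≤ l₁ →
  2 * (P * l₁) + 64 * l₂ + l₀ < P * l₀ + 16 * l₁
drop-slope P S l₀@(suc _) l₁ l₂ pos S<P slope l₁≤ l₂≤ = begin-strict
  2 * (P * l₁) + 64 * l₂ + l₀            ≡⟨ shuffle₁ P l₀ l₁ l₂ ⟩
  2 * (P * l₁) + l₀ + 32 * (2 * l₂)      ≤⟨ ℕ.+-monoʳ-≤ (2 * (P * l₁) + l₀) (ℕ.*-monoʳ-≤ 32 l₂≤) ⟩
  2 * (P * l₁) + l₀ + 32 * l₁            ≡⟨ shuffle₂ P l₀ l₁ ⟩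
  2 * (P * l₁) + l₀ + 8 * (2 * l₁) + 16 * l₁ ≤⟨ ℕ.+-monoˡ-≤ (16 * l₁) (ℕ.+-monoʳ-≤ (2 * (P * l₁) + l₀) (ℕ.*-monoʳ-≤ 8 l₁≤)) ⟩
  2 * (P * l₁) + l₀ + 8 * l₀ + 16 * l₁   <⟨ ℕ.+-monoˡ-< (16 * l₁) (ℕ.*-cancelˡ-< S (2 * (P * l₁) + l₀ + 8 * l₀) (P * l₀) scaled) ⟩
  P * l₀ + 16 * l₁ ∎
  where
  shuffle₁ : ∀ P l₀ l₁ l₂ → 2 * (P * l₁) + 64 * l₂ + l₀ ≡ 2 * (P * l₁) + l₀ + 32 * (2 * l₂)
  shuffle₁ = solve-∀
  shuffle₂ : ∀ P l₀ l₁ → 2 * (P * l₁) + l₀ + 32 * l₁ ≡ 2 * (P * l₁) + l₀ + 8 * (2 * l₁) + 16 * l₁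
  shuffle₂ = solve-∀
  shuffle₃ : ∀ P S l₀ l₁ → S * (2 * (P * l₁) + l₀ + 8 * l₀) ≡ P * (2 * S * l₁) + 3 * S * (3 * l₀)
  shuffle₃ = solve-∀
  shuffle₄ : ∀ P S l₀ → P * (S * l₀) ≡ S * (P * l₀)
  shuffle₄ = solve-∀
  scaled : S * (2 * (P * l₁) + l₀ + 8 * l₀) < S * (P * l₀)
  scaled = begin-strict
    S * (2 * (P * l₁) + l₀ + 8 * l₀)      ≡⟨ shuffle₃ P S l₀ l₁ ⟩
    P * (2 * S * l₁) + 3 * S * (3 * l₀)   <⟨ ℕ.+-monoʳ-< (P * (2 * S * l₁)) (ℕ.*-monoˡ-< (3 * l₀) S<P) ⟩
    P * (2 * S * l₁) + P * (3 * l₀)       ≡⟨ ℕ.*-distribˡ-+ P (2 * S * l₁) (3 * l₀) ⟨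
    P * (2 * S * l₁ + 3 * l₀)             ≤⟨ ℕ.*-monoʳ-≤ P slope ⟩
    P * (S * l₀)                          ≡⟨ shuffle₄ P S l₀ ⟩
    S * (P * l₀) ∎

-- For `j < 2 * E` one has `3 * (2 * E + j) ≤ 12 * E`. The bound fails at exponent 6, where 72 > 64.
12*<2^ : ∀ k → 12 * (7 + k) < 2 ^ (7 + k)
12*<2^ zero    = ℕ.<ᵇ⇒< 84 128 tt
12*<2^ (suc k) = begin-strict
  12 * (8 + k)               ≡⟨ ℕ.*-distribˡ-+ 12 1 (7 + k) ⟩
  12 + 12 * (7 + k)          ≤⟨ ℕ.+-monoˡ-≤ (12 * (7 + k)) (ℕ.m≤m*n 12 (7 + k)) ⟩
  12 * (7 + k) + 12 * (7 + k) <⟨ ℕ.+-mono-< (12*<2^ k) (12*<2^ k) ⟩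
  2 ^ (7 + k) + 2 ^ (7 + k)  ≡⟨ cong (2 ^ (7 + k) +_) (ℕ.+-identityʳ (2 ^ (7 + k))) ⟨
  2 ^ (8 + k) ∎

-- L≤4L needs E ≥ 9 and 3 (2 E + j) < 2 ^ E needs E ≥ 7; this leaves finitely many pairs.
rises-small : ∀ {E} → E < 9 → ∀ {j} → j < 7 → 2 + j ≤ E → 8 ≤ pred (E + 2 * j) → Rise (pred (E + 2 * j)) E j
rises-small = toWitness {a? = ℕ.allUpTo? (λ E → ℕ.allUpTo? (λ j →
  (2 + j ≤? E) →-dec (8 ≤? pred (E + 2 * j)) →-dec rise? (pred (E + 2 * j)) E j) 7) 9} tt

-- `suc j < 2 * E` and `E ≤ 6` leave only `j < 11`.
drops-small : ∀ {E} → E < 7 → ∀ {j} → j < 11 → 3 ≤ E → E ≤ suc j → suc j < 2 * E → 8 ≤ pred (E + 2 * j) → Drop (pred (E + 2 * j)) E j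
drops-small = toWitness {a? = ℕ.allUpTo? (λ E → ℕ.allUpTo? (λ j →
  (3 ≤? E) →-dec (E ≤? suc j) →-dec (suc j <? 2 * E) →-dec (8 ≤? pred (E + 2 * j)) →-dec drop? (pred (E + 2 * j)) E j) 11) 7} tt

rises : ∀ {n} E j → 8 ≤ n → suc n ≡ E + 2 * j → 2 + j ≤ E → Rise n E j
rises {n} E j 8≤n eq le with E <? 9
... | yes E<9 = subst (λ m → Rise m E j) (sym (cong pred eq))
  (rises-small E<9 (ℕ.≤-pred (ℕ.≤-pred (ℕ.≤-<-trans le E<9))) le (subst (8 ≤_) (cong pred eq) 8≤n))
... | no  E≮9 = rise (2 ^ E) (L n j) (L n (suc j)) (L n (2 + j)) (L-positive n j (subst (2 * j ≤_) (sym eq) (ℕ.m≤n+m (2 * j) E)))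
  (L≤2L E j eq le) (L≤4L E j eq le (ℕ.≮⇒≥ E≮9))

-- Three regimes: for `2 * E ≤ suc j` the ratio is at most 1/4; otherwise `j` is bounded by `E`, and
-- either `E < 7` leaves finitely many pairs or `2 ^ E` is large enough for `drop-slope`.
drops : ∀ {n} E j → 8 ≤ n → suc n ≡ E + 2 * j → 3 ≤ E → E ≤ suc j → Drop n E j
drops (suc zero) j _ _ (s≤s ()) _
drops {n} E@(suc (suc e)) j 8≤n eq 3≤E le with 2 * E ≤? suc j
... | yes 2E≤ = drop-quarter (2 ^ E) (L n j) (L n (suc j)) (L n (2 + j)) pos 2<P (L-quarter E j eq 2E≤) (L-quarter e (suc j) eq′ 2e≤)
  where
  pos = L-positive n j (subst (2 * j ≤_) (sym eq) (ℕ.m≤n+m (2 * j) E))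
  eq′ : suc n ≡ e + 2 * suc j
  eq′ = trans eq (shuffle e j)
    where
    shuffle : ∀ e j → 2 + e + 2 * j ≡ e + 2 * suc j
    shuffle = solve-∀
  2<P : 2 < 2 ^ E
  2<P = ℕ.≤-trans (ℕ.n≤1+n 3) (ℕ.^-monoʳ-≤ 2 {2} {E} (s≤s (s≤s z≤n)))
  2e≤ : 2 * e ≤ 2 + j
  2e≤ = ℕ.≤-trans (ℕ.*-monoʳ-≤ 2 (ℕ.m≤n+m e 2)) (ℕ.m≤n⇒m≤1+n 2E≤)
... | no 2E≰ with E <? 7
... | yes E<7 = subst (λ m → Drop m E j) (sym (cong pred eq))
  (drops-small E<7 (ℕ.≤-pred (ℕ.≤-trans (ℕ.≰⇒> 2E≰) (ℕ.*-monoʳ-≤ 2 (ℕ.≤-pred E<7)))) 3≤E le (ℕ.≰⇒> 2E≰) (subst (8 ≤_) (cong pred eq) 8≤n))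
... | no E≮7 = drop-slope (2 ^ E) (2 * E + j) (L n j) (L n (suc j)) (L n (2 + j)) pos S<P (L-slope e j eq le) (L-half E j eq le)
  (L-half e (suc j) eq′ (ℕ.≤-trans (ℕ.m≤n+m e 2) (ℕ.m≤n⇒m≤1+n le)))
  where
  pos = L-positive n j (subst (2 * j ≤_) (sym eq) (ℕ.m≤n+m (2 * j) E))
  eq′ : suc n ≡ e + 2 * suc j
  eq′ = trans eq (shuffle e j)
    where
    shuffle : ∀ e j → 2 + e + 2 * j ≡ e + 2 * suc j
    shuffle = solve-∀
  S<P : 3 * (2 * E + j) < 2 ^ E
  S<P = ℕ.≤-<-trans
    (ℕ.≤-trans (ℕ.*-monoʳ-≤ 3 (ℕ.+-monoʳ-≤ (2 * E) (ℕ.≤-trans (ℕ.n≤1+n j) (ℕ.≤-trans (ℕ.n≤1+n (suc j)) (ℕ.≰⇒> 2E≰)))))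
      (ℕ.≤-reflexive (shuffle E)))
    (subst (λ m → 12 * m < 2 ^ m) (ℕ.m+[n∸m]≡n (ℕ.≮⇒≥ E≮7)) (12*<2^ (E ∸ 7)))
    where
    shuffle : ∀ E → 3 * (2 * E + 2 * E) ≡ 12 * E
    shuffle = solve-∀

-- Support and peak of `F`.

-- That the subtraction in `F` is exact is taken from `S₇`, whose genus counts are the values of
-- `F`.
F-equation : ∀ n j → F n (suc j) + 8 ^ j * L n j ≡ 2 ^ (n + suc j) * L n j + 8 ^ suc j * L n (suc j)
F-equation n j = trans (cong (_+ 8 ^ j * L n j) (sym (Distribution₇.D≡F n (suc j)))) (Distribution₇.D-equation n j)

2^-split : ∀ {n} E j → suc n ≡ E + 2 * j → 2 ^ (n + suc j) ≡ 2 ^ E * 8 ^ j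
2^-split {n} E j eq = begin-equality
  2 ^ (n + suc j)       ≡⟨ cong (2 ^_) (trans (ℕ.+-suc n j) (trans (cong (_+ j) eq) (shuffle E j))) ⟩
  2 ^ (E + 3 * j)       ≡⟨ ℕ.^-distribˡ-+-* 2 E (3 * j) ⟩
  2 ^ E * 2 ^ (3 * j)   ≡⟨ cong (2 ^ E *_) (ℕ.^-*-assoc 2 3 j) ⟨
  2 ^ E * 8 ^ j         ∎
  where
  shuffle : ∀ E j → E + 2 * j + j ≡ E + 3 * j
  shuffle = solve-∀

module _ {n} E j (eq : suc n ≡ E + 2 * j) where

  private
    q  = 8 ^ j
    P  = 2 ^ E
    l₀ = L n j
    l₁ = L n (suc j)
    l₂ = L n (2 + j)
    instance
      q≢0 : NonZero (8 ^ j)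
      q≢0 = ℕ.m^n≢0 8 j

  F-E : F n (suc j) + q * l₀ ≡ P * q * l₀ + 8 * q * l₁
  F-E = trans (F-equation n j) (cong (λ m → m * l₀ + 8 * q * l₁) (2^-split E j eq))

  private
    F-E′ : F n (2 + j) + 8 * q * l₁ ≡ 2 * (P * q) * l₁ + 8 * (8 * q) * l₂
    F-E′ = trans (F-equation n (suc j)) (cong (λ m → m * l₁ + 8 * (8 * q) * l₂)
      (trans (cong (2 ^_) (ℕ.+-suc n (suc j))) (cong (2 *_) (2^-split E j eq))))

    left : F n (suc j) + (q * l₀ + 8 * q * l₁) ≡ q * (P * l₀ + 16 * l₁)
    left = trans (sym (ℕ.+-assoc (F n (suc j)) _ _)) (trans (cong (_+ 8 * q * l₁) F-E) (shuffle q P l₀ l₁))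
      where
      shuffle : ∀ q P l₀ l₁ → P * q * l₀ + 8 * q * l₁ + 8 * q * l₁ ≡ q * (P * l₀ + 16 * l₁)
      shuffle = solve-∀

    right : F n (2 + j) + (q * l₀ + 8 * q * l₁) ≡ q * (2 * (P * l₁) + 64 * l₂ + l₀)
    right = trans (shuffle₁ (F n (2 + j)) (q * l₀) (8 * q * l₁))
      (trans (cong (_+ q * l₀) F-E′) (shuffle₂ q P l₀ l₁ l₂))
      where
      shuffle₁ : ∀ c x y → c + (x + y) ≡ c + y + x
      shuffle₁ = solve-∀
      shuffle₂ : ∀ q P l₀ l₁ l₂ → 2 * (P * q) * l₁ + 8 * (8 * q) * l₂ + q * l₀ ≡ q * (2 * (P * l₁) + 64 * l₂ + l₀)
      shuffle₂ = solve-∀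

  F-rises : 8 ≤ n → 2 + j ≤ E → F n (suc j) < F n (2 + j)
  F-rises 8≤n le = ℕ.+-cancelʳ-< (q * l₀ + 8 * q * l₁) (F n (suc j)) (F n (2 + j)) (begin-strict
    F n (suc j) + (q * l₀ + 8 * q * l₁) ≡⟨ left ⟩
    q * (P * l₀ + 16 * l₁)                   <⟨ ℕ.*-monoʳ-< q (rises E j 8≤n eq le) ⟩
    q * (2 * (P * l₁) + 64 * l₂ + l₀)        ≡⟨ right ⟨
    F n (2 + j) + (q * l₀ + 8 * q * l₁) ∎)

  F-drops : 8 ≤ n → 3 ≤ E → E ≤ suc j → F n (2 + j) < F n (suc j)
  F-drops 8≤n 3≤E le = ℕ.+-cancelʳ-< (q * l₀ + 8 * q * l₁) (F n (2 + j)) (F n (suc j)) (begin-strict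
    F n (2 + j) + (q * l₀ + 8 * q * l₁) ≡⟨ right ⟩
    q * (2 * (P * l₁) + 64 * l₂ + l₀)        <⟨ ℕ.*-monoʳ-< q (drops E j 8≤n eq 3≤E le) ⟩
    q * (P * l₀ + 16 * l₁)                   ≡⟨ left ⟨
    F n (suc j) + (q * l₀ + 8 * q * l₁) ∎)

F-positive : ∀ n j → 2 * j ≤ n → 0 < F n (suc j)
F-positive n j le = ℕ.+-cancelʳ-< (8 ^ j * L n j) 0 (F n (suc j)) (begin-strict
  8 ^ j * L n j                                     <⟨ ℕ.m<n+m (8 ^ j * L n j) pos ⟩
  8 ^ j * L n j + 8 ^ j * L n j                     ≡⟨ shuffle (8 ^ j) (L n j) ⟩
  2 * 8 ^ j * L n j                                 ≤⟨ ℕ.*-monoˡ-≤ (L n j) (ℕ.*-monoˡ-≤ (8 ^ j) 2≤) ⟩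
  2 ^ E * 8 ^ j * L n j                             ≤⟨ ℕ.m≤m+n _ _ ⟩
  2 ^ E * 8 ^ j * L n j + 8 ^ suc j * L n (suc j)   ≡⟨ F-E E j eq ⟨
  F n (suc j) + 8 ^ j * L n j                  ∎)
  where
  E = suc (n ∸ 2 * j)
  eq : suc n ≡ E + 2 * j
  eq = cong suc (sym (ℕ.m∸n+n≡m le))
  2≤ : 2 ≤ 2 ^ E
  2≤ = ℕ.^-monoʳ-≤ 2 {1} {E} (s≤s z≤n)
  instance
    q≢0 : NonZero (8 ^ j)
    q≢0 = ℕ.m^n≢0 8 j
  pos : 0 < 8 ^ j * L n j
  pos = subst (_< 8 ^ j * L n j) (ℕ.*-zeroʳ (8 ^ j)) (ℕ.*-monoʳ-< (8 ^ j) (L-positive n j (ℕ.m≤n⇒m≤1+n le)))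
  shuffle : ∀ q l → q * l + q * l ≡ 2 * q * l
  shuffle = solve-∀

-- At the boundary `2 * j = suc n` the entry `L n j` is still positive, but its coefficient
-- `2 ^ 0 - 1` vanishes.
F-zero : ∀ n j → n < 2 * j → F n (suc j) ≡ 0
F-zero n j lt with ℕ.m≤n⇒m<n∨m≡n lt
... | inj₁ lt′ = ℕ.m+n≡0⇒m≡0 (F n (suc j)) (trans (F-equation n j)
  (cong₂ _+_ (trans (cong (2 ^ (n + suc j) *_) (L-zero n j lt′)) (ℕ.*-zeroʳ (2 ^ (n + suc j))))
    (trans (cong (8 ^ suc j *_) (L-zero n (suc j) (ℕ.<-trans lt′ (ℕ.*-monoʳ-< 2 (ℕ.n<1+n j))))) (ℕ.*-zeroʳ (8 ^ suc j)))))
... | inj₂ eq = ℕ.+-cancelʳ-≡ (8 ^ j * L n j) (F n (suc j)) 0 (begin-equality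
  F n (suc j) + 8 ^ j * L n j             ≡⟨ F-E 0 j eq ⟩
  1 * 8 ^ j * L n j + 8 ^ suc j * L n (suc j)  ≡⟨ cong₂ _+_ (cong (_* L n j) (ℕ.*-identityˡ (8 ^ j)))
                                                   (trans (cong (8 ^ suc j *_) (L-suc-zero 0 j eq (s≤s z≤n))) (ℕ.*-zeroʳ (8 ^ suc j))) ⟩
  8 ^ j * L n j + 0                            ≡⟨ ℕ.+-identityʳ _ ⟩
  8 ^ j * L n j                                ∎)

-- The bound is 4 + 2: `F₁₀` subtracts 2 at genus 1 and must still exceed its value 4 at genus 0.
F-1 : ∀ {n} → 1 ≤ n → 6 < F n 1
F-1 {suc n} _ = ℕ.+-cancelʳ-< 2 6 (F (suc n) 1) (begin-strict
  8                                                          <⟨ ℕ.m<m+n 8 (ℕ.*-monoʳ-< 8 (L-positive (suc n) 1 (s≤s (s≤s z≤n)))) ⟩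
  8 + 8 * L (suc n) 1                                        ≤⟨ ℕ.+-monoˡ-≤ (8 * L (suc n) 1) (ℕ.*-monoˡ-≤ 2 (ℕ.^-monoʳ-≤ 2 {2} {suc n + 1} 2≤)) ⟩
  2 ^ (suc n + 1) * 2 + 8 * L (suc n) 1                      ≡⟨ F-equation (suc n) 0 ⟨
  F (suc n) 1 + 2                                       ∎)
  where
  2≤ : 2 ≤ suc n + 1
  2≤ = s≤s (ℕ.m≤n+m 1 n)

Peaked : (f : ℕ → ℕ) (p r : ℕ) → Set
Peaked f p r = p ≤ r × (∀ {i} → i < p → f i < f (suc i)) × (∀ {i} → i < r → p ≤ i → f (suc i) < f i)

peaked? : ∀ f p r → Dec (Peaked f p r)
peaked? f p r = (p ≤? r) ×-dec ℕ.allUpTo? (λ i → f i <? f (suc i)) p ×-dec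
  ℕ.allUpTo? (λ i → (p ≤? i) →-dec (f (suc i) <? f i)) r

maxGenus : ℕ → ℕ
maxGenus n = n / 2 + 1

module _ {n} (8≤n : 8 ≤ n) where

  private
    p = (n + 2) / 3

    3p≤ : 3 * p ≤ n + 2
    3p≤ = ℕ.≤-trans (ℕ.≤-reflexive (ℕ.*-comm 3 p)) (m/n*n≤m (n + 2) 3)

    ≤3p : n ≤ 3 * p
    ≤3p = ℕ.+-cancelʳ-≤ 2 n (3 * p) (begin
      n + 2                    ≡⟨ m≡m%n+[m/n]*n (n + 2) 3 ⟩
      (n + 2) % 3 + p * 3      ≤⟨ ℕ.+-monoˡ-≤ (p * 3) (ℕ.≤-pred (m%n<n (n + 2) 3)) ⟩
      2 + p * 3                ≡⟨ trans (ℕ.+-comm 2 (p * 3)) (cong (_+ 2) (ℕ.*-comm p 3)) ⟩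
      3 * p + 2                ∎)

    p≤n/2 : p ≤ n / 2
    p≤n/2 = subst (_≤ n / 2) (m*n/n≡m p 2) (/-monoˡ-≤ {p * 2} {n} 2 (ℕ.*-cancelˡ-≤ {p * 2} {n} 3 (begin
      3 * (p * 2)    ≡⟨ shuffle p ⟩
      2 * (3 * p)    ≤⟨ ℕ.*-monoʳ-≤ 2 3p≤ ⟩
      2 * (n + 2)    ≡⟨ ℕ.*-distribˡ-+ 2 n 2 ⟩
      2 * n + 4      ≤⟨ ℕ.+-monoʳ-≤ (2 * n) (ℕ.≤-trans (ℕ.m≤m+n 4 4) 8≤n) ⟩
      2 * n + n      ≡⟨ ℕ.+-comm (2 * n) n ⟩
      3 * n          ∎)))
      where
      shuffle : ∀ p → 3 * (p * 2) ≡ 2 * (3 * p)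
      shuffle = solve-∀

  -- With `E = suc n ∸ 2 * j`, the rise condition `2 + j ≤ E` says `3 * suc j ≤ n + 2`, that is
  -- `j < p`, and `E ≤ suc j` says `n ≤ 3 * j`, which follows from `p ≤ j`. Below the top genus `E`
  -- is at least 3, as `F-drops` requires.
  peaked-F : Peaked (F n) ((n + 2) / 3 + 1) (maxGenus n)
  peaked-F = ℕ.+-monoˡ-≤ 1 p≤n/2 , ascends , descends
    where
    ascends : ∀ {i} → i < p + 1 → F n i < F n (suc i)
    ascends {zero}  _  = ℕ.≤-trans (ℕ.m≤m+n 3 4) (F-1 (ℕ.≤-trans (s≤s z≤n) 8≤n))
    ascends {suc j} lt = F-rises (suc n ∸ 2 * j) j
      (sym (ℕ.m∸n+n≡m (ℕ.≤-trans (ℕ.m≤n+m (2 * j) (2 + j)) sum≤))) 8≤n (ℕ.m+n≤o⇒m≤o∸n (2 + j) sum≤)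
      where
      j<p : j < p
      j<p = ℕ.≤-pred (subst (suc j <_) (ℕ.+-comm p 1) lt)
      sum≤ : 2 + j + 2 * j ≤ suc n
      sum≤ = ℕ.+-cancelʳ-≤ 1 (2 + j + 2 * j) (suc n) (begin
        2 + j + 2 * j + 1  ≡⟨ shuffle j ⟩
        3 * suc j          ≤⟨ ℕ.*-monoʳ-≤ 3 j<p ⟩
        3 * p              ≤⟨ 3p≤ ⟩
        n + 2              ≡⟨ ℕ.+-suc n 1 ⟩
        suc n + 1          ∎)
        where
        shuffle : ∀ j → 2 + j + 2 * j + 1 ≡ 3 * suc j
        shuffle = solve-∀

    descends : ∀ {i} → i < maxGenus n → p + 1 ≤ i → F n (suc i) < F n i
    descends {zero}  _  le = contradiction (subst (_≤ 0) (ℕ.+-comm p 1) le) λ ()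
    descends {suc j} lt le = F-drops (suc n ∸ 2 * j) j (sym (ℕ.m∸n+n≡m 2j≤)) 8≤n (ℕ.m+n≤o⇒m≤o∸n 3 3+2j≤)
      (ℕ.m≤n+o⇒m∸n≤o (suc n) (2 * j) (begin
        suc n            ≤⟨ s≤s ≤3p ⟩
        suc (3 * p)      ≤⟨ s≤s (ℕ.*-monoʳ-≤ 3 p≤j) ⟩
        suc (3 * j)      ≡⟨ shuffle j ⟩
        2 * j + suc j    ∎))
      where
      p≤j : p ≤ j
      p≤j = ℕ.≤-pred (subst (_≤ suc j) (ℕ.+-comm p 1) le)
      j<n/2 : j < n / 2
      j<n/2 = ℕ.≤-pred (subst (suc j <_) (ℕ.+-comm (n / 2) 1) lt)
      3+2j≤ : 3 + 2 * j ≤ suc n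
      3+2j≤ = s≤s (begin
        2 + 2 * j        ≡⟨ ℕ.*-suc 2 j ⟨
        2 * suc j        ≤⟨ ℕ.*-monoʳ-≤ 2 j<n/2 ⟩
        2 * (n / 2)      ≡⟨ ℕ.*-comm 2 (n / 2) ⟩
        n / 2 * 2        ≤⟨ m/n*n≤m n 2 ⟩
        n                ∎)
      2j≤ : 2 * j ≤ suc n
      2j≤ = ℕ.≤-trans (ℕ.m≤n+m (2 * j) 3) 3+2j≤
      shuffle : ∀ j → suc (3 * j) ≡ 2 * j + suc j
      shuffle = solve-∀

-- Four times the distribution of S₁₀ n.
F₁₀ : ℕ → ℕ → ℕ
F₁₀ n zero          = 4
F₁₀ n (suc zero)    = F n 1 ∸ 2
F₁₀ n (suc (suc g)) = F n (2 + g)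

-- Lowering the value at genus 1 only helps the ascent from 1 to 2, and `2 ≤ p` keeps the descent
-- away from it; the ascent from 0 is `F-1`.
peaked₁₀ : ∀ {n p r} → 1 ≤ n → 2 ≤ p → Peaked (F n) p r → Peaked (F₁₀ n) p r
peaked₁₀ {n} {p} {r} 1≤n 2≤p (p≤r , ascends , descends) = p≤r , ascends′ , descends′
  where
  ascends′ : ∀ {i} → i < p → F₁₀ n i < F₁₀ n (suc i)
  ascends′ {zero}        _  = ℕ.∸-monoˡ-≤ 2 (F-1 1≤n)
  ascends′ {suc zero}    lt = ℕ.≤-<-trans (ℕ.m∸n≤m _ 2) (ascends lt)
  ascends′ {suc (suc i)} lt = ascends lt

  descends′ : ∀ {i} → i < r → p ≤ i → F₁₀ n (suc i) < F₁₀ n i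
  descends′ {zero}        _  le = contradiction (ℕ.≤-trans 2≤p le) λ ()
  descends′ {suc zero}    _  le = contradiction (ℕ.≤-trans 2≤p le) λ { (s≤s ()) }
  descends′ {suc (suc i)} lt le = descends lt le

peaks-small : ∀ {n} → n < 7 → 1 ≤ n →
  Peaked (F n) ((n + 1) / 2) (maxGenus n) × Peaked (F₁₀ n) ((n + 1) / 2) (maxGenus n)
peaks-small = toWitness {a? = ℕ.allUpTo? (λ n → (1 ≤? n) →-dec
  peaked? (F n) ((n + 1) / 2) (maxGenus n) ×-dec peaked? (F₁₀ n) ((n + 1) / 2) (maxGenus n)) 7} tt

-- Both general formulas would give 4. At `j = 2` the leading terms favour a rise, as 25 ≤ 2 * 14,
-- but `L 7 4 = 1` is too small for the remainder to follow. This serves `S₇ 8` and `S₁₀ 7`.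
peaked-7 : Peaked (F 7) 3 (maxGenus 7)
peaked-7 = toWitness {a? = peaked? (F 7) 3 (maxGenus 7)} tt

F-max : ∀ n → 0 < F n (maxGenus n)
F-max n = subst (λ i → 0 < F n i) (ℕ.+-comm 1 (n / 2))
  (F-positive n (n / 2) (ℕ.≤-trans (ℕ.≤-reflexive (ℕ.*-comm 2 (n / 2))) (m/n*n≤m n 2)))

F-above : ∀ n i → maxGenus n < i → F n i ≡ 0
F-above n (suc j) lt = F-zero n j (begin-strict
  n                    ≡⟨ m≡m%n+[m/n]*n n 2 ⟩
  n % 2 + n / 2 * 2    <⟨ ℕ.+-monoˡ-< (n / 2 * 2) (m%n<n n 2) ⟩
  2 + n / 2 * 2        ≡⟨ ℕ.*-comm (suc (n / 2)) 2 ⟩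
  2 * suc (n / 2)      ≤⟨ ℕ.*-monoʳ-≤ 2 (ℕ.≤-pred (subst (_< suc j) (ℕ.+-comm (n / 2) 1) lt)) ⟩
  2 * j                ∎)

-- From `F` to the genus distributions.

module _ (S : List Word) (c : ℕ) .{{_ : NonZero c}} (f : ℕ → ℕ) (r : ℕ)
  (count : ∀ i → c * genusCount S i ≡ f i)
  (f₀ : 0 < f 0) (fᵣ : 0 < f r) (above : ∀ i → r < i → f i ≡ 0) where

  private
    reflect-< : ∀ i j → f i < f j → genusCount S i < genusCount S j
    reflect-< i j lt = ℕ.*-cancelˡ-< c (genusCount S i) (genusCount S j)
      (subst (_< c * genusCount S j) (sym (count i)) (subst (f i <_) (sym (count j)) lt))

    reflect-pos : ∀ i → 0 < f i → 0 < genusCount S i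
    reflect-pos i pos = ℕ.*-cancelˡ-< c 0 (genusCount S i)
      (subst (_< c * genusCount S i) (sym (ℕ.*-zeroʳ c)) (subst (0 <_) (sym (count i)) pos))

  minGenus : IsMinGenus S 0
  minGenus = reflect-pos 0 f₀ , λ _ _ → z≤n

  isMaxGenus : IsMaxGenus S r
  isMaxGenus = reflect-pos r fᵣ , λ i pos → ℕ.≮⇒≥ λ r<i →
    ℕ.<⇒≢ pos (sym (ℕ.m*n≡0⇒m≡0 (genusCount S i) c
      (trans (ℕ.*-comm (genusCount S i) c) (trans (count i) (above i r<i)))))

  distributionPeak : ∀ {p} → Peaked f p r → DistributionPeak S p
  distributionPeak {p} (p≤r , ascends , descends) = 0 , r , minGenus , isMaxGenus , record
    { q≤l     = z≤n
    ; l≤m     = ℕ.≤-refl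
    ; m≤r     = p≤r
    ; ascent  = λ i _ lt → ℕ.<⇒≤ (reflect-< i (suc i) (ascends (ℕ.<-trans (ℕ.n<1+n i) lt)))
    ; jump    = λ { i _ refl → reflect-< i (suc i) (ascends ℕ.≤-refl) }
    ; plateau = λ i p≤i i<p → contradiction i<p (ℕ.≤⇒≯ p≤i)
    ; drop    = λ p<r → reflect-< (suc p) p (descends p<r ℕ.≤-refl)
    ; descent = λ i p<i i<r → ℕ.<⇒≤ (reflect-< (suc i) i (descends i<r (ℕ.<⇒≤ p<i)))
    }

count₇ : ∀ n i → 1 * genusCount (S₇ (suc n)) i ≡ F n i
count₇ n i = trans (ℕ.*-identityˡ _) (trans (genusCount₇ (suc n) i) (Distribution₇.D≡F n i))

count₁₀ : ∀ n i → 4 * genusCount (S₁₀ n) i ≡ F₁₀ n i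
count₁₀ n i = trans (cong (4 *_) (genusCount₁₀ n i)) (value i)
  where
  value : ∀ i → 4 * #genus κ₁₀ 14∣2y∣3z n i ≡ F₁₀ n i
  value zero          = cong (4 *_) (Distribution₁₀.A-zero n)
  value (suc zero)    = trans (sym (ℕ.m+n∸n≡m (4 * #genus κ₁₀ 14∣2y∣3z n 1) 2)) (cong (_∸ 2) (Distribution₁₀.A₁-F n))
  value (suc (suc g)) = Distribution₁₀.A-F n g

peak₇ : ∀ n {p} → Peaked (F n) p (maxGenus n) → DistributionPeak (S₇ (suc n)) p
peak₇ n = distributionPeak (S₇ (suc n)) 1 (F n) (maxGenus n) (count₇ n) (s≤s z≤n) (F-max n) (F-above n)

peak₁₀ : ∀ n {p} → 1 ≤ n → Peaked (F₁₀ n) p (maxGenus n) → DistributionPeak (S₁₀ n) p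
peak₁₀ n 1≤n = distributionPeak (S₁₀ n) 4 (F₁₀ n) (maxGenus n) (count₁₀ n) (s≤s z≤n)
  (max (maxGenus n) (F-max n)) above
  where
  max : ∀ r → 0 < F n r → 0 < F₁₀ n r
  max zero          _   = s≤s z≤n
  max (suc zero)    _   = ℕ.≤-trans (s≤s z≤n) (ℕ.∸-monoˡ-≤ 2 (F-1 1≤n))
  max (suc (suc g)) pos = pos
  above : ∀ i → maxGenus n < i → F₁₀ n i ≡ 0
  above (suc zero)    lt = contradiction (subst (_< 1) (ℕ.+-comm (n / 2) 1) lt) λ { (s≤s ()) }
  above (suc (suc g)) lt = F-above n (2 + g) lt

unimodal : ∀ S {p} → DistributionPeak S p → UnimodalDistribution S
unimodal S (q , r , min , max , peak) = q , r , min , max , _ , _ , peak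

-- The distribution is 2, 2: a plateau without a single peak, so this case cannot go through
-- `DistributionPeak`.
unimodal-S₇-1 : UnimodalDistribution (S₇ 1)
unimodal-S₇-1 = 0 , 1 , minGenus (S₇ 1) 1 (F 0) 1 (count₇ 0) (s≤s z≤n) (F-max 0) (F-above 0)
  , isMaxGenus (S₇ 1) 1 (F 0) 1 (count₇ 0) (s≤s z≤n) (F-max 0) (F-above 0) , 0 , 1 , record
  { q≤l     = z≤n
  ; l≤m     = z≤n
  ; m≤r     = ℕ.≤-refl
  ; ascent  = λ _ _ ()
  ; jump    = λ _ _ ()
  ; plateau = λ { zero _ _ → trans (equal 0) (sym (equal 1)) ; (suc _) _ (s≤s ()) }
  ; drop    = λ { (s≤s ()) }
  ; descent = λ i 1<i i<1 → contradiction i<1 (ℕ.<⇒≯ 1<i)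
  }
  where
  equal : ∀ i → genusCount (S₇ 1) i ≡ F 0 i
  equal i = trans (sym (ℕ.*-identityˡ _)) (count₇ 0 i)

peak₇-small : ∀ n → 2 ≤ n → n ≤ 7 → DistributionPeak (S₇ n) (n / 2)
-- `F n` belongs to `S₇ (suc n)`, so the table for `n < 7` covers sizes up to 7.
peak₇-small (suc n) (s≤s 1≤n) n<7 = subst (λ m → DistributionPeak (S₇ (suc n)) (m / 2)) (ℕ.+-comm n 1)
  (peak₇ n (proj₁ (peaks-small n<7 1≤n)))

peak₇-large : ∀ n → 9 ≤ n → DistributionPeak (S₇ n) ((n + 1) / 3 + 1)
peak₇-large (suc n) (s≤s 8≤n) = subst (λ m → DistributionPeak (S₇ (suc n)) (m / 3 + 1)) (ℕ.+-suc n 1)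
  (peak₇ n (peaked-F 8≤n))

peak₁₀-small : ∀ n → 1 ≤ n → n ≤ 6 → DistributionPeak (S₁₀ n) ((n + 1) / 2)
peak₁₀-small n 1≤n n≤6 = peak₁₀ n 1≤n (proj₂ (peaks-small (s≤s n≤6) 1≤n))

peak₁₀-large : ∀ n → 8 ≤ n → DistributionPeak (S₁₀ n) ((n + 2) / 3 + 1)
peak₁₀-large n 8≤n = peak₁₀ n 1≤n (peaked₁₀ 1≤n 2≤p (peaked-F 8≤n))
  where
  1≤n = ℕ.≤-trans (s≤s z≤n) 8≤n
  2≤p : 2 ≤ (n + 2) / 3 + 1
  2≤p = ℕ.+-monoˡ-≤ 1 (ℕ.≤-trans (s≤s z≤n) (/-monoˡ-≤ {10} {n + 2} 3 (ℕ.+-monoˡ-≤ 2 8≤n)))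

-- Stated for a variable n, since comparing S₇ 8 with S₇ (suc 7) makes Agda enumerate both lists.
peak₇-8 : ∀ n → n ≡ 8 → DistributionPeak (S₇ n) 3
peak₇-8 (suc m) e = peak₇ m (subst (λ m → Peaked (F m) 3 (maxGenus m)) (sym (ℕ.suc-injective e)) peaked-7)

peak₁₀-7 : ∀ n → n ≡ 7 → DistributionPeak (S₁₀ n) 3
peak₁₀-7 n e = peak₁₀ n 1≤n (peaked₁₀ 1≤n (s≤s (s≤s z≤n))
  (subst (λ m → Peaked (F m) 3 (maxGenus m)) (sym e) peaked-7))
  where
  1≤n : 1 ≤ n
  1≤n = subst (1 ≤_) (sym e) (s≤s z≤n)

unimodal₇ : ∀ n → 1 ≤ n → UnimodalDistribution (S₇ n)
unimodal₇ n 1≤n = from₁ (ℕ.m≤n⇒m<n∨m≡n 1≤n)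
  where
  from₈ : 9 ≤ n ⊎ 8 ≡ n → UnimodalDistribution (S₇ n)
  from₈ (inj₁ 9≤n)  = unimodal (S₇ n) (peak₇-large n 9≤n)
  from₈ (inj₂ 8≡n)  = unimodal (S₇ n) (peak₇-8 n (sym 8≡n))
  from₂ : 2 ≤ n → Dec (n ≤ 7) → UnimodalDistribution (S₇ n)
  from₂ 2≤n (yes n≤7) = unimodal (S₇ n) (peak₇-small n 2≤n n≤7)
  from₂ 2≤n (no  n≰7) = from₈ (ℕ.m≤n⇒m<n∨m≡n (ℕ.≰⇒> n≰7))
  from₁ : 2 ≤ n ⊎ 1 ≡ n → UnimodalDistribution (S₇ n)
  from₁ (inj₁ 2≤n)  = from₂ 2≤n (n ≤? 7)
  from₁ (inj₂ 1≡n)  = subst (λ n → UnimodalDistribution (S₇ n)) 1≡n unimodal-S₇-1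

unimodal₁₀ : ∀ n → 1 ≤ n → UnimodalDistribution (S₁₀ n)
unimodal₁₀ n 1≤n = from₁ (n ≤? 6)
  where
  from₇ : 8 ≤ n ⊎ 7 ≡ n → UnimodalDistribution (S₁₀ n)
  from₇ (inj₁ 8≤n)  = unimodal (S₁₀ n) (peak₁₀-large n 8≤n)
  from₇ (inj₂ 7≡n)  = unimodal (S₁₀ n) (peak₁₀-7 n (sym 7≡n))
  from₁ : Dec (n ≤ 6) → UnimodalDistribution (S₁₀ n)
  from₁ (yes n≤6) = unimodal (S₁₀ n) (peak₁₀-small n 1≤n n≤6)
  from₁ (no  n≰6) = from₇ (ℕ.m≤n⇒m<n∨m≡n (ℕ.≰⇒> n≰6))

corollary3p10 : (∀ (n : ℕ) → 1 ≤ n → UnimodalDistribution (S₇ n) × UnimodalDistribution (S₁₀ n))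
    × ((∀ (n : ℕ) → 2 ≤ n → n ≤ 7 → DistributionPeak (S₇ n) (n / 2))
    × DistributionPeak (S₇ 8) 3
    × (∀ (n : ℕ) → 9 ≤ n → DistributionPeak (S₇ n) ((n + 1) / 3 + 1)))
    × ((∀ (n : ℕ) → 1 ≤ n → n ≤ 6 → DistributionPeak (S₁₀ n) ((n + 1) / 2))
    × DistributionPeak (S₁₀ 7) 3
    × (∀ (n : ℕ) → 8 ≤ n → DistributionPeak (S₁₀ n) ((n + 2) / 3 + 1)))
corollary3p10 =
  (λ n 1≤n → unimodal₇ n 1≤n , unimodal₁₀ n 1≤n)
  , (peak₇-small , peak₇-8 8 refl , peak₇-large)
  , (peak₁₀-small , peak₁₀-7 7 refl , peak₁₀-large)
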